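{- Let $I_n$ denote the number of isolated vertices of the random Catalan-pair graph $CP_n$, and let \[ \gamma = 4 \sum_{m=1}^{\infty} 16^{ -m} \sum_{b=0}^{m-1} \binom{2m-2}{2b} C_{m-1-b}\, C_b \;(=0.3023\ldots), \] where $C_j=\frac{1}{j+1}\binom{2j}{j}$. Then $\mathbb{E}[I_n]\sim \gamma n$ as $n\to\infty$, and for every $\epsilon>0$, $\Pr[|I_n-\gamma n|<\epsilon n]\to 1$ as $n\to\infty$.
   Context: For a finite set $S$ of $2m$ points on a line, a Catalan-arc matching of $S$ is a perfect matching of $S$ into pairs ("arcs") such that there are no two arcs $\{a,c\},\{b,d\}$ with $a<b<c<d$; there are $C_m$ of them. The random graph $CP_n$ is generated as follows. Take the points $1,2,\dots,2n$ on a line. Color each of the points $1,\dots,2n-1$ red or blue independently and uniformly at random, and color point $2n$ so that the total number of red points is even. Then choose, independently and uniformly at random, a Catalan-arc matching of the red points and a Catalan-arc matching of the blue points. $CP_n$ has one vertex for each of the $n$ arcs, and two vertices are adjacent iff the endpoints of their arcs alternate, i.e. the arcs are $\{a,c\}$ and $\{b,d\}$ with $a<b<c<d$. -}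

module Defs where

open import Data.Bool using (Bool; true; false; not; _∧_; _∨_; T; if_then_else_)
open import Data.Nat as ℕ using (ℕ; zero; suc; _<ᵇ_; _∸_; _^_)
open import Data.Nat.Combinatorics using (_C_)
open import Data.Integer using (+_)
open import Data.List using (List; []; _∷_; [_]; _++_; map; concatMap; length; filterᵇ; foldr; upTo; zip)
open import Data.Bool.ListAction using (and)
open import Data.Product using (_×_; _,_; proj₁; proj₂; Σ; ∃-syntax)
open import Data.Rational using (ℚ; _/_; 0ℚ; _+_; _*_; _-_; _<_; _≤_)

toℚ : ℕ → ℚ
toℚ k = + k / 1

-- 1/k, with the (never used) convention 1/0 = 0
inv : ℕ → ℚ
inv zero    = 0ℚ
inv (suc k) = + 1 / suc k

all : {A : Set} → (A → Bool) → List A → Bool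
all p xs = and (map p xs)

sumℚ : List ℚ → ℚ
sumℚ = foldr _+_ 0ℚ

-- Arcs and matchings.  An arc {a,c} with a < c is stored as the pair (a , c).

Arc : Set
Arc = ℕ × ℕ

Matching : Set
Matching = List Arc

picks : {A : Set} → List A → List (A × List A)
picks []       = []
picks (x ∷ xs) = (x , xs) ∷ map (λ p → proj₁ p , x ∷ proj₂ p) (picks xs)

-- all perfect matchings of a list of points (each exactly once; the first
-- remaining point is matched with some other point).  First argument is fuel.
pm : ℕ → List ℕ → List Matching
pm _       []       = [ [] ]
pm zero    (_ ∷ _)  = []
pm (suc f) (x ∷ xs) =
  concatMap (λ p → map ((x , proj₁ p) ∷_) (pm f (proj₂ p))) (picks xs)

perfectMatchings : List ℕ → List Matching
perfectMatchings xs = pm (length xs) xs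

crossesᵇ : Arc → Arc → Bool
crossesᵇ (a , c) (b , d) = (a <ᵇ b) ∧ ((b <ᵇ c) ∧ (c <ᵇ d))

alternatesᵇ : Arc → Arc → Bool
alternatesᵇ p q = crossesᵇ p q ∨ crossesᵇ q p

noncrossingᵇ : Matching → Bool
noncrossingᵇ M = all (λ p → all (λ q → not (crossesᵇ p q)) M) M

-- all Catalan-arc matchings of a (strictly increasing) list of points
catalanMatchings : List ℕ → List Matching
catalanMatchings S = filterᵇ noncrossingᵇ (perfectMatchings S)

-- all red/blue colourings (true = red) of k points
allColourings : ℕ → List (List Bool)
allColourings zero    = [ [] ]
allColourings (suc k) = concatMap (λ bs → (true ∷ bs) ∷ (false ∷ bs) ∷ []) (allColourings k)

countTrue : List Bool → ℕ
countTrue bs = length (filterᵇ (λ b → b) bs)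

oddᵇ : ℕ → Bool
oddᵇ zero    = false
oddᵇ (suc k) = not (oddᵇ k)

-- colour of point 2n: red iff the first 2n-1 points contain an odd number of reds
fullColouring : List Bool → List Bool
fullColouring c = c ++ [ oddᵇ (countTrue c) ]

points : ℕ → List ℕ
points n = map suc (upTo (2 ℕ.* n))

coloured : ℕ → List Bool → List (ℕ × Bool)
coloured n c = zip (points n) (fullColouring c)

redPoints bluePoints : ℕ → List Bool → List ℕ
redPoints  n c = map proj₁ (filterᵇ proj₂ (coloured n c))
bluePoints n c = map proj₁ (filterᵇ (λ p → not (proj₂ p)) (coloured n c))

-- an outcome: colouring of points 1..2n-1, red matching, blue matching
Outcome : Set
Outcome = List Bool × Matching × Matching

-- the finite probability space of CP_n, as a list of (probability, outcome)
outcomes : ℕ → List (ℚ × Outcome)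
outcomes n = concatMap perColouring (allColourings (2 ℕ.* n ∸ 1))
  where
  perColouring : List Bool → List (ℚ × Outcome)
  perColouring c =
    let R = catalanMatchings (redPoints n c)
        B = catalanMatchings (bluePoints n c)
        w = inv (2 ^ (2 ℕ.* n ∸ 1)) * (inv (length R) * inv (length B))
    in concatMap (λ mr → map (λ mb → w , (c , mr , mb)) B) R

-- vertices of CP_n = arcs of both matchings; number of isolated vertices
isolated : Outcome → ℕ
isolated (_ , mr , mb) =
  let arcs = mr ++ mb in
  length (filterᵇ (λ p → all (λ q → not (alternatesᵇ p q)) arcs) arcs)

expectation : {A : Set} → List (ℚ × A) → (A → ℚ) → ℚ
expectation Ω X = sumℚ (map (λ p → proj₁ p * X (proj₂ p)) Ω)

weightOf : {A : Set} → List (ℚ × A) → (A → Bool) → ℚ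
weightOf Ω s = sumℚ (map proj₁ (filterᵇ (λ p → s (proj₂ p)) Ω))

-- Pr[P] > q : some (decidable) sub-event of P has probability > q
-- (equivalent on a finite space to Pr[P] > q)
ProbGreater : {A : Set} → List (ℚ × A) → (A → Set) → ℚ → Set
ProbGreater {A} Ω P q =
  Σ (A → Bool) λ s → ((a : A) → T (s a) → P a) × (q < weightOf Ω s)

I : ℕ → ℚ
I n = expectation (outcomes n) (λ o → toℚ (isolated o))

-- The constant γ, as the limit of its (increasing) partial sums

catalan : ℕ → ℚ
catalan j = toℚ ((2 ℕ.* j) C j) * inv (suc j)

innerSum : ℕ → ℚ
innerSum m = sumℚ (map (λ b → toℚ ((2 ℕ.* m ∸ 2) C (2 ℕ.* b)) * (catalan (m ∸ 1 ∸ b) * catalan b)) (upTo m))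

γPartial : ℕ → ℚ
γPartial zero    = 0ℚ
γPartial (suc M) = γPartial M + toℚ 4 * (inv (16 ^ suc M) * innerSum (suc M))

BelowGamma : ℚ → Set
BelowGamma q = ∃[ M ] q < γPartial M

AboveGamma : ℚ → Set
AboveGamma q = ∃[ δ ] (0ℚ < δ × ((M : ℕ) → γPartial M + δ ≤ q))

NearGamma : ℚ → ℚ → Set
NearGamma ε x = BelowGamma (x - ε) × AboveGamma (x + ε)

{-# OPTIONS --safe #-}
module Submission where

-- An outcome is read as a word of length 2n over four letters (colour, opening or closing endpoint).
-- There are at least 4^m / poly(m) Catalan-arc matchings of 2m points, so the law of this word has
-- density at most poly(n) with respect to the uniform law on words, and it suffices to show that
-- under the uniform law I_n / n is near γ up to an exponentially small probability.  Scanning the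
-- word after an opening letter decides whether its arc is isolated; the scan ends with "isolated"
-- within 2M letters with probability γPartial M, and the probability that it is undecided after
-- d letters tends to 0 by recurrence of the simple random walk.  Hence the count is additive over
-- long blocks up to a small error.  By Chebyshev, a superblock of many blocks has a count near
-- its mean except with probability at most 4^(-s), and then the probability that at least K/s
-- among K superblocks are exceptional is at most 2^(-K).

-- The comparison with uniform words loses a factor of order n^4, while a variance bound for the
-- whole word gives a failure probability that decays only like 1/n. This is why an exponentially
-- small probability is needed, and why there are two levels of blocks: Chebyshev is used on one
-- superblock only, and independence of the superblocks supplies the exponent. The moment of 4^(s
-- times the number of bad superblocks) replaces a Chernoff bound, so that only powers of integers
-- occur. Most uniform words come from no outcome, as they are not balanced; the scan is therefore
-- defined on all words and may end undecided. The number γ is never available, only its partial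
-- sums. All estimates are made around a rational `g`, twice the mean number of isolated arcs per
-- letter of a block (a vertex takes two letters). It is at most a partial sum of γ, and every
-- partial sum exceeds it by at most 2/s. Isolation is visible from the left endpoint on: an arc is
-- crossed by no arc of the other colour exactly if, during the arc, the height of the other colour
-- never drops below its initial value and is back at that value at the end.

open import Defs
open import Data.Bool using (Bool; true; false; not; _∧_; T; _∨_)
open import Data.List using (List; []; _∷_; _++_; map; concatMap; length; filterᵇ; zip; applyUpTo; drop)
open import Data.List.Properties using (length-++-sucʳ; length-map; length-++; ∷ʳ-injective; ∷-injective; map-applyUpTo; ++-assoc; map-++; map-cong-local)
open import Data.List.Membership.Propositional using (_∈_; _∉_)
open import Data.List.Relation.Unary.Any using (here; there)
open import Data.Product using (_×_; _,_; proj₁; proj₂; ∃₂; ∃-syntax)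
open import Data.Sum using (_⊎_; inj₁; inj₂)
open import Data.Empty using (⊥-elim; ⊥)
open import Function using (_∘_; id)
open import Relation.Nullary using (¬_; yes; no; contradiction; Dec; does)
open import Relation.Binary.PropositionalEquality hiding (J)
open import Data.Bool.Properties using (T-∧; T?; T-∨; not-involutive; ¬-not)
open import Relation.Nullary.Decidable using (dec-true; dec-false)
import Data.Bool.Properties as Bool
import Data.List.Relation.Unary.All as All
import Data.List.Relation.Unary.All.Properties as All
import Data.List.Relation.Unary.AllPairs as AllPairs
import Data.List.Relation.Unary.Unique.Propositional.Properties as Unique

-- Lists without repetition, perfect matchings, and heights of non-crossing matchings.

module Matchings where

  open import Data.Nat
  open import Data.Nat.Properties
  open import Data.List.Membership.Propositional.Properties
  open import Data.List.Relation.Binary.Subset.Propositional using (_⊆_)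
  open import Data.List.Relation.Unary.All using (All; []; _∷_)
  open import Data.List.Relation.Unary.AllPairs using (AllPairs; []; _∷_)
  open import Data.List.Relation.Unary.Unique.Propositional using (Unique)
  open import Function.Bundles using (Equivalence)

  module _ {A : Set} where

    remove-∈ : ∀ {x z : A} ys {zs} → z ∈ ys ++ x ∷ zs → z ≢ x → z ∈ ys ++ zs
    remove-∈ ys z∈ z≢x with ∈-++⁻ ys z∈
    ... | inj₁ p         = ∈-++⁺ˡ p
    ... | inj₂ (here p)  = contradiction p z≢x
    ... | inj₂ (there p) = ∈-++⁺ʳ ys p

    insert-∈ : ∀ {x z : A} ys {zs} → z ∈ ys ++ zs → z ∈ ys ++ x ∷ zs
    insert-∈ ys z∈ with ∈-++⁻ ys z∈
    ... | inj₁ p = ∈-++⁺ˡ p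
    ... | inj₂ p = ∈-++⁺ʳ ys (there p)

    Unique-⊆⇒length-≤ : ∀ {xs ys : List A} → Unique xs → xs ⊆ ys → length xs ≤ length ys
    Unique-⊆⇒length-≤ {[]}     _        _  = z≤n
    Unique-⊆⇒length-≤ {x ∷ xs} (x∉ ∷ u) xs⊆ with ∈-∃++ (xs⊆ (here refl))
    ... | as , bs , refl = subst (suc (length xs) ≤_) (sym (length-++-sucʳ as x bs))
      (s≤s (Unique-⊆⇒length-≤ u
        (λ z∈ → remove-∈ as (xs⊆ (there z∈)) (λ z≡x → All.lookup x∉ z∈ (sym z≡x)))))

    AllPairs-drop-middle : ∀ {R : A → A → Set} xs {y zs} → AllPairs R (xs ++ y ∷ zs) → AllPairs R (xs ++ zs)
    AllPairs-drop-middle []       (_ ∷ rs) = rs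
    AllPairs-drop-middle (x ∷ xs) (r ∷ rs) =
      All.tabulate (λ z∈ → All.lookup r (insert-∈ xs z∈)) ∷ AllPairs-drop-middle xs rs

    Unique-middle : ∀ xs {y : A} {zs} → Unique (xs ++ y ∷ zs) → y ∉ xs ++ zs
    Unique-middle []       (y∉ ∷ _) y∈         = All.lookup y∉ y∈ refl
    Unique-middle (x ∷ xs) (x∉ ∷ _) (here refl) = All.lookup x∉ (∈-++⁺ʳ xs (here refl)) refl
    Unique-middle (x ∷ xs) (_ ∷ u)  (there y∈)  = Unique-middle xs u y∈

    Unique-split : ∀ xs xs′ {y : A} {zs zs′} → Unique (xs ++ y ∷ zs) →
      xs ++ y ∷ zs ≡ xs′ ++ y ∷ zs′ → xs ++ zs ≡ xs′ ++ zs′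
    Unique-split []       []         u refl = refl
    Unique-split []       (x ∷ xs′) (y∉ ∷ _) refl = contradiction refl (All.lookup y∉ (∈-++⁺ʳ xs′ (here refl)))
    Unique-split (x ∷ xs) []         (y∉ ∷ _) refl = contradiction refl (All.lookup y∉ (∈-++⁺ʳ xs (here refl)))
    Unique-split (x ∷ xs) (x′ ∷ xs′) (_ ∷ u) eq with Data.List.Properties.∷-injective eq
    ... | refl , eq′ = cong (x ∷_) (Unique-split xs xs′ u eq′)

    Unique-map-∈ : ∀ {B : Set} (f : A → B) {xs} → Unique xs →
      (∀ {x y} → x ∈ xs → y ∈ xs → f x ≡ f y → x ≡ y) → Unique (map f xs)
    Unique-map-∈ f []       inj = []
    Unique-map-∈ f (x∉ ∷ u) inj =
      All.map⁺ (All.tabulate λ y∈ fx≡fy → All.lookup x∉ y∈ (inj (here refl) (there y∈) fx≡fy))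
      ∷ Unique-map-∈ f u (λ x∈ y∈ → inj (there x∈) (there y∈))

    -- The label `h x` can be read off from any element of `f x` by `key`, so pieces with different
    -- labels are disjoint.
    Unique-concatMap : ∀ {B K : Set} (f : A → List B) (key : B → K) (h : A → K) {xs} →
      (∀ {x y} → y ∈ f x → key y ≡ h x) → (∀ x → x ∈ xs → Unique (f x)) → Unique (map h xs) →
      Unique (concatMap f xs)
    Unique-concatMap f key h {[]}     keyed uf u        = []
    Unique-concatMap f key h {x ∷ xs} keyed uf (x∉ ∷ u) =
      Unique.++⁺ (uf x (here refl)) (Unique-concatMap f key h keyed (λ y → uf y ∘ there) u) disjoint
      where
      disjoint : ∀ {v} → ¬ (v ∈ f x × v ∈ concatMap f xs)
      disjoint (v∈fx , v∈rest) with ∈-concat⁻′ (map f xs) v∈rest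
      ... | ys , v∈ys , ys∈ with ∈-map⁻ f ys∈
      ... | x′ , x′∈ , refl =
        All.lookup x∉ (∈-map⁺ h x′∈) (trans (sym (keyed v∈fx)) (keyed v∈ys))

  ∈-concatMap-intro : ∀ {A B : Set} (f : A → List B) {x xs y} → x ∈ xs → y ∈ f x → y ∈ concatMap f xs
  ∈-concatMap-intro f x∈ y∈ = ∈-concat⁺′ y∈ (∈-map⁺ f x∈)

  ∈-concatMap-elim : ∀ {A B : Set} (f : A → List B) xs {y} → y ∈ concatMap f xs → ∃[ x ] x ∈ xs × y ∈ f x
  ∈-concatMap-elim f xs y∈ with ∈-concat⁻′ (map f xs) y∈
  ... | ys , y∈ys , ys∈ with ∈-map⁻ f ys∈
  ... | x , x∈ , refl = x , x∈ , y∈ys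

  -- `pm` without fuel. Since the first remaining point always gets the next arc, the arcs come in a
  -- fixed order: a matching of a given list of points is represented by one list only.
  data PM : List ℕ → Matching → Set where
    []  : PM [] []
    arc : ∀ {x y M} A B → PM (A ++ B) M → PM (x ∷ A ++ y ∷ B) ((x , y) ∷ M)

  picks-sound : ∀ {A : Set} {y : A} {r} xs → (y , r) ∈ picks xs →
    ∃₂ λ as bs → xs ≡ as ++ y ∷ bs × r ≡ as ++ bs
  picks-sound (x ∷ xs) (here refl) = [] , xs , refl , refl
  picks-sound (x ∷ xs) (there p) with ∈-map⁻ _ p
  ... | (y , r) , q , refl with picks-sound xs q
  ... | as , bs , refl , refl = x ∷ as , bs , refl , refl

  picks-complete : ∀ {A : Set} {y : A} as bs → (y , as ++ bs) ∈ picks (as ++ y ∷ bs)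
  picks-complete []       bs = here refl
  picks-complete (a ∷ as) bs = there (∈-map⁺ _ (picks-complete as bs))

  picks-firsts : ∀ {A : Set} (xs : List A) → map proj₁ (picks xs) ≡ xs
  picks-firsts []       = refl
  picks-firsts (x ∷ xs) = cong (x ∷_)
    (trans (sym (Data.List.Properties.map-∘ (picks xs))) (picks-firsts xs))

  pm-sound : ∀ f {S M} → M ∈ pm f S → PM S M
  pm-sound zero    {[]} (here refl) = []
  pm-sound (suc f) {[]} (here refl) = []
  pm-sound (suc f) {x ∷ xs} M∈ with ∈-concatMap-elim (λ p → map ((x , proj₁ p) ∷_) (pm f (proj₂ p))) (picks xs) M∈
  ... | (y , r) , p∈ , M∈′ with ∈-map⁻ _ M∈′ | picks-sound xs p∈
  ... | M′ , M′∈ , refl | as , bs , refl , refl = arc as bs (pm-sound f M′∈)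

  pm-complete : ∀ f {S M} → length S ≤ f → PM S M → M ∈ pm f S
  pm-complete zero    _ [] = here refl
  pm-complete (suc f) _ [] = here refl
  pm-complete (suc f) (s≤s le) (arc {x} {y} A B p) =
    ∈-concatMap-intro (λ p → map ((x , proj₁ p) ∷_) (pm f (proj₂ p))) (picks-complete A B)
      (∈-map⁺ _ (pm-complete f
        (≤-trans (n≤1+n _) (≤-trans (≤-reflexive (sym (length-++-sucʳ A y B))) le)) p))

  Increasing : List ℕ → Set
  Increasing = AllPairs _<_

  Increasing⇒Unique : ∀ {S} → Increasing S → Unique S
  Increasing⇒Unique = AllPairs.map <⇒≢

  Unique-pm : ∀ f {S} → Unique S → Unique (pm f S)
  Unique-pm zero    {[]}     u = [] ∷ []
  Unique-pm (suc f) {[]}     u = [] ∷ []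
  Unique-pm zero    {x ∷ xs} u = []
  Unique-pm (suc f) {x ∷ xs} (_ ∷ u) =
    Unique-concatMap _ key proj₁ {picks xs} (λ {p} → keyed p) inner (subst Unique (sym (picks-firsts xs)) u)
    where
    key : Matching → ℕ
    key []            = 0
    key ((_ , y) ∷ _) = y
    keyed : ∀ p {M} → M ∈ map ((x , proj₁ p) ∷_) (pm f (proj₂ p)) → key M ≡ proj₁ p
    keyed _ M∈ with ∈-map⁻ _ M∈
    ... | _ , _ , refl = refl
    inner : ∀ p → p ∈ picks xs → Unique (map ((x , proj₁ p) ∷_) (pm f (proj₂ p)))
    inner (y , r) p∈ with picks-sound xs p∈
    ... | as , bs , refl , refl =
      Unique.map⁺ (λ { refl → refl }) (Unique-pm f (AllPairs-drop-middle as u))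

  Disjoint : Arc → Arc → Set
  Disjoint (a , c) (b , d) = a ≢ b × a ≢ d × c ≢ b × c ≢ d

  record WellFormed (M : Matching) : Set where
    field
      ordered  : ∀ {b d} → (b , d) ∈ M → b < d
      disjoint : AllPairs Disjoint M

  open WellFormed

  IsEndpoint : ℕ → Matching → Set
  IsEndpoint z M = (∃[ d ] (z , d) ∈ M) ⊎ (∃[ b ] (b , z) ∈ M)

  PM-endpoints : ∀ {S M b d} → PM S M → (b , d) ∈ M → b ∈ S × d ∈ S
  PM-endpoints (arc A B p) (here refl) = here refl , there (∈-++⁺ʳ A (here refl))
  PM-endpoints (arc A B p) (there q) with PM-endpoints p q
  ... | b∈ , d∈ = there (insert-∈ A b∈) , there (insert-∈ A d∈)

  PM-covers : ∀ {S M z} → PM S M → z ∈ S → IsEndpoint z M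
  PM-covers (arc A B p) (here refl) = inj₁ (_ , here refl)
  PM-covers {z = z} (arc {y = y} A B p) (there z∈) with z ≟ y
  ... | yes refl = inj₂ (_ , here refl)
  ... | no  z≢y with PM-covers p (remove-∈ A z∈ z≢y)
  ... | inj₁ (d , q) = inj₁ (d , there q)
  ... | inj₂ (b , q) = inj₂ (b , there q)

  PM-wellFormed : ∀ {S M} → Increasing S → PM S M → WellFormed M
  PM-wellFormed inc [] = record { ordered = λ () ; disjoint = [] }
  PM-wellFormed (x< ∷ inc) (arc {x} {y} {M} A B p) = record
    { ordered  = λ { (here refl) → All.lookup x< (∈-++⁺ʳ A (here refl)) ; (there q) → ordered ih q }
    ; disjoint = All.tabulate separate ∷ disjoint ih }
    where
    ih : WellFormed M
    ih = PM-wellFormed (AllPairs-drop-middle A inc) p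
    x∉ : ∀ {z} → z ∈ A ++ B → x ≢ z
    x∉ z∈ = <⇒≢ (All.lookup x< (insert-∈ A z∈))
    y∉ : ∀ {z} → z ∈ A ++ B → y ≢ z
    y∉ z∈ refl = Unique-middle A (Increasing⇒Unique inc) z∈
    separate : ∀ {q} → q ∈ M → Disjoint (x , y) q
    separate q∈ with PM-endpoints p q∈
    ... | b∈ , d∈ = x∉ b∈ , x∉ d∈ , y∉ b∈ , y∉ d∈

  Disjoint-sym : ∀ {p q} → Disjoint p q → Disjoint q p
  Disjoint-sym (s , t , u , v) = s ∘ sym , u ∘ sym , t ∘ sym , v ∘ sym

  ≡-or-disjoint : ∀ {M p q} → AllPairs Disjoint M → p ∈ M → q ∈ M → p ≡ q ⊎ Disjoint p q
  ≡-or-disjoint _        (here refl) (here refl) = inj₁ refl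
  ≡-or-disjoint (ds ∷ _) (here refl) (there q∈)  = inj₂ (All.lookup ds q∈)
  ≡-or-disjoint (ds ∷ _) (there p∈)  (here refl) = inj₂ (Disjoint-sym (All.lookup ds p∈))
  ≡-or-disjoint (_ ∷ ds) (there p∈)  (there q∈)  = ≡-or-disjoint ds p∈ q∈

  ind : Bool → ℕ
  ind false = 0
  ind true  = 1

  count : {A : Set} → (A → Bool) → List A → ℕ
  count p []       = 0
  count p (x ∷ xs) = ind (p x) + count p xs

  ind-mono : ∀ {a b} → (T a → T b) → ind a ≤ ind b
  ind-mono {false} f = z≤n
  ind-mono {true} {true} f = ≤-refl
  ind-mono {true} {false} f = ⊥-elim (f _)

  module _ {A : Set} {p q : A → Bool} where

    count-mono : ∀ xs → (∀ {x} → x ∈ xs → T (p x) → T (q x)) → count p xs ≤ count q xs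
    count-mono []       imp = z≤n
    count-mono (x ∷ xs) imp = +-mono-≤ (ind-mono (imp (here refl))) (count-mono xs (imp ∘ there))

    count-mono-< : ∀ {xs y} → y ∈ xs → T (q y) → ¬ T (p y) →
      (∀ {x} → x ∈ xs → T (p x) → T (q x)) → count p xs < count q xs
    count-mono-< {x ∷ xs} (here refl) qy ¬py imp with p x | q x
    ... | true  | _    = ⊥-elim (¬py _)
    ... | false | true = s≤s (count-mono xs (imp ∘ there))
    count-mono-< {x ∷ xs} (there y∈) qy ¬py imp =
      +-mono-≤-< (ind-mono (imp (here refl))) (count-mono-< y∈ qy ¬py (imp ∘ there))

  -- Half-open at the right, so that `height M z` is the height of the Dyck path of `M` just after
  -- the point `z`: it rises at a left endpoint and falls at a right endpoint.
  covers : ℕ → Arc → Bool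
  covers z (b , d) = (b ≤ᵇ z) ∧ (z <ᵇ d)

  height : Matching → ℕ → ℕ
  height M z = count (covers z) M

  covers-intro : ∀ {z b d} → b ≤ z → z < d → T (covers z (b , d))
  covers-intro b≤z z<d = Equivalence.from T-∧ (≤⇒≤ᵇ b≤z , <⇒<ᵇ z<d)

  covers-elim : ∀ {z b d} → T (covers z (b , d)) → b ≤ z × z < d
  covers-elim {z} {b} {d} t with Equivalence.to T-∧ t
  ... | s , u = ≤ᵇ⇒≤ b z s , <ᵇ⇒< z d u

  Crosses : Arc → Arc → Set
  Crosses (a , c) (b , d) = a < b × b < c × c < d

  crosses-intro : ∀ p q → Crosses p q → T (crossesᵇ p q)
  crosses-intro p q (s , t , u) = Equivalence.from T-∧ (<⇒<ᵇ s , Equivalence.from T-∧ (<⇒<ᵇ t , <⇒<ᵇ u))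

  crosses-elim : ∀ p q → T (crossesᵇ p q) → Crosses p q
  crosses-elim (a , c) (b , d) x with Equivalence.to T-∧ x
  ... | s , y with Equivalence.to T-∧ y
  ... | t , u = <ᵇ⇒< a b s , <ᵇ⇒< b c t , <ᵇ⇒< c d u

  NonCrossing : Matching → Set
  NonCrossing M = ∀ {p q} → p ∈ M → q ∈ M → ¬ Crosses p q

  T-not⁻ : ∀ {b} → T (not b) → ¬ T b
  T-not⁻ {false} _ ()

  T-not⁺ : ∀ {b} → ¬ T b → T (not b)
  T-not⁺ {false} _ = _
  T-not⁺ {true}  f = f _

  all-elim : ∀ {A : Set} (p : A → Bool) {xs x} → T (all p xs) → x ∈ xs → T (p x)
  all-elim p {y ∷ ys} t (here refl) = proj₁ (Equivalence.to (T-∧ {p y}) t)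
  all-elim p {y ∷ ys} t (there x∈)  = all-elim p (proj₂ (Equivalence.to (T-∧ {p y}) t)) x∈

  all-intro : ∀ {A : Set} (p : A → Bool) xs → (∀ {x} → x ∈ xs → T (p x)) → T (all p xs)
  all-intro p []       f = _
  all-intro p (y ∷ ys) f = Equivalence.from T-∧ (f (here refl) , all-intro p ys (f ∘ there))

  noncrossing-elim : ∀ {M} → T (noncrossingᵇ M) → NonCrossing M
  noncrossing-elim {M} t {p} {q} p∈ q∈ x = T-not⁻ (all-elim _ (all-elim (λ p → all _ M) t p∈) q∈) (crosses-intro p q x)

  noncrossing-intro : ∀ {M} → NonCrossing M → T (noncrossingᵇ M)
  noncrossing-intro {M} nc = all-intro _ M λ {p} p∈ → all-intro _ M λ {q} q∈ → T-not⁺ (nc p∈ q∈ ∘ crosses-elim p q)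

  catalan-sound : ∀ S {M} → M ∈ catalanMatchings S → PM S M × NonCrossing M
  catalan-sound S {M} M∈ with ∈-filter⁻ (λ M → T? (noncrossingᵇ M)) {xs = perfectMatchings S} M∈
  ... | M∈′ , t = pm-sound (length S) M∈′ , noncrossing-elim t

  catalan-complete : ∀ {S M} → PM S M → NonCrossing M → M ∈ catalanMatchings S
  catalan-complete {S} p nc = ∈-filter⁺ (λ M → T? (noncrossingᵇ M)) (pm-complete (length S) ≤-refl p) (noncrossing-intro nc)

  Unique-catalan : ∀ {S} → Increasing S → Unique (catalanMatchings S)
  Unique-catalan {S} inc = Unique.filter⁺ (λ M → T? (noncrossingᵇ M)) (Unique-pm (length S) (Increasing⇒Unique inc))

  NotEndpoint : ℕ → Matching → Set
  NotEndpoint z M = ∀ {b d} → (b , d) ∈ M → b ≢ z × d ≢ z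

  covers-step : ∀ z b d → b ≢ suc z → d ≢ suc z → covers (suc z) (b , d) ≡ covers z (b , d)
  covers-step z b d b≢ d≢ = cong₂ _∧_ left right
    where
    left : (b ≤ᵇ suc z) ≡ (b ≤ᵇ z)
    left with b ≤ᵇ suc z in e₁ | b ≤ᵇ z in e₂
    ... | true  | true  = refl
    ... | false | false = refl
    ... | true  | false = ⊥-elim (subst T e₂ (≤⇒≤ᵇ (≤-pred (≤∧≢⇒< (≤ᵇ⇒≤ b (suc z) (subst T (sym e₁) _)) b≢))))
    ... | false | true  = ⊥-elim (subst T e₁ (≤⇒≤ᵇ (m≤n⇒m≤1+n (≤ᵇ⇒≤ b z (subst T (sym e₂) _)))))
    right : (suc z <ᵇ d) ≡ (z <ᵇ d)
    right with suc z <ᵇ d in e₁ | z <ᵇ d in e₂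
    ... | true  | true  = refl
    ... | false | false = refl
    ... | true  | false = ⊥-elim (subst T e₂ (<⇒<ᵇ (<-trans (n<1+n z) (<ᵇ⇒< (suc z) d (subst T (sym e₁) _)))))
    ... | false | true  = ⊥-elim (subst T e₁ (<⇒<ᵇ (≤∧≢⇒< (<ᵇ⇒< z d (subst T (sym e₂) _)) (d≢ ∘ sym))))

  height-flat : ∀ M z → NotEndpoint (suc z) M → height M (suc z) ≡ height M z
  height-flat []            z ne = refl
  height-flat ((b , d) ∷ M) z ne = cong₂ _+_
    (cong ind (covers-step z b d (proj₁ (ne (here refl))) (proj₂ (ne (here refl)))))
    (height-flat M z (ne ∘ there))

  T⇒≡ : ∀ {b} → T b → b ≡ true
  T⇒≡ {true} _ = refl

  ¬T⇒≡ : ∀ {b} → ¬ T b → b ≡ false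
  ¬T⇒≡ {false} _ = refl
  ¬T⇒≡ {true}  f = ⊥-elim (f _)

  height-open : ∀ {M z d} → WellFormed M → (suc z , d) ∈ M → height M (suc z) ≡ suc (height M z)
  height-open {(b , d) ∷ M} {z} wf (here refl) with disjoint wf
  ... | ds ∷ _ rewrite T⇒≡ (covers-intro {suc z} {suc z} {d} ≤-refl (ordered wf (here refl)))
                      | ¬T⇒≡ {covers z (suc z , d)} (λ t → 1+n≰n (proj₁ (covers-elim {z} {suc z} {d} t))) =
    cong suc (height-flat M z λ q∈ → let (s , _ , _ , _) = All.lookup ds q∈ ; (_ , t , _ , _) = All.lookup ds q∈ in s ∘ sym , t ∘ sym)
  height-open {(b , d) ∷ M} {z} wf (there q∈) with disjoint wf
  ... | ds ∷ dss rewrite covers-step z b d (proj₁ (All.lookup ds q∈)) (proj₁ (proj₂ (proj₂ (All.lookup ds q∈)))) =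
    trans (cong (ind (covers z (b , d)) +_) (height-open (record { ordered = ordered wf ∘ there ; disjoint = dss }) q∈)) (+-suc _ _)

  height-close : ∀ {M z b} → WellFormed M → (b , suc z) ∈ M → suc (height M (suc z)) ≡ height M z
  height-close {(b , d) ∷ M} {z} wf (here refl) with disjoint wf
  ... | ds ∷ _ rewrite T⇒≡ (covers-intro {z} {b} {suc z} (≤-pred (ordered wf (here refl))) ≤-refl)
                      | ¬T⇒≡ {covers (suc z) (b , suc z)} (λ t → 1+n≰n (proj₂ (covers-elim {suc z} {b} {suc z} t))) =
    cong suc (height-flat M z λ q∈ → let (_ , _ , s , t) = All.lookup ds q∈ in s ∘ sym , t ∘ sym)
  height-close {(b , d) ∷ M} {z} wf (there q∈) with disjoint wf
  ... | ds ∷ dss rewrite covers-step z b d (proj₁ (proj₂ (All.lookup ds q∈))) (proj₂ (proj₂ (proj₂ (All.lookup ds q∈)))) =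
    trans (sym (+-suc _ _)) (cong (ind (covers z (b , d)) +_) (height-close (record { ordered = ordered wf ∘ there ; disjoint = dss }) q∈))

  -- An arc that covers `b` starts before `suc b`, so by non-crossing it ends after `d` or not
  -- before it, and hence covers `z` too. The arc from `suc b` itself covers `z` but not `b`, which
  -- makes the inequality strict.
  height-inside : ∀ {M b d z} → WellFormed M → NonCrossing M → (suc b , d) ∈ M →
    suc b ≤ z → z < d → height M b < height M z
  height-inside {M} {b} {d} {z} wf nc p∈ b<z z<d =
    count-mono-< p∈ (covers-intro b<z z<d) (λ t → 1+n≰n (proj₁ (covers-elim {b} {suc b} {d} t))) imp
    where
    imp : ∀ {q} → q ∈ M → T (covers b q) → T (covers z q)
    imp {b′ , d′} q∈ t with covers-elim {b} {b′} {d′} t | ≡-or-disjoint (disjoint wf) q∈ p∈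
    ... | b′≤b , b<d′ | inj₁ refl = ⊥-elim (1+n≰n b′≤b)
    ... | b′≤b , b<d′ | inj₂ (_ , _ , d′≢ , _) with d ≤? d′
    ...   | yes d≤d′ = covers-intro (≤-trans b′≤b (≤-trans (n≤1+n b) b<z)) (<-≤-trans z<d d≤d′)
    ...   | no  d≰d′ = ⊥-elim (nc q∈ p∈ (s≤s b′≤b , ≤∧≢⇒< b<d′ (d′≢ ∘ sym) , ≰⇒> d≰d′))

  -- An arc that is open after `d` cannot have started inside the given arc without crossing it, so
  -- it was already open at `b`, just before that arc.
  height-after : ∀ {M b d} → WellFormed M → NonCrossing M → (suc b , d) ∈ M → height M d ≤ height M b
  height-after {M} {b} {d} wf nc p∈ = count-mono M imp
    where
    imp : ∀ {q} → q ∈ M → T (covers d q) → T (covers b q)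
    imp {b′ , d′} q∈ t with covers-elim {d} {b′} {d′} t | ≡-or-disjoint (disjoint wf) q∈ p∈
    ... | b′≤d , d<d′ | inj₁ refl = ⊥-elim (<-irrefl refl d<d′)
    ... | b′≤d , d<d′ | inj₂ (b′≢ , b′≢d , _ , _) with b′ ≤? b
    ...   | yes b′≤b = covers-intro b′≤b (<-trans (<-trans (n<1+n b) (ordered wf p∈)) d<d′)
    ...   | no  b′≰b = ⊥-elim (nc p∈ q∈ (≤∧≢⇒< (≰⇒> b′≰b) (b′≢ ∘ sym) , ≤∧≢⇒< b′≤d b′≢d , d<d′))

  Alternates : Arc → Arc → Set
  Alternates p q = Crosses p q ⊎ Crosses q p

  -- This lemma and the next are the necessity of the height criterion for a free arc: an arc open
  -- at `a` that closed before `c`, or one open at `c` that started after `a`, would alternate with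
  -- `(a , c)`.
  height-over-free : ∀ {M a c z} → NotEndpoint a M → (∀ {q} → q ∈ M → ¬ Alternates (a , c) q) →
    a ≤ z → z < c → height M a ≤ height M z
  height-over-free {M} {a} {c} {z} ne free a≤z z<c = count-mono M imp
    where
    imp : ∀ {q} → q ∈ M → T (covers a q) → T (covers z q)
    imp {b , d} q∈ t with covers-elim {a} {b} {d} t
    ... | b≤a , a<d with z <? d
    ...   | yes z<d = covers-intro (≤-trans b≤a a≤z) z<d
    ...   | no  z≮d = ⊥-elim (free q∈ (inj₂ (≤∧≢⇒< b≤a (proj₁ (ne q∈)) , a<d , ≤-<-trans (≮⇒≥ z≮d) z<c)))

  height-after-free : ∀ {M a c} → a < c → NotEndpoint a M → NotEndpoint c M →
    (∀ {q} → q ∈ M → ¬ Alternates (a , c) q) → height M c ≤ height M a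
  height-after-free {M} {a} {c} a<c nea nec free = count-mono M imp
    where
    imp : ∀ {q} → q ∈ M → T (covers c q) → T (covers a q)
    imp {b , d} q∈ t with covers-elim {c} {b} {d} t
    ... | b≤c , c<d with b ≤? a
    ...   | yes b≤a = covers-intro b≤a (<-trans a<c c<d)
    ...   | no  b≰a = ⊥-elim (free q∈ (inj₁ (≰⇒> b≰a , ≤∧≢⇒< b≤c (proj₁ (nec q∈)) , c<d)))

  -- Sufficiency of the height criterion. An arc from `suc b` that starts inside and ends outside
  -- makes the height at `c` exceed that at `b`; one that starts outside and ends inside at `d`
  -- brings the height at `d` down to that at `b`, below the height at `a`. Heights are compared
  -- with the point before the arc, hence the positivity of left endpoints.
  free-from-heights : ∀ {M a c} → WellFormed M → NonCrossing M → (∀ {b d} → (b , d) ∈ M → 1 ≤ b) →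
    (∀ z → a ≤ z → z ≤ c → height M a ≤ height M z) → height M c ≤ height M a →
    ∀ {q} → q ∈ M → ¬ Alternates (a , c) q
  free-from-heights wf nc pos above back {suc b , d} q∈ (inj₁ (s≤s a≤b , b<c , c<d)) =
    <-irrefl refl (<-≤-trans (height-inside wf nc q∈ (<⇒≤ b<c) c<d)
      (≤-trans back (above b a≤b (<⇒≤ (<-trans (n<1+n b) b<c)))))
  free-from-heights wf nc pos above back {suc b , d} q∈ (inj₂ (b<a , a<d , d<c)) =
    <-irrefl refl (<-≤-trans (height-inside wf nc q∈ (<⇒≤ b<a) a<d)
      (≤-trans (above d (<⇒≤ a<d) (<⇒≤ d<c)) (height-after wf nc q∈)))
  free-from-heights wf nc pos above back {zero , d} q∈ _ = contradiction (pos q∈) λ ()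

-- Deciding isolation of an arc by scanning the word.

module Scanning where

  open Matchings
  open import Data.Nat
  open import Data.Nat.Properties
  open import Data.List.Membership.DecPropositional _≟_ using (_∈?_)
  open import Data.List.Membership.Propositional.Properties
  open import Data.List.Relation.Unary.All using (All; []; _∷_)
  open import Data.List.Relation.Unary.AllPairs using (AllPairs; []; _∷_)
  open import Data.List.Relation.Unary.Unique.Propositional using (Unique)
  open import Function.Bundles using (Equivalence)

  open WellFormed

  Letter : Set
  Letter = Bool × Bool

  data Status : Set where
    iso non unknown : Status

  agree : Bool → Bool → Bool
  agree true  b = b
  agree false b = not b

  -- The scan starts just after the left endpoint of an arc of colour X; hx and hy count the arcs of
  -- colour X and of the other colour opened since then.  A closing letter of the other colour at
  -- hy = 0 ends an arc that crosses the scanned one.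
  mutual
    scan : Bool → ℕ → ℕ → List Letter → Status
    scan X hx hy []            = unknown
    scan X hx hy ((c , o) ∷ w) = step X (agree X c) o hx hy w

    step : Bool → Bool → Bool → ℕ → ℕ → List Letter → Status
    step X true  true  hx       hy       w = scan X (suc hx) hy w
    step X true  false (suc hx) hy       w = scan X hx hy w
    step X true  false zero     zero     w = iso
    step X true  false zero     (suc hy) w = non
    step X false true  hx       hy       w = scan X hx (suc hy) w
    step X false false hx       (suc hy) w = scan X hx hy w
    step X false false hx       zero     w = non

  -- A closing letter counts as `non`, so that every arc is counted once, at its left endpoint.
  status : List Letter → Status
  status []                = non
  status ((c , false) ∷ w) = non
  status ((c , true)  ∷ w) = scan c 0 0 w

  isIso isUnknown : Status → Bool
  isIso iso     = true
  isIso non     = false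
  isIso unknown = false
  isUnknown iso     = false
  isUnknown non     = false
  isUnknown unknown = true

  isoCount unknownCount : List Letter → ℕ
  isoCount []      = 0
  isoCount (l ∷ w) = ind (isIso (status (l ∷ w))) + isoCount w
  unknownCount []      = 0
  unknownCount (l ∷ w) = ind (isUnknown (status (l ∷ w))) + unknownCount w

  wordFrom : List ℕ → ℕ → List Bool → List Letter
  wordFrom L z []       = []
  wordFrom L z (b ∷ bs) = (b , does (z ∈? L)) ∷ wordFrom L (suc z) bs

  agree-refl : ∀ X → agree X X ≡ true
  agree-refl true  = refl
  agree-refl false = refl

  agree-not : ∀ X → agree X (not X) ≡ false
  agree-not true  = refl
  agree-not false = refl

  -- Indexing the two matchings by the colour lets every argument run for `X` against `not X`,
  -- instead of once for red and once for blue.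
  record Configuration : Set where
    field
      mat         : Bool → Matching
      wellFormed  : ∀ b → WellFormed (mat b)
      nonCrossing : ∀ b → NonCrossing (mat b)
      positive    : ∀ b {x y} → (x , y) ∈ mat b → 1 ≤ x
      separate    : ∀ b {z} → IsEndpoint z (mat b) → NotEndpoint z (mat (not b))

    arcs : Matching
    arcs = mat true ++ mat false

    lefts : List ℕ
    lefts = map proj₁ arcs

    isolatedArc : Arc → Bool
    isolatedArc p = all (λ q → not (alternatesᵇ p q)) arcs

    data Coloured : ℕ → List Bool → Set where
      []  : ∀ {z} → Coloured z []
      _∷_ : ∀ {z b bs} → IsEndpoint z (mat b) → Coloured (suc z) bs → Coloured z (b ∷ bs)

  alternates-elim : ∀ p q → T (alternatesᵇ p q) → Alternates p q
  alternates-elim p q t with Equivalence.to (T-∨ {crossesᵇ p q}) t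
  ... | inj₁ x = inj₁ (crosses-elim p q x)
  ... | inj₂ x = inj₂ (crosses-elim q p x)

  alternates-intro : ∀ p q → Alternates p q → T (alternatesᵇ p q)
  alternates-intro p q (inj₁ x) = Equivalence.from (T-∨ {crossesᵇ p q}) (inj₁ (crosses-intro p q x))
  alternates-intro p q (inj₂ x) = Equivalence.from (T-∨ {crossesᵇ p q}) (inj₂ (crosses-intro q p x))

  ≤-suc-split : ∀ {m n} → m ≤ suc n → m ≤ n ⊎ m ≡ suc n
  ≤-suc-split {m} {n} le with m ≟ suc n
  ... | yes e = inj₂ e
  ... | no ne = inj₁ (≤-pred (≤∧≢⇒< le ne))

  extend-up : ∀ {P : ℕ → Set} {lo z} → (∀ z′ → lo ≤ z′ → z′ ≤ z → P z′) → P (suc z) → ∀ z′ → lo ≤ z′ → z′ ≤ suc z → P z′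
  extend-up h p z′ l u with ≤-suc-split u
  ... | inj₁ u′   = h z′ l u′
  ... | inj₂ refl = p

  module _ (C : Configuration) where
    open Configuration C

    mat-∈-arcs : ∀ b {p} → p ∈ mat b → p ∈ arcs
    mat-∈-arcs true  p∈ = ∈-++⁺ˡ p∈
    mat-∈-arcs false p∈ = ∈-++⁺ʳ (mat true) p∈

    arcs-∈-mat : ∀ {p} → p ∈ arcs → ∃[ b ] p ∈ mat b
    arcs-∈-mat p∈ with ∈-++⁻ (mat true) p∈
    ... | inj₁ q = true , q
    ... | inj₂ q = false , q

    arc-colour : ∀ {b z y} → IsEndpoint z (mat b) → (z , y) ∈ arcs → (z , y) ∈ mat b
    arc-colour {b} e p∈ with arcs-∈-mat p∈
    ... | b′ , p∈′ with b′ Bool.≟ b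
    ...   | yes refl = p∈′
    ...   | no  ne with ¬-not ne
    ...     | refl = ⊥-elim (proj₁ (separate b e p∈′) refl)

    left-end : ∀ {b z} → IsEndpoint z (mat b) → z ∈ lefts → ∃[ y ] (z , y) ∈ mat b
    left-end e z∈ with ∈-map⁻ proj₁ z∈
    ... | (_ , y) , p∈ , refl = y , arc-colour e p∈

    right-end : ∀ {b z} → IsEndpoint z (mat b) → z ∉ lefts → ∃[ x ] (x , z) ∈ mat b
    right-end {b} (inj₁ (y , p∈)) z∉ = ⊥-elim (z∉ (∈-map⁺ proj₁ (mat-∈-arcs b p∈)))
    right-end     (inj₂ r)        z∉ = r

    module _ (X : Bool) {a c : ℕ} (arc∈ : (suc a , c) ∈ mat X) where

      private
        Y : Bool
        Y = not X

        hX hY : ℕ → ℕ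
        hX = height (mat X)
        hY = height (mat Y)

      Free : Set
      Free = ∀ {q} → q ∈ mat Y → ¬ Alternates (suc a , c) q

      Above : ℕ → Set
      Above z = ∀ z′ → suc a ≤ z′ → z′ ≤ z → hY (suc a) ≤ hY z′

      Verdict : Status → Set
      Verdict t = (t ≡ iso × Free) ⊎ (t ≡ non × ¬ Free)

      -- The invariant after letter `z`: the scanned colour is `suc hx` above its height just before
      -- the arc, the other colour is `hy` above its height at the left endpoint and, by `Above`,
      -- has never been lower. As the remaining letters still include position `c`, the verdict
      -- cannot be `unknown`.
      scan-correct : ∀ bs z hx hy → Coloured (suc z) bs → suc a ≤ z → z < c → c ≤ z + length bs →
        hX z ≡ suc (hX a + hx) → hY z ≡ hY (suc a) + hy →
        Above z →
        Verdict (scan X hx hy (wordFrom lefts (suc z) bs))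
      scan-correct [] z hx hy _ _ z<c c≤ _ _ _ =
        ⊥-elim (<-irrefl refl (<-≤-trans z<c (subst (c ≤_) (+-identityʳ z) c≤)))
      scan-correct (b ∷ bs) z hx hy (e ∷ cs) a<z z<c c≤ ex ey above with b Bool.≟ X
      scan-correct (b ∷ bs) z hx hy (e ∷ cs) a<z z<c c≤ ex ey above | yes refl
        rewrite agree-refl X with suc z ∈? lefts
      ... | yes z∈ = scan-correct bs (suc z) (suc hx) hy cs (m≤n⇒m≤1+n a<z) z+1<c
              (subst (c ≤_) (+-suc z (length bs)) c≤)
              (trans (height-open (wellFormed X) q∈) (cong suc (trans ex (sym (+-suc (hX a) hx)))))
              (trans flatY ey) above′
        where
        q∈ = proj₂ (left-end e z∈)
        flatY = height-flat (mat Y) z (separate X e)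
        above′ : Above (suc z)
        above′ = extend-up above (subst (hY (suc a) ≤_) (sym flatY) (above z a<z ≤-refl))
        z+1<c : suc z < c
        z+1<c with ≡-or-disjoint (disjoint (wellFormed X)) q∈ arc∈
        ... | inj₁ refl = ⊥-elim (1+n≰n a<z)
        ... | inj₂ (_ , ne , _ , _) = ≤∧≢⇒< z<c ne
      ... | no  z∉ = closing hx hy ex ey
        where
        q∈ = proj₂ (right-end e z∉)
        flatY = height-flat (mat Y) z (separate X e)
        down = height-close (wellFormed X) q∈
        above′ : Above (suc z)
        above′ = extend-up above (subst (hY (suc a) ≤_) (sym flatY) (above z a<z ≤-refl))
        closing : ∀ hx hy → hX z ≡ suc (hX a + hx) → hY z ≡ hY (suc a) + hy →
          Verdict (step X true false hx hy (wordFrom lefts (suc (suc z)) bs))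
        closing (suc hx) hy ex ey = scan-correct bs (suc z) hx hy cs (m≤n⇒m≤1+n a<z) z+1<c
          (subst (c ≤_) (+-suc z (length bs)) c≤)
          (suc-injective (trans down (trans ex (cong suc (+-suc (hX a) hx))))) (trans flatY ey) above′
          where
          -- This closing letter leaves the scanned colour above its height before the arc, whereas
          -- `height-after` forbids that at `c`; so `c` is still ahead.
          z+1<c : suc z < c
          z+1<c = ≤∧≢⇒< z<c λ { refl → 1+n≰n (≤-trans (≤-trans (m≤m+n (suc (hX a)) hx)
            (≤-reflexive (suc-injective (sym (trans down (trans ex (cong suc (+-suc (hX a) hx))))))))
            (height-after (wellFormed X) (nonCrossing X) arc∈)) }
        closing zero hy ex ey = lastStep hy ey
          where
          -- The scanned colour is back at its height before the arc, which `height-inside` excludes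
          -- strictly inside the arc.
          z+1≡c : suc z ≡ c
          z+1≡c with suc z ≟ c
          ... | yes p = p
          ... | no ne = ⊥-elim (<-irrefl (sym (suc-injective (trans down (trans ex (cong suc (+-identityʳ (hX a)))))))
                  (height-inside (wellFormed X) (nonCrossing X) arc∈ (m≤n⇒m≤1+n a<z) (≤∧≢⇒< z<c ne)))
          lastStep : ∀ hy → hY z ≡ hY (suc a) + hy →
            Verdict (step X true false zero hy (wordFrom lefts (suc (suc z)) bs))
          lastStep zero ey = inj₁ (refl , free-from-heights (wellFormed Y) (nonCrossing Y) (positive Y)
            (λ z′ l u → above′ z′ l (subst (z′ ≤_) (sym z+1≡c) u))
            (subst (λ t → hY t ≤ hY (suc a)) z+1≡c (≤-reflexive (trans flatY (trans ey (+-identityʳ _))))))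
          -- The other colour ends higher than it began, so one of its arcs started inside and
          -- leaves the scanned arc.
          lastStep (suc hy) ey = inj₂ (refl , λ free → 1+n≰n (≤-trans
            (≤-trans (m≤m+n (suc (hY (suc a))) hy) (≤-reflexive (trans (sym (+-suc _ hy)) (trans (sym ey) (sym flatY)))))
            (subst (λ t → hY t ≤ hY (suc a)) (sym z+1≡c)
              (height-after-free (ordered (wellFormed X) arc∈) (separate X (inj₁ (_ , arc∈))) (separate X (inj₂ (_ , arc∈))) free))))
      scan-correct (b ∷ bs) z hx hy (e ∷ cs) a<z z<c c≤ ex ey above | no b≢X with ¬-not b≢X
      ... | refl rewrite agree-not X = body (suc z ∈? lefts)
        where
        neX : NotEndpoint (suc z) (mat X)
        neX = subst (λ t → NotEndpoint (suc z) (mat t)) (not-involutive X) (separate Y e)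
        flatX = height-flat (mat X) z neX
        z+1<c : suc z < c
        z+1<c = ≤∧≢⇒< z<c λ { refl → proj₂ (neX arc∈) refl }
        body : (d : Dec (suc z ∈ lefts)) →
          Verdict (step X false (does d) hx hy (wordFrom lefts (suc (suc z)) bs))
        body (yes z∈) = scan-correct bs (suc z) hx (suc hy) cs (m≤n⇒m≤1+n a<z) z+1<c
              (subst (c ≤_) (+-suc z (length bs)) c≤) (trans flatX ex)
              (trans up (trans (cong suc ey) (sym (+-suc _ hy)))) above′
          where
          up = height-open (wellFormed Y) (proj₂ (left-end e z∈))
          above′ : Above (suc z)
          above′ = extend-up above (subst (hY (suc a) ≤_) (sym up) (m≤n⇒m≤1+n (above z a<z ≤-refl)))
        body (no z∉) = falling hy ey
          where
          down = height-close (wellFormed Y) (proj₂ (right-end e z∉))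
          falling : ∀ hy → hY z ≡ hY (suc a) + hy →
            Verdict (step X false false hx hy (wordFrom lefts (suc (suc z)) bs))
          -- The other colour falls below its initial height, so an arc opened before the scanned
          -- one closes inside it.
          falling zero ey = inj₂ (refl , λ free → 1+n≰n (≤-trans
            (s≤s (height-over-free (separate X (inj₁ (_ , arc∈))) free (m≤n⇒m≤1+n a<z) z+1<c))
            (≤-reflexive (trans down (trans ey (+-identityʳ _))))))
          falling (suc hy) ey = scan-correct bs (suc z) hx hy cs (m≤n⇒m≤1+n a<z) z+1<c
              (subst (c ≤_) (+-suc z (length bs)) c≤) (trans flatX ex) ey′ above′
            where
            ey′ : hY (suc z) ≡ hY (suc a) + hy
            ey′ = suc-injective (trans down (trans ey (+-suc _ hy)))
            above′ : Above (suc z)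
            above′ = extend-up above (subst (hY (suc a) ≤_) (sym ey′) (m≤m+n _ hy))

      free⇒isolated : Free → T (isolatedArc (suc a , c))
      free⇒isolated free = all-intro _ arcs λ {q} q∈ → T-not⁺ (notAlt q∈ ∘ alternates-elim _ q)
        where
        notAlt : ∀ {q} → q ∈ arcs → ¬ Alternates (suc a , c) q
        notAlt q∈ alt with arcs-∈-mat q∈
        ... | b , q∈′ with b Bool.≟ X
        notAlt q∈ (inj₁ x) | b , q∈′ | yes refl = nonCrossing X arc∈ q∈′ x
        notAlt q∈ (inj₂ x) | b , q∈′ | yes refl = nonCrossing X q∈′ arc∈ x
        notAlt q∈ alt | b , q∈′ | no b≢X with ¬-not b≢X
        ... | refl = free q∈′ alt

      isolated⇒free : T (isolatedArc (suc a , c)) → Free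
      isolated⇒free t {q} q∈ alt = T-not⁻ (all-elim _ t (mat-∈-arcs Y q∈)) (alternates-intro _ q alt)

    Bounded : ℕ → Set
    Bounded N = ∀ {x y} → (x , y) ∈ arcs → y < N

    status-correct : ∀ {N b bs z c} → Bounded N → N ≡ suc z + suc (length bs) →
      Coloured (suc z) (b ∷ bs) → (suc z , c) ∈ mat b →
      (T (isIso (status (wordFrom lefts (suc z) (b ∷ bs)))) → T (isolatedArc (suc z , c))) ×
      (T (isolatedArc (suc z , c)) → T (isIso (status (wordFrom lefts (suc z) (b ∷ bs)))))
    status-correct {N} {b} {bs} {z} {c} bounded refl (e ∷ cs) arc∈ with suc z ∈? lefts
    ... | no z∉ = ⊥-elim (z∉ (∈-map⁺ proj₁ (mat-∈-arcs b arc∈)))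
    ... | yes _ with scan-correct b arc∈ bs (suc z) 0 0 cs ≤-refl (ordered (wellFormed b) arc∈)
          (≤-pred (subst (c <_) (cong suc (+-suc z (length bs))) (bounded (mat-∈-arcs b arc∈))))
          (trans (height-open (wellFormed b) arc∈) (cong suc (sym (+-identityʳ _))))
          (sym (+-identityʳ _)) (λ z′ l u → ≤-reflexive (cong (height (mat (not b))) (≤-antisym l u)))
    ...   | inj₁ (eq , free)  rewrite eq = (λ _ → free⇒isolated b arc∈ free) , _
    ...   | inj₂ (eq , ¬free) rewrite eq = (λ ()) , (λ t → ⊥-elim (¬free (isolated⇒free b arc∈ t)))

  -- Left endpoints serve as names of arcs. The equality of the two counts in `isolated≡isoCount` is
  -- then a mutual inclusion of duplicate-free lists of positions.
  isoPositions : ℕ → List Letter → List ℕ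
  isoPositions z []      = []
  isoPositions z (l ∷ w) with isIso (status (l ∷ w))
  ... | true  = z ∷ isoPositions (suc z) w
  ... | false = isoPositions (suc z) w

  length-isoPositions : ∀ z w → length (isoPositions z w) ≡ isoCount w
  length-isoPositions z []      = refl
  length-isoPositions z (l ∷ w) with isIso (status (l ∷ w))
  ... | true  = cong suc (length-isoPositions (suc z) w)
  ... | false = length-isoPositions (suc z) w

  isoPositions-≥ : ∀ z w {x} → x ∈ isoPositions z w → z ≤ x
  isoPositions-≥ z (l ∷ w) x∈ with isIso (status (l ∷ w))
  isoPositions-≥ z (l ∷ w) (here refl) | true = ≤-refl
  isoPositions-≥ z (l ∷ w) (there x∈)  | true = <⇒≤ (isoPositions-≥ (suc z) w x∈)
  isoPositions-≥ z (l ∷ w) x∈          | false = <⇒≤ (isoPositions-≥ (suc z) w x∈)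

  Unique-isoPositions : ∀ z w → Unique (isoPositions z w)
  Unique-isoPositions z []      = []
  Unique-isoPositions z (l ∷ w) with isIso (status (l ∷ w))
  ... | true  = All.tabulate (λ x∈ → <⇒≢ (isoPositions-≥ (suc z) w x∈)) ∷ Unique-isoPositions (suc z) w
  ... | false = Unique-isoPositions (suc z) w

  isoPositions-there : ∀ {x} z l w → x ∈ isoPositions (suc z) w → x ∈ isoPositions z (l ∷ w)
  isoPositions-there z l w x∈ with isIso (status (l ∷ w))
  ... | true  = there x∈
  ... | false = x∈

  isoPositions-here : ∀ z l w → T (isIso (status (l ∷ w))) → z ∈ isoPositions z (l ∷ w)
  isoPositions-here z l w t with isIso (status (l ∷ w))
  ... | true = here refl

  isoPositions-elim : ∀ {x} z l w → x ∈ isoPositions z (l ∷ w) →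
    (x ≡ z × T (isIso (status (l ∷ w)))) ⊎ x ∈ isoPositions (suc z) w
  isoPositions-elim z l w x∈ with isIso (status (l ∷ w))
  isoPositions-elim z l w (here refl) | true = inj₁ (refl , _)
  isoPositions-elim z l w (there x∈)  | true = inj₂ x∈
  isoPositions-elim z l w x∈          | false = inj₂ x∈

  iso⇒open : ∀ c o w → T (isIso (status ((c , o) ∷ w))) → T o
  iso⇒open c true w t = _

  T-does : ∀ {P : Set} (d : Dec P) → T (does d) → P
  T-does (yes p) _ = p

  module _ (C : Configuration) where
    open Configuration C

    private
      isolatedLefts : List ℕ
      isolatedLefts = map proj₁ (filterᵇ isolatedArc arcs)

    isoPositions⊆ : ∀ {N} z bs {x} → Bounded C N → N ≡ suc z + length bs → Coloured (suc z) bs →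
      x ∈ isoPositions (suc z) (wordFrom lefts (suc z) bs) → x ∈ isolatedLefts
    isoPositions⊆ z (b ∷ bs) bounded eq (e ∷ cs) x∈
      with isoPositions-elim (suc z) (b , does (suc z ∈? lefts)) (wordFrom lefts (suc (suc z)) bs) x∈
    ... | inj₂ x∈′ = isoPositions⊆ (suc z) bs bounded (trans eq (cong suc (+-suc z (length bs)))) cs x∈′
    ... | inj₁ (refl , t) with left-end C e (T-does (suc z ∈? lefts) (iso⇒open b (does (suc z ∈? lefts)) (wordFrom lefts (suc (suc z)) bs) t))
    ...   | y , p∈ = ∈-map⁺ proj₁ (∈-filter⁺ (λ p → T? (isolatedArc p)) (mat-∈-arcs C b p∈)
                       (proj₁ (status-correct C bounded eq (e ∷ cs) p∈) t))

    isoPositions⊇ : ∀ {N} z bs {x y} → Bounded C N → N ≡ suc z + length bs → Coloured (suc z) bs →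
      suc z ≤ x → (x , y) ∈ arcs → T (isolatedArc (x , y)) →
      x ∈ isoPositions (suc z) (wordFrom lefts (suc z) bs)
    isoPositions⊇ z [] {x} {y} bounded refl [] z<x p∈ t with arcs-∈-mat C p∈
    ... | b , p∈′ = ⊥-elim (<-irrefl refl (<-trans (ordered (wellFormed b) p∈′)
      (<-≤-trans (bounded p∈) (≤-trans (≤-reflexive (cong suc (+-identityʳ z))) z<x))))
    isoPositions⊇ z (b ∷ bs) {x} {y} bounded eq (e ∷ cs) z<x p∈ t with x ≟ suc z
    ... | yes refl = isoPositions-here (suc z) (b , does (suc z ∈? lefts)) (wordFrom lefts (suc (suc z)) bs)
            (proj₂ (status-correct C bounded eq (e ∷ cs) (arc-colour C e p∈)) t)
    ... | no  ne   = isoPositions-there (suc z) (b , does (suc z ∈? lefts)) (wordFrom lefts (suc (suc z)) bs)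
            (isoPositions⊇ (suc z) bs bounded (trans eq (cong suc (+-suc z (length bs)))) cs (≤∧≢⇒< z<x (ne ∘ sym)) p∈ t)

    private
      arcs-unique : Unique lefts → Unique isolatedLefts
      arcs-unique = go arcs
        where
        go : ∀ M → Unique (map proj₁ M) → Unique (map proj₁ (filterᵇ isolatedArc M))
        go []      u        = []
        go (p ∷ M) (x∉ ∷ u) with isolatedArc p
        ... | false = go M u
        ... | true  = All.tabulate fresh ∷ go M u
          where
          fresh : ∀ {z} → z ∈ map proj₁ (filterᵇ isolatedArc M) → proj₁ p ≢ z
          fresh z∈ with ∈-map⁻ proj₁ z∈
          ... | q , q∈ , refl = All.lookup x∉ (∈-map⁺ proj₁ (proj₁ (∈-filter⁻ (λ p → T? (isolatedArc p)) {xs = M} q∈)))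

      mat-lefts-unique : ∀ b → Unique (map proj₁ (mat b))
      mat-lefts-unique b = go (disjoint (wellFormed b))
        where
        go : ∀ {M} → AllPairs Disjoint M → Unique (map proj₁ M)
        go []        = []
        go (ds ∷ dss) = All.tabulate (λ z∈ → let (q , q∈ , e) = ∈-map⁻ proj₁ z∈ in
          λ e′ → proj₁ (All.lookup ds q∈) (trans e′ e)) ∷ go dss

      lefts-unique : Unique lefts
      lefts-unique = subst Unique (sym (Data.List.Properties.map-++ proj₁ (mat true) (mat false)))
        (Unique.++⁺ (mat-lefts-unique true) (mat-lefts-unique false) clash)
        where
        clash : ∀ {v} → ¬ (v ∈ map proj₁ (mat true) × v ∈ map proj₁ (mat false))
        clash (v∈ , v∈′) with ∈-map⁻ proj₁ v∈ | ∈-map⁻ proj₁ v∈′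
        ... | (x , y) , p∈ , refl | (_ , y′) , q∈ , refl = proj₁ (separate true (inj₁ (y , p∈)) q∈) refl

    isolated≡isoCount : ∀ bs → Bounded C (suc (length bs)) → Coloured 1 bs →
      length (filterᵇ isolatedArc arcs) ≡ isoCount (wordFrom lefts 1 bs)
    isolated≡isoCount bs bounded cs = begin
      length (filterᵇ isolatedArc arcs) ≡⟨ length-map proj₁ (filterᵇ isolatedArc arcs) ⟨
      length isolatedLefts ≡⟨ ≤-antisym
        (Unique-⊆⇒length-≤ (arcs-unique lefts-unique) fwd)
        (Unique-⊆⇒length-≤ (Unique-isoPositions 1 (wordFrom lefts 1 bs)) (isoPositions⊆ 0 bs bounded refl cs)) ⟩
      length (isoPositions 1 (wordFrom lefts 1 bs)) ≡⟨ length-isoPositions 1 (wordFrom lefts 1 bs) ⟩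
      isoCount (wordFrom lefts 1 bs) ∎
      where
      open ≡-Reasoning
      fwd : ∀ {x} → x ∈ isolatedLefts → x ∈ isoPositions 1 (wordFrom lefts 1 bs)
      fwd x∈ with ∈-map⁻ proj₁ x∈
      ... | (x , y) , p∈ , refl with ∈-filter⁻ (λ p → T? (isolatedArc p)) {xs = arcs} p∈
      ...   | p∈′ , t with arcs-∈-mat C p∈′
      ...     | b , p∈″ = isoPositions⊇ 0 bs bounded refl cs (positive b p∈″) p∈′ t

-- Outcomes as words: the encoding is injective.

module Outcomes where

  open Matchings
  open Scanning
  open import Data.Nat hiding (_^_)
  import Data.Nat as ℕ
  open import Data.Nat.Properties
  open import Data.List.Membership.DecPropositional _≟_ using (_∈?_)
  open import Data.List.Membership.Propositional.Properties
  open import Data.List.Relation.Unary.All using (All; []; _∷_)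
  open import Data.List.Relation.Unary.AllPairs using ([]; _∷_)
  open import Data.List.Relation.Unary.Unique.Propositional using (Unique)
  open import Data.Rational using (ℚ)
  import Data.Rational as ℚ
  open import Relation.Binary.Definitions using (tri<; tri≈; tri>)

  open WellFormed

  height-0 : ∀ M → (∀ {x y} → (x , y) ∈ M → 1 ≤ x) → height M 0 ≡ 0
  height-0 []            pos = refl
  height-0 ((zero , d) ∷ M) pos = contradiction (pos (here refl)) λ ()
  height-0 ((suc b , d) ∷ M) pos = height-0 M (pos ∘ there)

  NotEndpoint-outside : ∀ {S M z} → PM S M → z ∉ S → NotEndpoint z M
  NotEndpoint-outside p z∉ q∈ with PM-endpoints p q∈
  ... | b∈ , d∈ = (λ { refl → z∉ b∈ }) , (λ { refl → z∉ d∈ })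

  -- The first point is an endpoint of the head arc only, so the inclusion forces the head arcs to
  -- agree, and what remains are matchings of the same shorter list.
  PM-⊆⇒≡ : ∀ {S M M′} → Unique S → PM S M → PM S M′ → (∀ {p} → p ∈ M → p ∈ M′) → M ≡ M′
  PM-⊆⇒≡ u p p′ sub = go u p p′ refl sub
    where
    go : ∀ {S S′ M M′} → Unique S → PM S M → PM S′ M′ → S ≡ S′ → (∀ {p} → p ∈ M → p ∈ M′) → M ≡ M′
    go _ [] [] _ _ = refl
    go (x∉ ∷ u) (arc {x} {y} {M} A B p) (arc {x′} {y′} {M′} A′ B′ p′) eq sub with ∷-injective eq
    ... | refl , eq′ = helper (sub (here refl))
      where
      x∉M′ : ∀ {z} → (x , z) ∉ M′
      x∉M′ q∈ = All.lookup x∉ (subst (_ ∈_) (sym eq′) (insert-∈ A′ (proj₁ (PM-endpoints p′ q∈)))) refl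
      x∉M : ∀ {z} → (x , z) ∉ M
      x∉M q∈ = All.lookup x∉ (insert-∈ A (proj₁ (PM-endpoints p q∈))) refl
      helper : (x , y) ∈ (x , y′) ∷ M′ → (x , y) ∷ M ≡ (x , y′) ∷ M′
      helper (there q∈) = ⊥-elim (x∉M′ q∈)
      helper (here refl) = cong ((x , y) ∷_)
        (go (AllPairs-drop-middle A u) p p′ (Unique-split A A′ u eq′) tail)
        where
        tail : ∀ {q} → q ∈ M → q ∈ M′
        tail q∈ with sub (there q∈)
        ... | here refl = ⊥-elim (x∉M q∈)
        ... | there q∈′ = q∈′

  module _ {S M M′} (inc : Increasing S) (p : PM S M) (p′ : PM S M′)
           (nc : NonCrossing M) (nc′ : NonCrossing M′) (pos : ∀ {z} → z ∈ S → 1 ≤ z)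
           (to : ∀ {z} → z ∈ map proj₁ M → z ∈ map proj₁ M′)
           (from : ∀ {z} → z ∈ map proj₁ M′ → z ∈ map proj₁ M) where

    private
      wf = PM-wellFormed inc p
      wf′ = PM-wellFormed inc p′

    -- Both paths start at height 0 and move by the same step at every point: whether a point is a
    -- left endpoint, a right endpoint or no endpoint is the same for the two matchings.
    lefts⇒heights : ∀ z → height M z ≡ height M′ z
    lefts⇒heights zero    = trans (height-0 M (pos ∘ proj₁ ∘ PM-endpoints p))
                                  (sym (height-0 M′ (pos ∘ proj₁ ∘ PM-endpoints p′)))
    lefts⇒heights (suc z) with suc z ∈? S
    ... | no z∉ = trans (height-flat M z (NotEndpoint-outside p z∉))
                    (trans (lefts⇒heights z) (sym (height-flat M′ z (NotEndpoint-outside p′ z∉))))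
    ... | yes z∈ with PM-covers p z∈ | PM-covers p′ z∈
    ...   | inj₁ (_ , q) | inj₁ (_ , q′) =
            trans (height-open wf q) (trans (cong suc (lefts⇒heights z)) (sym (height-open wf′ q′)))
    ...   | inj₂ (_ , q) | inj₂ (_ , q′) =
            suc-injective (trans (height-close wf q) (trans (lefts⇒heights z) (sym (height-close wf′ q′))))
    ...   | inj₁ (_ , q) | inj₂ (_ , q′) with ∈-map⁻ proj₁ (to (∈-map⁺ proj₁ q))
    ...     | (_ , d) , r , refl = ⊥-elim (clash wf′ r q′)
      where
      clash : ∀ {M z d b} → WellFormed M → (z , d) ∈ M → (b , z) ∈ M → ⊥
      clash w r s with ≡-or-disjoint (disjoint w) r s
      ... | inj₁ refl = <-irrefl refl (ordered w r)
      ... | inj₂ (_ , ne , _ , _) = ne refl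
    lefts⇒heights (suc z) | yes z∈ | inj₂ (_ , q) | inj₁ (_ , q′) with ∈-map⁻ proj₁ (from (∈-map⁺ proj₁ q′))
    ...     | (_ , d) , r , refl with ≡-or-disjoint (disjoint wf) r q
    ...       | inj₁ refl = ⊥-elim (<-irrefl refl (ordered wf r))
    ...       | inj₂ (_ , ne , _ , _) = ⊥-elim (ne refl)

    -- The partner of a left endpoint is where the path first returns to its previous height. If the
    -- partners differed, the shorter arc would have come down at a point where the other matching
    -- is still strictly inside its arc, although the heights agree.
    lefts-determine-matching : M ≡ M′
    lefts-determine-matching = PM-⊆⇒≡ (Increasing⇒Unique inc) p p′ sub
      where
      sub : ∀ {q} → q ∈ M → q ∈ M′
      sub {zero , d} q∈ = contradiction (pos (proj₁ (PM-endpoints p q∈))) λ ()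
      sub {suc b , d} q∈ with ∈-map⁻ proj₁ (to (∈-map⁺ proj₁ q∈))
      ... | (_ , d′) , r , refl with <-cmp d d′
      ...   | tri≈ _ refl _ = r
      ...   | tri< d<d′ _ _ = ⊥-elim (<-irrefl refl (<-≤-trans
                (height-inside wf′ nc′ r (<⇒≤ (ordered wf q∈)) d<d′)
                (subst₂ _≤_ (lefts⇒heights d) (lefts⇒heights b) (height-after wf nc q∈))))
      ...   | tri> _ _ d′<d = ⊥-elim (<-irrefl refl (<-≤-trans
                (height-inside wf nc q∈ (<⇒≤ (ordered wf′ r)) d′<d)
                (subst₂ _≤_ (sym (lefts⇒heights d′)) (sym (lefts⇒heights b)) (height-after wf′ nc′ r))))

  -- `redPoints` and `bluePoints` as one recursion with the colour as a parameter, which suits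
  -- induction along the colouring.
  pointsOf : Bool → ℕ → List Bool → List ℕ
  pointsOf X z []       = []
  pointsOf X z (b ∷ bs) with agree X b
  ... | true  = z ∷ pointsOf X (suc z) bs
  ... | false = pointsOf X (suc z) bs

  pointsOf-range : ∀ X z bs {x} → x ∈ pointsOf X z bs → z ≤ x × x < z + length bs
  pointsOf-range X z (b ∷ bs) {x} x∈ with agree X b
  pointsOf-range X z (b ∷ bs) (here refl) | true = ≤-refl , m<m+n z z<s
  pointsOf-range X z (b ∷ bs) {x} (there x∈) | true with pointsOf-range X (suc z) bs x∈
  ... | l , u = <⇒≤ l , subst (x <_) (sym (+-suc z (length bs))) u
  pointsOf-range X z (b ∷ bs) {x} x∈ | false with pointsOf-range X (suc z) bs x∈
  ... | l , u = <⇒≤ l , subst (x <_) (sym (+-suc z (length bs))) u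

  pointsOf-increasing : ∀ X z bs → Increasing (pointsOf X z bs)
  pointsOf-increasing X z []       = []
  pointsOf-increasing X z (b ∷ bs) with agree X b
  ... | true  = All.tabulate (proj₁ ∘ pointsOf-range X (suc z) bs) ∷ pointsOf-increasing X (suc z) bs
  ... | false = pointsOf-increasing X (suc z) bs

  agree-clash : ∀ X b → agree X b ≡ true → agree (not X) b ≡ true → ⊥
  agree-clash true  true  _ ()
  agree-clash true  false () _
  agree-clash false true  () _
  agree-clash false false _ ()

  pointsOf-disjoint : ∀ X z bs {x} → x ∈ pointsOf X z bs → x ∉ pointsOf (not X) z bs
  pointsOf-disjoint X z (b ∷ bs) x∈ x∈′ with agree X b in e | agree (not X) b in e′
  ... | true  | true = agree-clash X b e e′
  pointsOf-disjoint X z (b ∷ bs) (here refl) x∈′ | true | false = 1+n≰n (proj₁ (pointsOf-range (not X) (suc z) bs x∈′))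
  pointsOf-disjoint X z (b ∷ bs) (there x∈) x∈′ | true | false = pointsOf-disjoint X (suc z) bs x∈ x∈′
  pointsOf-disjoint X z (b ∷ bs) x∈ (here refl) | false | true = 1+n≰n (proj₁ (pointsOf-range X (suc z) bs x∈))
  pointsOf-disjoint X z (b ∷ bs) x∈ (there x∈′) | false | true = pointsOf-disjoint X (suc z) bs x∈ x∈′
  ... | false | false = pointsOf-disjoint X (suc z) bs x∈ x∈′

  record IsOutcome (bs : List Bool) (mr mb : Matching) : Set where
    field
      red  : mr ∈ catalanMatchings (pointsOf true 1 bs)
      blue : mb ∈ catalanMatchings (pointsOf false 1 bs)

    mat : Bool → Matching
    mat true  = mr
    mat false = mb

    isPM : ∀ b → PM (pointsOf b 1 bs) (mat b)
    isPM true  = proj₁ (catalan-sound (pointsOf true 1 bs) red)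
    isPM false = proj₁ (catalan-sound (pointsOf false 1 bs) blue)

    isNC : ∀ b → NonCrossing (mat b)
    isNC true  = proj₂ (catalan-sound (pointsOf true 1 bs) red)
    isNC false = proj₂ (catalan-sound (pointsOf false 1 bs) blue)

    endpoint⇒point : ∀ b {z} → IsEndpoint z (mat b) → z ∈ pointsOf b 1 bs
    endpoint⇒point b (inj₁ (_ , q∈)) = proj₁ (PM-endpoints (isPM b) q∈)
    endpoint⇒point b (inj₂ (_ , q∈)) = proj₂ (PM-endpoints (isPM b) q∈)

    configuration : Configuration
    configuration = record
      { mat = mat
      ; wellFormed = λ b → PM-wellFormed (pointsOf-increasing b 1 bs) (isPM b)
      ; nonCrossing = isNC
      ; positive = λ b q∈ → proj₁ (pointsOf-range b 1 bs (proj₁ (PM-endpoints (isPM b) q∈)))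
      ; separate = λ b e → NotEndpoint-outside (isPM (not b)) (pointsOf-disjoint b 1 bs (endpoint⇒point b e))
      }

    coloured-from : ∀ z cs → (∀ b {x} → x ∈ pointsOf b z cs → IsEndpoint x (mat b)) →
      Configuration.Coloured configuration z cs
    coloured-from z []       h = Configuration.[]
    coloured-from z (b ∷ cs) h = h b (head b) Configuration.∷ coloured-from (suc z) cs (λ c x∈ → h c (tail c x∈))
      where
      head : ∀ b → z ∈ pointsOf b z (b ∷ cs)
      head b rewrite agree-refl b = here refl
      tail : ∀ c {x} → x ∈ pointsOf c (suc z) cs → x ∈ pointsOf c z (b ∷ cs)
      tail c x∈ with agree c b
      ... | true  = there x∈
      ... | false = x∈

    isBounded : Bounded configuration (suc (length bs))
    isBounded q∈ with arcs-∈-mat configuration q∈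
    ... | b , q∈′ = proj₂ (pointsOf-range b 1 bs (proj₂ (PM-endpoints (isPM b) q∈′)))

  outcomeWord : List Bool → Matching → Matching → List Letter
  outcomeWord bs mr mb = wordFrom (map proj₁ (mr ++ mb)) 1 bs

  length-wordFrom : ∀ L z bs → length (wordFrom L z bs) ≡ length bs
  length-wordFrom L z []       = refl
  length-wordFrom L z (b ∷ bs) = cong suc (length-wordFrom L (suc z) bs)

  isolated≡isoCount-word : ∀ {bs mr mb} c → IsOutcome bs mr mb →
    isolated (c , mr , mb) ≡ isoCount (outcomeWord bs mr mb)
  isolated≡isoCount-word {bs} c o = isolated≡isoCount configuration bs isBounded
    (coloured-from 1 bs λ b x∈ → PM-covers (isPM b) x∈)
    where open IsOutcome o

  wordFrom-colours : ∀ L z bs → map proj₁ (wordFrom L z bs) ≡ bs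
  wordFrom-colours L z []       = refl
  wordFrom-colours L z (b ∷ bs) = cong (b ∷_) (wordFrom-colours L (suc z) bs)

  wordFrom-lefts : ∀ {L L′} z bs {x} → wordFrom L z bs ≡ wordFrom L′ z bs →
    z ≤ x → x < z + length bs → x ∈ L → x ∈ L′
  wordFrom-lefts z [] eq z≤x x< x∈ =
    ⊥-elim (<-irrefl refl (<-≤-trans x< (≤-trans (≤-reflexive (+-identityʳ z)) z≤x)))
  wordFrom-lefts {L} {L′} z (b ∷ bs) {x} eq z≤x x< x∈ with ∷-injective eq | x ≟ z
  ... | _  , eq′ | no ne = wordFrom-lefts (suc z) bs eq′ (≤∧≢⇒< z≤x (ne ∘ sym)) (subst (x <_) (+-suc z (length bs)) x<) x∈
  ... | e , _ | yes refl with x ∈? L | x ∈? L′ | cong proj₂ e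
  ...   | _     | yes q | _ = q
  ...   | no ∉  | no _ | _ = ⊥-elim (∉ x∈)
  ...   | yes _ | no _ | ()

  outcomeWord-injective : ∀ {bs mr mb mr′ mb′} → IsOutcome bs mr mb → IsOutcome bs mr′ mb′ →
    outcomeWord bs mr mb ≡ outcomeWord bs mr′ mb′ → mr ≡ mr′ × mb ≡ mb′
  outcomeWord-injective {bs} o o′ eq = same true , same false
    where
    module O = IsOutcome o
    module O′ = IsOutcome o′
    transfer : ∀ {mr mb mr′ mb′} (o : IsOutcome bs mr mb) (o′ : IsOutcome bs mr′ mb′) →
      outcomeWord bs mr mb ≡ outcomeWord bs mr′ mb′ → ∀ b {z} →
      z ∈ map proj₁ (IsOutcome.mat o b) → z ∈ map proj₁ (IsOutcome.mat o′ b)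
    transfer o o′ eq b z∈ with ∈-map⁻ proj₁ z∈
    ... | (z , y) , q∈ , refl = ∈-map⁺ proj₁ (proj₂ (left-end P′.configuration (PM-covers (P′.isPM b) z∈S)
        (wordFrom-lefts 1 bs eq (proj₁ (pointsOf-range b 1 bs z∈S)) (proj₂ (pointsOf-range b 1 bs z∈S))
          (∈-map⁺ proj₁ (mat-∈-arcs P.configuration b q∈)))))
      where
      module P = IsOutcome o
      module P′ = IsOutcome o′
      z∈S = proj₁ (PM-endpoints (P.isPM b) q∈)
    same : ∀ b → O.mat b ≡ O′.mat b
    same b = lefts-determine-matching (pointsOf-increasing b 1 bs) (O.isPM b) (O′.isPM b) (O.isNC b) (O′.isNC b)
      (proj₁ ∘ pointsOf-range b 1 bs) (transfer o o′ eq b) (transfer o′ o (sym eq) b)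

  zip-filter : ∀ X f z bs → (∀ i → f i ≡ z + i) →
    map proj₁ (filterᵇ (λ p → agree X (proj₂ p)) (zip (applyUpTo f (length bs)) bs)) ≡ pointsOf X z bs
  zip-filter X f z []       h = refl
  zip-filter X f z (b ∷ bs) h with agree X b
  ... | true  = cong₂ _∷_ (trans (h 0) (+-identityʳ z)) (zip-filter X (f ∘ suc) (suc z) bs (λ i → trans (h (suc i)) (+-suc z i)))
  ... | false = zip-filter X (f ∘ suc) (suc z) bs (λ i → trans (h (suc i)) (+-suc z i))

  allColourings-length : ∀ k {c} → c ∈ allColourings k → length c ≡ k
  allColourings-length zero    (here refl) = refl
  allColourings-length (suc k) c∈ with ∈-concatMap-elim (λ bs → (true ∷ bs) ∷ (false ∷ bs) ∷ []) (allColourings k) c∈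
  ... | bs , bs∈ , here refl         = cong suc (allColourings-length k bs∈)
  ... | bs , bs∈ , there (here refl) = cong suc (allColourings-length k bs∈)

  Unique-allColourings : ∀ k → Unique (allColourings k)
  Unique-allColourings zero    = [] ∷ []
  Unique-allColourings (suc k) = Unique-concatMap _ (drop 1) Function.id
    (λ { (here refl) → refl ; (there (here refl)) → refl ; (there (there ())) })
    (λ _ _ → ((λ ()) ∷ []) ∷ [] ∷ [])
    (subst Unique (sym (Data.List.Properties.map-id _)) (Unique-allColourings k))

  length-fullColouring : ∀ n {c} → c ∈ allColourings (2 * suc n ∸ 1) → length (fullColouring c) ≡ 2 * suc n
  length-fullColouring n {c} c∈ = trans (length-++ c) (trans (cong (_+ 1) (allColourings-length (2 * suc n ∸ 1) c∈)) (+-comm _ 1))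

  redPoints≡ : ∀ n c → length (fullColouring c) ≡ 2 * n → redPoints n c ≡ pointsOf true 1 (fullColouring c)
  redPoints≡ n c eq rewrite sym eq | map-applyUpTo Function.id suc (length (fullColouring c)) =
    zip-filter true suc 1 (fullColouring c) (λ _ → refl)

  bluePoints≡ : ∀ n c → length (fullColouring c) ≡ 2 * n → bluePoints n c ≡ pointsOf false 1 (fullColouring c)
  bluePoints≡ n c eq rewrite sym eq | map-applyUpTo Function.id suc (length (fullColouring c)) =
    zip-filter false suc 1 (fullColouring c) (λ _ → refl)

  weight : ℕ → List Bool → ℚ
  weight n c = inv (2 ℕ.^ (2 * n ∸ 1)) ℚ.*
    (inv (length (catalanMatchings (redPoints n c))) ℚ.* inv (length (catalanMatchings (bluePoints n c))))

  perColouring : ℕ → List Bool → List (ℚ × Outcome)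
  perColouring n c = concatMap (λ mr → map (λ mb → weight n c , (c , mr , mb)) (catalanMatchings (bluePoints n c)))
                               (catalanMatchings (redPoints n c))

  record OutcomeData (n : ℕ) (w : ℚ) (c : List Bool) (mr mb : Matching) : Set where
    field
      w≡    : w ≡ weight n c
      c∈    : c ∈ allColourings (2 * n ∸ 1)
      red∈  : mr ∈ catalanMatchings (redPoints n c)
      blue∈ : mb ∈ catalanMatchings (bluePoints n c)

  perColouring-elim : ∀ n c {w c′ mr mb} → (w , (c′ , mr , mb)) ∈ perColouring n c →
    w ≡ weight n c × c′ ≡ c × mr ∈ catalanMatchings (redPoints n c) × mb ∈ catalanMatchings (bluePoints n c)
  perColouring-elim n c o∈ with ∈-concatMap-elim (λ mr → map (λ mb → weight n c , (c , mr , mb)) (catalanMatchings (bluePoints n c))) (catalanMatchings (redPoints n c)) o∈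
  ... | mr , mr∈ , o∈′ with ∈-map⁻ (λ mb → weight n c , (c , mr , mb)) o∈′
  ... | mb , mb∈ , refl = refl , refl , mr∈ , mb∈

  outcomes-elim : ∀ n {w c mr mb} → (w , (c , mr , mb)) ∈ outcomes n → OutcomeData n w c mr mb
  outcomes-elim n o∈ with ∈-concatMap-elim (perColouring n) (allColourings (2 * n ∸ 1)) o∈
  ... | c , c∈ , o∈′ with perColouring-elim n c o∈′
  ... | w≡ , refl , r , b = record { w≡ = w≡ ; c∈ = c∈ ; red∈ = r ; blue∈ = b }

  isOutcome : ∀ {n w c mr mb} → OutcomeData (suc n) w c mr mb → IsOutcome (fullColouring c) mr mb
  isOutcome {n} {c = c} {mr} {mb} d = record
    { red  = subst (λ S → mr ∈ catalanMatchings S) (redPoints≡ (suc n) c (length-fullColouring n c∈)) red∈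
    ; blue = subst (λ S → mb ∈ catalanMatchings S) (bluePoints≡ (suc n) c (length-fullColouring n c∈)) blue∈ }
    where open OutcomeData d

  Unique-outcomes : ∀ n → Unique (outcomes (suc n))
  Unique-outcomes n = Unique-concatMap (perColouring (suc n)) (proj₁ ∘ proj₂) Function.id
    (λ {c} o∈ → proj₁ (proj₂ (perColouring-elim (suc n) c o∈))) inner
    (subst Unique (sym (Data.List.Properties.map-id _)) (Unique-allColourings (2 * suc n ∸ 1)))
    where
    inner : ∀ c → c ∈ allColourings (2 * suc n ∸ 1) → Unique (perColouring (suc n) c)
    inner c c∈ = Unique-concatMap (λ mr → map (λ mb → weight (suc n) c , (c , mr , mb)) blues) (proj₁ ∘ proj₂ ∘ proj₂) Function.id
      keyed
      (λ mr _ → Unique.map⁺ (λ { refl → refl }) (subst (Unique ∘ catalanMatchings) (sym (bluePoints≡ (suc n) c len)) (Unique-catalan (pointsOf-increasing false 1 (fullColouring c)))))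
      (subst Unique (sym (Data.List.Properties.map-id _))
        (subst (Unique ∘ catalanMatchings) (sym (redPoints≡ (suc n) c len)) (Unique-catalan (pointsOf-increasing true 1 (fullColouring c)))))
      where
      len = length-fullColouring n c∈
      blues = catalanMatchings (bluePoints (suc n) c)
      keyed : ∀ {mr o} → o ∈ map (λ mb → weight (suc n) c , (c , mr , mb)) blues → proj₁ (proj₂ (proj₂ o)) ≡ mr
      keyed {mr} o∈ with ∈-map⁻ (λ mb → weight (suc n) c , (c , mr , mb)) o∈
      ... | _ , _ , refl = refl

  wordOf : Outcome → List Letter
  wordOf (c , mr , mb) = outcomeWord (fullColouring c) mr mb

  -- The colours of the word give the full colouring, hence the colouring without its parity bit;
  -- the opening letters give the left endpoints, hence both matchings. The weight is a function of
  -- the colouring, so even the weighted outcomes agree.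
  wordOf-injective : ∀ n {o o′} → o ∈ outcomes (suc n) → o′ ∈ outcomes (suc n) →
    wordOf (proj₂ o) ≡ wordOf (proj₂ o′) → o ≡ o′
  wordOf-injective n {w , c , mr , mb} {w′ , c′ , mr′ , mb′} o∈ o∈′ eq =
    assemble same-c (outcomes-elim (suc n) o∈) (outcomes-elim (suc n) o∈′) eq
    where
    same-c : c ≡ c′
    same-c = proj₁ (∷ʳ-injective c c′
      (trans (sym (wordFrom-colours (map proj₁ (mr ++ mb)) 1 (fullColouring c)))
      (trans (cong (map proj₁) eq) (wordFrom-colours (map proj₁ (mr′ ++ mb′)) 1 (fullColouring c′)))))
    assemble : ∀ {w c mr mb w′ c′ mr′ mb′} → c ≡ c′ → OutcomeData (suc n) w c mr mb → OutcomeData (suc n) w′ c′ mr′ mb′ →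
      outcomeWord (fullColouring c) mr mb ≡ outcomeWord (fullColouring c′) mr′ mb′ →
      (w , (c , mr , mb)) ≡ (w′ , (c′ , mr′ , mb′))
    assemble {w} {c} {mr} {mb} {w′} refl d d′ eq =
      cong₂ _,_ (trans (OutcomeData.w≡ d) (sym (OutcomeData.w≡ d′)))
        (cong₂ (λ x y → c , x , y) (proj₁ same) (proj₂ same))
      where
      same = outcomeWord-injective (isOutcome d) (isOutcome d′) eq

  letters : List Letter
  letters = (true , true) ∷ (true , false) ∷ (false , true) ∷ (false , false) ∷ []

  allWords : ℕ → List (List Letter)
  allWords zero    = [] ∷ []
  allWords (suc k) = concatMap (λ l → map (l ∷_) (allWords k)) letters

  ∈-letters : ∀ l → l ∈ letters
  ∈-letters (true , true)   = here refl
  ∈-letters (true , false)  = there (here refl)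
  ∈-letters (false , true)  = there (there (here refl))
  ∈-letters (false , false) = there (there (there (here refl)))

  ∈-allWords : ∀ w → w ∈ allWords (length w)
  ∈-allWords []      = here refl
  ∈-allWords (l ∷ w) = ∈-concatMap-intro (λ l → map (l ∷_) (allWords (length w))) (∈-letters l) (∈-map⁺ (l ∷_) (∈-allWords w))

  count-outcomes-≤ : ∀ n (bad : List Letter → Bool) →
    length (filterᵇ (λ o → bad (wordOf (proj₂ o))) (outcomes (suc n))) ≤
    length (filterᵇ bad (allWords (2 * suc n)))
  count-outcomes-≤ n bad = subst (_≤ length (filterᵇ bad (allWords (2 * suc n)))) (length-map (wordOf ∘ proj₂) bads)
    (Unique-⊆⇒length-≤
      (Unique-map-∈ (wordOf ∘ proj₂) (Unique.filter⁺ (λ o → T? (bad (wordOf (proj₂ o)))) (Unique-outcomes n))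
        (λ x∈ y∈ → wordOf-injective n (proj₁ (elim x∈)) (proj₁ (elim y∈))))
      sub)
    where
    open import Data.Bool.Properties using (T?)
    bads = filterᵇ (λ o → bad (wordOf (proj₂ o))) (outcomes (suc n))
    elim : ∀ {o} → o ∈ bads → o ∈ outcomes (suc n) × T (bad (wordOf (proj₂ o)))
    elim = ∈-filter⁻ (λ o → T? (bad (wordOf (proj₂ o)))) {xs = outcomes (suc n)}
    sub : ∀ {w} → w ∈ map (wordOf ∘ proj₂) bads → w ∈ filterᵇ bad (allWords (2 * suc n))
    sub w∈ with ∈-map⁻ (wordOf ∘ proj₂) w∈
    ... | (v , c , mr , mb) , o∈ , refl with elim o∈
    ...   | o∈′ , t = ∈-filter⁺ (λ w → T? (bad w))
      (subst (λ k → wordOf (c , mr , mb) ∈ allWords k)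
        (trans (length-wordFrom (map proj₁ (mr ++ mb)) 1 (fullColouring c)) (length-fullColouring n (OutcomeData.c∈ (outcomes-elim (suc n) o∈′))))
        (∈-allWords (wordOf (c , mr , mb)))) t

-- A lower bound for the number of Catalan-arc matchings.

module CatalanNumbers where

  open Matchings
  open Scanning
  open Outcomes
  open import Data.Nat
  open import Data.Nat.Properties
  open import Data.Nat.Combinatorics using (_C_; nCk+nC[k+1]≡[n+1]C[k+1]; nCk≡nC[n∸k]; nCn≡1)
  open import Data.Nat.Tactic.RingSolver using (solve-∀)
  open import Data.List.Membership.DecPropositional _≟_ using (_∈?_)
  open import Data.List.Membership.Propositional.Properties
  open import Data.List.Relation.Unary.All using (All; []; _∷_)
  open import Data.List.Relation.Unary.AllPairs using ([]; _∷_)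
  open import Data.List.Relation.Unary.Unique.Propositional using (Unique)

  -- Paths of `k` steps up or down by one, from height `h` to height 0, that never go below 0.
  paths : ℕ → ℕ → ℕ
  paths zero    zero    = 1
  paths zero    (suc h) = 0
  paths (suc k) zero    = paths k 1
  paths (suc k) (suc h) = paths k (2 + h) + paths k h

  dyck : ℕ → ℕ → List (List Bool)
  dyck zero    zero    = [] ∷ []
  dyck zero    (suc h) = []
  dyck (suc k) zero    = map (true ∷_) (dyck k 1)
  dyck (suc k) (suc h) = map (true ∷_) (dyck k (2 + h)) ++ map (false ∷_) (dyck k h)

  length-dyck : ∀ k h → length (dyck k h) ≡ paths k h
  length-dyck zero    zero    = refl
  length-dyck zero    (suc h) = refl
  length-dyck (suc k) zero    = trans (length-map _ (dyck k 1)) (length-dyck k 1)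
  length-dyck (suc k) (suc h) = trans (length-++ (map (true ∷_) (dyck k (2 + h))))
    (cong₂ _+_ (trans (length-map _ (dyck k (2 + h))) (length-dyck k (2 + h)))
               (trans (length-map _ (dyck k h)) (length-dyck k h)))

  Unique-dyck : ∀ k h → Unique (dyck k h)
  Unique-dyck zero    zero    = [] ∷ []
  Unique-dyck zero    (suc h) = []
  Unique-dyck (suc k) zero    = Unique.map⁺ (λ { refl → refl }) (Unique-dyck k 1)
  Unique-dyck (suc k) (suc h) = Unique.++⁺ (Unique.map⁺ (λ { refl → refl }) (Unique-dyck k (2 + h)))
    (Unique.map⁺ (λ { refl → refl }) (Unique-dyck k h)) clash
    where
    clash : ∀ {v} → ¬ (v ∈ map (true ∷_) (dyck k (2 + h)) × v ∈ map (false ∷_) (dyck k h))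
    clash (p , q) with ∈-map⁻ (true ∷_) p | ∈-map⁻ (false ∷_) q
    ... | _ , _ , refl | _ , _ , ()

  data Tree : Set where
    leaf : Tree
    node : Tree → Tree → Tree

  flatten : Tree → List Bool
  flatten leaf       = []
  flatten (node s t) = true ∷ flatten s ++ false ∷ flatten t

  descents : List Tree → List Bool
  descents []       = []
  descents (t ∷ ts) = false ∷ flatten t ++ descents ts

  -- A path from height `h` to 0 is cut at its first visits to h-1, ..., 0. The pieces between the
  -- cuts are Dyck words, which explains the `h` further trees.
  parse : ∀ k h {v} → v ∈ dyck k h →
    ∃₂ λ t ts → length ts ≡ h × v ≡ flatten t ++ descents ts
  -- Prefixing an up step joins the first two pieces of a path from height `suc h`: they become the
  -- left and right subtree of one node.
  parse-up : ∀ k h {v} → v ∈ dyck k (suc h) → ∃₂ λ t ts → length ts ≡ h × true ∷ v ≡ flatten t ++ descents ts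

  parse zero    zero    (here refl) = leaf , [] , refl , refl
  parse (suc k) zero    v∈ with ∈-map⁻ (true ∷_) v∈
  ... | v , v∈′ , refl = parse-up k zero v∈′
  parse (suc k) (suc h) v∈ with ∈-++⁻ (map (true ∷_) (dyck k (2 + h))) v∈
  ... | inj₁ p with ∈-map⁻ (true ∷_) p
  ...   | v , v∈′ , refl = parse-up k (suc h) v∈′
  parse (suc k) (suc h) v∈ | inj₂ p with ∈-map⁻ (false ∷_) p
  ...   | v , v∈′ , refl with parse k h v∈′
  ...     | t , ts , len , refl = leaf , t ∷ ts , cong suc len , refl

  parse-up k h v∈ with parse k (suc h) v∈
  ... | t , u ∷ ts , len , refl = node t u , ts , suc-injective len ,
        cong (true ∷_) (sym (++-assoc (flatten t) (false ∷ flatten u) (descents ts)))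

  pattern-of : Matching → List ℕ → List Bool
  pattern-of M S = map (λ z → does (z ∈? map proj₁ M)) S

  PM-++ : ∀ {A B M N} → PM A M → PM B N → PM (A ++ B) (M ++ N)
  PM-++ []              q = q
  PM-++ {B = B} (arc {x} {y} E D p) q =
    subst (λ S → PM (x ∷ S) _) (sym (++-assoc E (y ∷ D) B))
      (arc E (D ++ B) (subst (λ S → PM S _) (++-assoc E D B) (PM-++ p q)))

  Increasing-split : ∀ A {y B} → Increasing (A ++ y ∷ B) →
    Increasing A × (∀ {z} → z ∈ A → z < y) × (∀ {z} → z ∈ B → y < z) × Increasing B
  Increasing-split []      (y< ∷ inc) = [] , (λ ()) , All.lookup y< , inc
  Increasing-split (x ∷ A) {y} (x< ∷ inc) with Increasing-split A inc
  ... | incA , A<y , y<B , incB =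
    All.tabulate (λ z∈ → All.lookup x< (∈-++⁺ˡ z∈)) ∷ incA , below , y<B , incB
    where
    below : ∀ {z} → z ∈ x ∷ A → z < y
    below (here refl) = All.lookup x< (∈-++⁺ʳ A (here refl))
    below (there z∈)  = A<y z∈

  does-cong : ∀ {P Q : Set} (p : Dec P) (q : Dec Q) → (P → Q) → (Q → P) → does p ≡ does q
  does-cong (yes _) (yes _) _ _ = refl
  does-cong (no _)  (no _)  _ _ = refl
  does-cong (yes p) (no ¬q) f _ = contradiction (f p) ¬q
  does-cong (no ¬p) (yes q) _ g = contradiction (g q) ¬p

  split-at : ∀ {A : Set} a {b} (S : List A) → length S ≡ a + suc b →
    ∃[ xs ] ∃[ y ] ∃[ ys ] S ≡ xs ++ y ∷ ys × length xs ≡ a × length ys ≡ b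
  split-at zero    (y ∷ ys) eq = [] , y , ys , refl , refl , suc-injective eq
  split-at (suc a) (x ∷ S)  eq with split-at a S (suc-injective eq)
  ... | xs , y , ys , refl , e₁ , e₂ = x ∷ xs , y , ys , refl , cong suc e₁ , e₂

  -- First-return decomposition: the first point is matched with the point just after the
  -- `length (flatten s)` points of the left subtree, which lie under this arc; the right subtree
  -- takes the points after it.
  tree-matching : ∀ t S → Increasing S → length S ≡ length (flatten t) →
    ∃[ M ] PM S M × NonCrossing M × pattern-of M S ≡ flatten t
  tree-matching leaf       []      _ _ = [] , [] , (λ ()) , refl
  tree-matching (node s t) (x ∷ S) (x< ∷ inc) eq
    with split-at (length (flatten s)) S (trans (suc-injective eq) (length-++ (flatten s)))
  ... | A , y , B , refl , lenA , lenB
    with Increasing-split A inc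
  ... | incA , A<y , y<B , incB
    with tree-matching s A incA lenA | tree-matching t B incB lenB
  ... | M , pM , ncM , patM | N , pN , ncN , patN =
    (x , y) ∷ M ++ N , arc A B (PM-++ pM pN) , nc , cong₂ _∷_ pat-x (begin
      map inL (A ++ y ∷ B) ≡⟨ map-++ inL A (y ∷ B) ⟩
      map inL A ++ inL y ∷ map inL B ≡⟨ cong₂ (λ l b → l ++ b ∷ map inL B) (trans (map-cong-local (All.tabulate pat-A)) patM) pat-y ⟩
      flatten s ++ false ∷ map inL B ≡⟨ cong (λ l → flatten s ++ false ∷ l) (trans (map-cong-local (All.tabulate pat-B)) patN) ⟩
      flatten s ++ false ∷ flatten t ∎)
    where
    open ≡-Reasoning
    L = map proj₁ ((x , y) ∷ M ++ N)
    inL : ℕ → Bool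
    inL z = does (z ∈? L)
    x<A : ∀ {z} → z ∈ A → x < z
    x<A z∈ = All.lookup x< (∈-++⁺ˡ z∈)
    x<y : x < y
    x<y = All.lookup x< (∈-++⁺ʳ A (here refl))
    MA : ∀ {b d} → (b , d) ∈ M → (x < b × b < y) × (x < d × d < y)
    MA q∈ with PM-endpoints pM q∈
    ... | b∈ , d∈ = (x<A b∈ , A<y b∈) , (x<A d∈ , A<y d∈)
    NB : ∀ {b d} → (b , d) ∈ N → y < b × y < d
    NB q∈ with PM-endpoints pN q∈
    ... | b∈ , d∈ = y<B b∈ , y<B d∈
    nc : NonCrossing ((x , y) ∷ M ++ N)
    nc (here refl) (here refl) (p , _) = <-irrefl refl p
    nc (here refl) (there q∈) (p , q , r) with ∈-++⁻ M q∈
    ... | inj₁ q∈M = <-asym r (proj₂ (proj₂ (MA q∈M)))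
    ... | inj₂ q∈N = <-asym q (proj₁ (NB q∈N))
    nc (there p∈) (here refl) (p , _) with ∈-++⁻ M p∈
    ... | inj₁ p∈M = <-asym p (proj₁ (proj₁ (MA p∈M)))
    ... | inj₂ p∈N = <-asym p (<-trans x<y (proj₁ (NB p∈N)))
    nc (there p∈) (there q∈) (p , q , r) with ∈-++⁻ M p∈ | ∈-++⁻ M q∈
    ... | inj₁ p∈M | inj₁ q∈M = ncM p∈M q∈M (p , q , r)
    ... | inj₁ p∈M | inj₂ q∈N = <-asym q (<-trans (proj₂ (proj₂ (MA p∈M))) (proj₁ (NB q∈N)))
    ... | inj₂ p∈N | inj₁ q∈M = <-asym p (<-trans (proj₂ (proj₁ (MA q∈M))) (proj₁ (NB p∈N)))
    ... | inj₂ p∈N | inj₂ q∈N = ncN p∈N q∈N (p , q , r)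
    L-elim : ∀ {z} → z ∈ L → z ≡ x ⊎ z ∈ map proj₁ M ⊎ z ∈ map proj₁ N
    L-elim (here e) = inj₁ e
    L-elim (there z∈) = inj₂ (∈-++⁻ (map proj₁ M) (subst (_ ∈_) (map-++ proj₁ M N) z∈))
    lefts-M : ∀ {z} → z ∈ map proj₁ M → x < z × z < y
    lefts-M z∈ with ∈-map⁻ proj₁ z∈
    ... | _ , q∈ , refl = proj₁ (MA q∈)
    lefts-N : ∀ {z} → z ∈ map proj₁ N → y < z
    lefts-N z∈ with ∈-map⁻ proj₁ z∈
    ... | _ , q∈ , refl = proj₁ (NB q∈)
    pat-x : inL x ≡ true
    pat-x = dec-true (x ∈? L) (here refl)
    pat-y : inL y ≡ false
    pat-y = dec-false (y ∈? L) λ y∈ → absurd (L-elim y∈)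
      where
      absurd : y ≡ x ⊎ y ∈ map proj₁ M ⊎ y ∈ map proj₁ N → ⊥
      absurd (inj₁ refl)       = <-irrefl refl x<y
      absurd (inj₂ (inj₁ y∈M)) = <-irrefl refl (proj₂ (lefts-M y∈M))
      absurd (inj₂ (inj₂ y∈N)) = <-irrefl refl (lefts-N y∈N)
    pat-A : ∀ {z} → z ∈ A → inL z ≡ does (z ∈? map proj₁ M)
    pat-A {z} z∈A = does-cong (z ∈? L) (z ∈? map proj₁ M) to
      (λ z∈ → there (subst (z ∈_) (sym (map-++ proj₁ M N)) (∈-++⁺ˡ z∈)))
      where
      to : z ∈ L → z ∈ map proj₁ M
      to z∈ with L-elim z∈
      ... | inj₁ refl = ⊥-elim (<-irrefl refl (x<A z∈A))
      ... | inj₂ (inj₁ r) = r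
      ... | inj₂ (inj₂ r) = ⊥-elim (<-asym (lefts-N r) (A<y z∈A))
    pat-B : ∀ {z} → z ∈ B → inL z ≡ does (z ∈? map proj₁ N)
    pat-B {z} z∈B = does-cong (z ∈? L) (z ∈? map proj₁ N) to
      (λ z∈ → there (subst (z ∈_) (sym (map-++ proj₁ M N)) (∈-++⁺ʳ (map proj₁ M) z∈)))
      where
      to : z ∈ L → z ∈ map proj₁ N
      to z∈ with L-elim z∈
      ... | inj₁ refl = ⊥-elim (<-asym x<y (y<B z∈B))
      ... | inj₂ (inj₁ r) = ⊥-elim (<-asym (proj₂ (lefts-M r)) (y<B z∈B))
      ... | inj₂ (inj₂ r) = r

  dyck-length : ∀ k h {v} → v ∈ dyck k h → length v ≡ k
  dyck-length zero    zero    (here refl) = refl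
  dyck-length (suc k) zero    v∈ with ∈-map⁻ (true ∷_) v∈
  ... | v , v∈′ , refl = cong suc (dyck-length k 1 v∈′)
  dyck-length (suc k) (suc h) v∈ with ∈-++⁻ (map (true ∷_) (dyck k (2 + h))) v∈
  ... | inj₁ p with ∈-map⁻ (true ∷_) p
  ...   | v , v∈′ , refl = cong suc (dyck-length k (2 + h) v∈′)
  dyck-length (suc k) (suc h) v∈ | inj₂ p with ∈-map⁻ (false ∷_) p
  ...   | v , v∈′ , refl = cong suc (dyck-length k h v∈′)

  -- Every Dyck word is the pattern of left endpoints of some non-crossing matching. For a lower
  -- bound it is enough that the pattern map is onto.
  paths≤catalanMatchings : ∀ S → Increasing S → paths (length S) 0 ≤ length (catalanMatchings S)
  paths≤catalanMatchings S inc = subst₂ _≤_ (length-dyck (length S) 0) (length-map (λ M → pattern-of M S) (catalanMatchings S))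
    (Unique-⊆⇒length-≤ (Unique-dyck (length S) 0) sub)
    where
    sub : ∀ {v} → v ∈ dyck (length S) 0 → v ∈ map (λ M → pattern-of M S) (catalanMatchings S)
    sub {v} v∈ with parse (length S) 0 v∈ | dyck-length (length S) 0 v∈
    ... | t , [] , _ , eq | len with tree-matching t S inc (trans (sym len) (cong length (trans eq (Data.List.Properties.++-identityʳ _))))
    ...   | M , pM , ncM , pat = subst (_∈ map (λ M → pattern-of M S) (catalanMatchings S))
              (trans pat (sym (trans eq (Data.List.Properties.++-identityʳ _))))
              (∈-map⁺ (λ M → pattern-of M S) (catalan-complete pM ncM))

  paths-zero : ∀ n h → n < h → paths n h ≡ 0
  paths-zero zero    (suc h) _         = refl
  paths-zero (suc n) (suc h) (s≤s n<h) = cong₂ _+_ (paths-zero n (2 + h) (m<n⇒m<1+n (m<n⇒m<1+n n<h))) (paths-zero n h n<h)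

  -- n C (k - 1), with n C (-1) = 0
  binomPred : ℕ → ℕ → ℕ
  binomPred n zero    = 0
  binomPred n (suc k) = n C k

  pascal : ∀ n k → suc n C k ≡ binomPred n k + n C k
  pascal n zero    = trans (nC0 (suc n)) (sym (nC0 n))
    where
    nC0 : ∀ m → m C 0 ≡ 1
    nC0 m = trans (nCk≡nC[n∸k] {0} {m} z≤n) (nCn≡1 m)
  pascal n (suc k) = sym (nCk+nC[k+1]≡[n+1]C[k+1] n k)

  middle-symmetric : ∀ k → suc (k + k) C suc k ≡ suc (k + k) C k
  middle-symmetric k = sym (trans (nCk≡nC[n∸k] (m≤n⇒m≤1+n (m≤m+n k k)))
    (cong (suc (k + k) C_) (trans (cong (_∸ k) (sym (+-suc k k))) (m+n∸m≡n k (suc k)))))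

  -- The reflection principle, with `k` the number of up steps: `binomPred n k` counts the paths
  -- that do go below 0. The induction is Pascal's rule; at `h = 0` it closes because the two middle
  -- binomials of an odd row are equal.
  ballot : ∀ n k h → n ≡ h + (k + k) → paths n h + binomPred n k ≡ n C k
  ballot zero    zero    zero    eq = refl
  ballot (suc n) (suc k) zero    eq = begin
    paths n 1 + suc n C k ≡⟨ cong (paths n 1 +_) (pascal n k) ⟩
    paths n 1 + (binomPred n k + n C k) ≡⟨ +-assoc (paths n 1) _ _ ⟨
    paths n 1 + binomPred n k + n C k ≡⟨ cong (_+ n C k) (ballot n k 1 n≡) ⟩
    n C k + n C k ≡⟨ cong (n C k +_) (subst (λ m → m C k ≡ m C suc k) (sym n≡) (sym (middle-symmetric k))) ⟩
    n C k + n C suc k ≡⟨ nCk+nC[k+1]≡[n+1]C[k+1] n k ⟩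
    suc n C suc k ∎
    where
    open ≡-Reasoning
    n≡ : n ≡ suc (k + k)
    n≡ = trans (suc-injective eq) (+-suc k k)
  ballot (suc n) zero (suc h) eq = begin
    paths n (2 + h) + paths n h + 0 ≡⟨ cong (λ t → t + paths n h + 0) (paths-zero n (2 + h) (s≤s (≤-trans (≤-reflexive (trans n≡ (+-identityʳ h))) (n≤1+n h)))) ⟩
    paths n h + 0 ≡⟨ ballot n zero h n≡ ⟩
    n C 0 ≡⟨ pascal n 0 ⟨
    suc n C 0 ∎
    where
    open ≡-Reasoning
    n≡ : n ≡ h + 0
    n≡ = suc-injective eq
  ballot (suc n) (suc k) (suc h) eq = begin
    paths n (2 + h) + paths n h + suc n C k ≡⟨ cong (paths n (2 + h) + paths n h +_) (pascal n k) ⟩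
    paths n (2 + h) + paths n h + (binomPred n k + n C k) ≡⟨ shuffle (paths n (2 + h)) (paths n h) (binomPred n k) (n C k) ⟩
    (paths n (2 + h) + binomPred n k) + (paths n h + n C k) ≡⟨ cong₂ _+_ (ballot n k (2 + h) n≡) (ballot n (suc k) h (suc-injective eq)) ⟩
    n C k + n C suc k ≡⟨ nCk+nC[k+1]≡[n+1]C[k+1] n k ⟩
    suc n C suc k ∎
    where
    open ≡-Reasoning
    shuffle : ∀ a b c d → a + b + (c + d) ≡ (a + c) + (b + d)
    shuffle = solve-∀
    n≡ : n ≡ 2 + h + (k + k)
    n≡ = trans (suc-injective eq) (arith h k)
      where
      arith : ∀ h k → h + suc (k + suc k) ≡ 2 + h + (k + k)
      arith = solve-∀

  -- The identity (k+1) C(n,k+1) = (n-k) C(n,k), arranged so that no truncated subtraction appears.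
  absorption : ∀ n k → suc k * (n C suc k) + k * (n C k) ≡ n * (n C k)
  absorption zero    zero    = refl
  absorption zero    (suc k) = trans (cong₂ _+_ (*-zeroʳ k) (*-zeroʳ k)) refl
  absorption (suc n) zero    rewrite sym (nCk+nC[k+1]≡[n+1]C[k+1] n 0) | pascal n 0 =
    trans (arith₁ (n C 0) (n C 1)) (cong (n C 0 +_) (trans (arith₂ (n C 1) (n C 0)) (absorption n 0)))
    where
    arith₁ : ∀ a b → 1 * (a + b) + 0 ≡ a + b
    arith₁ = solve-∀
    arith₂ : ∀ b a → b ≡ 1 * b + 0 * a
    arith₂ = solve-∀
  absorption (suc n) (suc k) rewrite sym (nCk+nC[k+1]≡[n+1]C[k+1] n (suc k)) | sym (nCk+nC[k+1]≡[n+1]C[k+1] n k) = begin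
    suc (suc k) * (b + c) + suc k * (a + b) ≡⟨ arith k a b c ⟩
    (suc (suc k) * c + suc k * b) + (suc k * b + k * a) + (a + b)
      ≡⟨ cong₂ (λ s t → s + t + (a + b)) (absorption n (suc k)) (absorption n k) ⟩
    n * b + n * a + (a + b) ≡⟨ arith′ n a b ⟩
    suc n * (a + b) ∎
    where
    open ≡-Reasoning
    a = n C k
    b = n C suc k
    c = n C suc (suc k)
    arith : ∀ k a b c → suc (suc k) * (b + c) + suc k * (a + b) ≡
      (suc (suc k) * c + suc k * b) + (suc k * b + k * a) + (a + b)
    arith = solve-∀
    arith′ : ∀ n a b → n * b + n * a + (a + b) ≡ suc n * (a + b)
    arith′ = solve-∀

  -- By `ballot` the number of paths is C(2i,i) - C(2i,i-1), and `absorption` gives (i+1) C(2i,i-1)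
  -- = i C(2i,i).
  paths-catalan : ∀ i → suc i * paths (i + i) 0 ≡ (i + i) C i
  paths-catalan zero    = refl
  paths-catalan (suc k) = +-cancelʳ-≡ (suc k * c) (suc i * p) c (begin
    suc i * p + suc k * c ≡⟨ cong (suc i * p +_) (sym lemma) ⟩
    suc i * p + suc i * b ≡⟨ *-distribˡ-+ (suc i) p b ⟨
    suc i * (p + b) ≡⟨ cong (suc i *_) (ballot (i + i) i 0 refl) ⟩
    suc i * c ∎)
    where
    open ≡-Reasoning
    i = suc k
    p = paths (i + i) 0
    b = (i + i) C k
    c = (i + i) C i
    arith : ∀ k b → (suc k + suc k) * b ≡ suc (suc k) * b + k * b
    arith = solve-∀
    lemma : suc i * b ≡ suc k * c
    lemma = +-cancelʳ-≡ (k * b) (suc i * b) (suc k * c) (sym (trans (absorption (i + i) k) (arith k b)))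

  central-ratio : ∀ i → suc i * ((suc i + suc i) C suc i) ≡ 2 * (suc (i + i) * ((i + i) C i))
  central-ratio i = begin
    suc i * ((suc i + suc i) C suc i) ≡⟨ cong (λ m → suc i * (m C suc i)) (cong suc (+-suc i i)) ⟩
    suc i * (suc n C suc i) ≡⟨ cong (suc i *_) (nCk+nC[k+1]≡[n+1]C[k+1] n i) ⟨
    suc i * (n C i + n C suc i) ≡⟨ cong (λ t → suc i * (t + n C suc i)) (sym (middle-symmetric i)) ⟩
    suc i * (n C suc i + n C suc i) ≡⟨ arith₁ i (n C suc i) ⟩
    2 * (suc i * (n C suc i)) ≡⟨ cong (λ t → 2 * (suc i * t)) (nCk+nC[k+1]≡[n+1]C[k+1] (i + i) i) ⟨
    2 * (suc i * (a + b)) ≡⟨ cong (2 *_) absorb ⟩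
    2 * (suc (i + i) * a) ∎
    where
    open ≡-Reasoning
    n = suc (i + i)
    a = (i + i) C i
    b = (i + i) C suc i
    arith₁ : ∀ i c → suc i * (c + c) ≡ 2 * (suc i * c)
    arith₁ = solve-∀
    arith₂ : ∀ i a b → suc i * (a + b) ≡ a + (suc i * b + i * a)
    arith₂ = solve-∀
    absorb : suc i * (a + b) ≡ suc (i + i) * a
    absorb = trans (arith₂ i a b) (cong (a +_) (absorption (i + i) i))

  -- From i to i+1 the central binomial grows by the factor 2(2i+1)/(i+1), so (2i+1) C(2i,i) grows
  -- by 2(2i+3)/(i+1) times (2i+1)/(2i+1), which is at least 4.
  4^≤central : ∀ i → 4 ^ i ≤ suc (i + i) * ((i + i) C i)
  4^≤central zero    = ≤-refl
  4^≤central (suc i) = begin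
    4 * 4 ^ i ≤⟨ *-monoʳ-≤ 4 (4^≤central i) ⟩
    4 * (suc (i + i) * ((i + i) C i)) ≡⟨ arith (suc (i + i) * ((i + i) C i)) ⟩
    2 * (2 * (suc (i + i) * ((i + i) C i))) ≡⟨ cong (2 *_) (central-ratio i) ⟨
    2 * (suc i * ((suc i + suc i) C suc i)) ≡⟨ *-assoc 2 (suc i) _ ⟨
    2 * suc i * ((suc i + suc i) C suc i) ≤⟨ *-monoˡ-≤ ((suc i + suc i) C suc i) (≤-trans (≤-reflexive (arith₂ i)) (n≤1+n _)) ⟩
    suc (suc i + suc i) * ((suc i + suc i) C suc i) ∎
    where
    open ≤-Reasoning
    arith : ∀ x → 4 * x ≡ 2 * (2 * x)
    arith = solve-∀
    arith₂ : ∀ i → 2 * suc i ≡ suc i + suc i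
    arith₂ = solve-∀

  -- The polynomial loss: one factor from the central binomial, the other from the denominator of
  -- the Catalan number.
  bound : ℕ → ℕ
  bound n = suc (n + n) * suc n

  4^≤paths : ∀ i → 4 ^ i ≤ bound i * paths (i + i) 0
  4^≤paths i = ≤-trans (4^≤central i) (≤-reflexive
    (trans (cong (suc (i + i) *_) (sym (paths-catalan i))) (sym (*-assoc (suc (i + i)) (suc i) _))))

  length-pointsOf : ∀ X z bs → length (pointsOf X z bs) ≡ count (agree X) bs
  length-pointsOf X z []       = refl
  length-pointsOf X z (b ∷ bs) with agree X b
  ... | true  = cong suc (length-pointsOf X (suc z) bs)
  ... | false = length-pointsOf X (suc z) bs

  count-++ : ∀ {A : Set} (p : A → Bool) xs ys → count p (xs ++ ys) ≡ count p xs + count p ys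
  count-++ p []       ys = refl
  count-++ p (x ∷ xs) ys = trans (cong (ind (p x) +_) (count-++ p xs ys)) (sym (+-assoc (ind (p x)) _ _))

  count-true-false : ∀ bs → count (agree true) bs + count (agree false) bs ≡ length bs
  count-true-false []           = refl
  count-true-false (true ∷ bs)  = cong suc (count-true-false bs)
  count-true-false (false ∷ bs) = trans (+-suc _ _) (cong suc (count-true-false bs))

  countTrue≡count : ∀ bs → countTrue bs ≡ count (agree true) bs
  countTrue≡count []           = refl
  countTrue≡count (true ∷ bs)  = cong suc (countTrue≡count bs)
  countTrue≡count (false ∷ bs) = countTrue≡count bs

  double-or-odd : ∀ k → (oddᵇ k ≡ false × ∃[ i ] k ≡ i + i) ⊎ (oddᵇ k ≡ true × ∃[ i ] suc k ≡ i + i)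
  double-or-odd zero    = inj₁ (refl , 0 , refl)
  double-or-odd (suc k) with double-or-odd k
  ... | inj₁ (o , i , refl) rewrite o = inj₂ (refl , suc i , cong suc (sym (+-suc i i)))
  ... | inj₂ (o , i , eq)   rewrite o = inj₁ (refl , i , eq)

  even-total : ∀ k → ∃[ i ] k + (ind (oddᵇ k) + 0) ≡ i + i
  even-total k with double-or-odd k
  ... | inj₁ (o , i , eq) rewrite o = i , trans (+-identityʳ k) eq
  ... | inj₂ (o , i , eq) rewrite o = i , trans (+-comm k 1) eq

  red-even : ∀ c → ∃[ i ] count (agree true) (fullColouring c) ≡ i + i
  red-even c with even-total (countTrue c)
  ... | i , eq = i , trans (count-++ (agree true) c _) (trans (cong (_+ (ind (oddᵇ (countTrue c)) + 0)) (sym (countTrue≡count c))) eq)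

  -- The parity bit makes the number of red points even; the total is even, so the number of blue
  -- points is even as well.
  colour-halves : ∀ n {c} → c ∈ allColourings (2 * suc n ∸ 1) →
    ∃₂ λ i j → length (redPoints (suc n) c) ≡ i + i × length (bluePoints (suc n) c) ≡ j + j × i + j ≡ suc n
  colour-halves n {c} c∈ with red-even c
  ... | i , ri = i , suc n ∸ i , trans (trans (cong length (redPoints≡ (suc n) c len)) (length-pointsOf true 1 bs)) ri
                   , trans (trans (cong length (bluePoints≡ (suc n) c len)) (length-pointsOf false 1 bs)) blue
                   , m+[n∸m]≡n i≤n
    where
    bs = fullColouring c
    len = length-fullColouring n c∈
    total : (i + i) + count (agree false) bs ≡ suc n + suc n
    total = trans (cong (_+ count (agree false) bs) (sym ri)) (trans (count-true-false bs) (trans len (cong (suc n +_) (+-identityʳ (suc n)))))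
    i≤n : i ≤ suc n
    i≤n = ≮⇒≥ λ n<i → <-irrefl refl (<-≤-trans (+-mono-< n<i n<i) (≤-trans (m≤m+n (i + i) _) (≤-reflexive total)))
    j = suc n ∸ i
    blue : count (agree false) bs ≡ j + j
    blue = +-cancelˡ-≡ (i + i) _ _ (trans total (trans (cong₂ _+_ e e) (arith i j)))
      where
      e : suc n ≡ i + j
      e = sym (m+[n∸m]≡n i≤n)
      arith : ∀ i j → (i + j) + (i + j) ≡ (i + i) + (j + j)
      arith = solve-∀

  bound-mono : ∀ {i n} → i ≤ n → bound i ≤ bound n
  bound-mono i≤n = *-mono-≤ (s≤s (+-mono-≤ i≤n i≤n)) (s≤s i≤n)

  4^≤matchings : ∀ i S → Increasing S → length S ≡ i + i → 4 ^ i ≤ bound i * length (catalanMatchings S)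
  4^≤matchings i S inc eq = ≤-trans (4^≤paths i)
    (*-monoʳ-≤ (bound i) (subst (λ k → paths k 0 ≤ length (catalanMatchings S)) eq (paths≤catalanMatchings S inc)))

  matchings-lower-bound : ∀ n {c} → c ∈ allColourings (2 * suc n ∸ 1) →
    4 ^ suc n ≤ (bound (suc n) * bound (suc n)) *
      (length (catalanMatchings (redPoints (suc n) c)) * length (catalanMatchings (bluePoints (suc n) c)))
  matchings-lower-bound n {c} c∈ with colour-halves n c∈
  ... | i , j , ri , bj , ij = begin
    4 ^ suc n ≡⟨ cong (4 ^_) ij ⟨
    4 ^ (i + j) ≡⟨ ^-distribˡ-+-* 4 i j ⟩
    4 ^ i * 4 ^ j ≤⟨ *-mono-≤
      (≤-trans (4^≤matchings i _ (subst Increasing (sym (redPoints≡ (suc n) c len)) (pointsOf-increasing true 1 (fullColouring c))) ri)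
        (*-monoˡ-≤ R (bound-mono (≤-trans (m≤m+n i j) (≤-reflexive ij)))))
      (≤-trans (4^≤matchings j _ (subst Increasing (sym (bluePoints≡ (suc n) c len)) (pointsOf-increasing false 1 (fullColouring c))) bj)
        (*-monoˡ-≤ B (bound-mono (≤-trans (m≤n+m j i) (≤-reflexive ij))))) ⟩
    (bound (suc n) * R) * (bound (suc n) * B) ≡⟨ arith (bound (suc n)) R B ⟩
    (bound (suc n) * bound (suc n)) * (R * B) ∎
    where
    open ≤-Reasoning
    len = length-fullColouring n c∈
    R = length (catalanMatchings (redPoints (suc n) c))
    B = length (catalanMatchings (bluePoints (suc n) c))
    arith : ∀ b r s → (b * r) * (b * s) ≡ (b * b) * (r * s)
    arith = solve-∀

-- Rational arithmetic, expectations of independent samples, and tail bounds.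

module Expectations where

  open import Data.Nat as ℕ using (ℕ; zero; suc; z≤n)
  import Data.Nat.Properties as ℕ
  import Data.Integer as ℤ
  import Data.Integer.Properties as ℤ
  open import Data.Rational
  open import Data.Rational.Properties
  import Data.Rational.Unnormalised as ℚᵘ
  import Data.Rational.Unnormalised.Properties as ℚᵘ
  open import Data.Maybe using (Maybe; just; nothing)
  open import Data.Vec using (Vec; []; _∷_)
  open import Tactic.RingSolver.Core.AlmostCommutativeRing using (AlmostCommutativeRing; fromCommutativeRing)
  open import Tactic.RingSolver using (solve-∀)

  ℚ-ring : AlmostCommutativeRing _ _
  ℚ-ring = fromCommutativeRing +-*-commutativeRing isZero
    where
    isZero : ∀ x → Maybe (0ℚ ≡ x)
    isZero x with 0ℚ ≟ x
    ... | yes p = just p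
    ... | no _  = nothing

  frac : ℕ → ℕ → ℚᵘ.ℚᵘ
  frac a d = ℚᵘ.mkℚᵘ (ℤ.+ a) d

  toℚᵘ-toℚ : ∀ k → toℚᵘ (toℚ k) ℚᵘ.≃ frac k 0
  toℚᵘ-toℚ k = toℚᵘ-fromℚᵘ (frac k 0)

  toℚ-+ : ∀ a b → toℚ (a ℕ.+ b) ≡ toℚ a + toℚ b
  toℚ-+ a b = toℚᵘ-injective (ℚᵘ.≃-trans (toℚᵘ-toℚ (a ℕ.+ b)) (ℚᵘ.≃-sym
    (ℚᵘ.≃-trans (toℚᵘ-homo-+ (toℚ a) (toℚ b)) (ℚᵘ.≃-trans (ℚᵘ.+-cong (toℚᵘ-toℚ a) (toℚᵘ-toℚ b))
      (ℚᵘ.*≡* (cong (ℤ._* ℤ.+ 1) (trans (cong₂ ℤ._+_ (ℤ.*-identityʳ (ℤ.+ a)) (ℤ.*-identityʳ (ℤ.+ b))) refl)))))))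

  toℚ-* : ∀ a b → toℚ (a ℕ.* b) ≡ toℚ a * toℚ b
  toℚ-* a b = toℚᵘ-injective (ℚᵘ.≃-trans (toℚᵘ-toℚ (a ℕ.* b)) (ℚᵘ.≃-sym
    (ℚᵘ.≃-trans (toℚᵘ-homo-* (toℚ a) (toℚ b)) (ℚᵘ.≃-trans (ℚᵘ.*-cong (toℚᵘ-toℚ a) (toℚᵘ-toℚ b))
      (ℚᵘ.*≡* (cong (ℤ._* ℤ.+ 1) (sym (ℤ.pos-* a b))))))))

  toℚ-mono-≤ : ∀ {a b} → a ℕ.≤ b → toℚ a ≤ toℚ b
  toℚ-mono-≤ {a} {b} a≤b = toℚᵘ-cancel-≤ (ℚᵘ.≤-trans (ℚᵘ.≤-reflexive (toℚᵘ-toℚ a))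
    (ℚᵘ.≤-trans (ℚᵘ.*≤* (ℤ.*-monoʳ-≤-nonNeg (ℤ.+ 1) (ℤ.+≤+ a≤b))) (ℚᵘ.≤-reflexive (ℚᵘ.≃-sym (toℚᵘ-toℚ b)))))

  toℚ-inv : ∀ k → .{{_ : ℕ.NonZero k}} → toℚ k * inv k ≡ 1ℚ
  toℚ-inv (suc k) = toℚᵘ-injective (ℚᵘ.≃-trans (toℚᵘ-homo-* (toℚ (suc k)) (inv (suc k)))
    (ℚᵘ.≃-trans (ℚᵘ.*-cong (toℚᵘ-toℚ (suc k)) (toℚᵘ-fromℚᵘ (frac 1 k)))
      (ℚᵘ.*≡* (trans (ℤ.*-identityʳ _) (trans (ℤ.*-identityʳ _) (sym (trans (ℤ.*-identityˡ _) (cong (λ t → ℤ.+ suc t) (ℕ.+-identityʳ k)))))))))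

  -- toℚ and inv, made abstract so that the type checker never unfolds the normalisation of fractions
  abstract
    nat : ℕ → ℚ
    nat = toℚ

    nat≡toℚ : ∀ k → nat k ≡ toℚ k
    nat≡toℚ k = refl

    recip : ℕ → ℚ
    recip = inv

    recip≡inv : ∀ k → recip k ≡ inv k
    recip≡inv k = refl

    nat-+ : ∀ a b → nat (a ℕ.+ b) ≡ nat a + nat b
    nat-+ = toℚ-+

    nat-* : ∀ a b → nat (a ℕ.* b) ≡ nat a * nat b
    nat-* = toℚ-*

    nat-mono-≤ : ∀ {a b} → a ℕ.≤ b → nat a ≤ nat b
    nat-mono-≤ = toℚ-mono-≤

    nat-recip : ∀ k → .{{_ : ℕ.NonZero k}} → nat k * recip k ≡ 1ℚ
    nat-recip = toℚ-inv

    nat-0 : nat 0 ≡ 0ℚ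
    nat-0 = refl

    nat-1 : nat 1 ≡ 1ℚ
    nat-1 = refl

  nat-≥0 : ∀ a → 0ℚ ≤ nat a
  nat-≥0 a = subst (_≤ nat a) nat-0 (nat-mono-≤ {0} {a} z≤n)

  nat-suc : ∀ a → nat (suc a) ≡ 1ℚ + nat a
  nat-suc a = trans (nat-+ 1 a) (cong (_+ nat a) nat-1)

  nat-suc-* : ∀ k c → c + nat k * c ≡ nat (suc k) * c
  nat-suc-* k c = trans (arith (nat k) c) (cong (_* c) (sym (nat-suc k)))
    where
    arith : ∀ k c → c + k * c ≡ (1ℚ + k) * c
    arith = solve-∀ ℚ-ring

  nat-2 : nat 2 ≡ 1ℚ + 1ℚ
  nat-2 = trans (nat-suc 1) (cong (1ℚ +_) nat-1)

  nat-mono-< : ∀ {a b} → a ℕ.< b → nat a < nat b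
  nat-mono-< {a} {b} a<b = <-≤-trans (subst (nat a <_) (trans (+-comm (nat a) 1ℚ) (sym (nat-suc a)))
    (subst (_< nat a + 1ℚ) (+-identityʳ (nat a)) (+-monoʳ-< (nat a) (positive⁻¹ 1ℚ)))) (nat-mono-≤ a<b)

  nat->0 : ∀ {a} → 0 ℕ.< a → 0ℚ < nat a
  nat->0 {a} 0<a = subst (_< nat a) nat-0 (nat-mono-< 0<a)

  *-monoˡ : ∀ {r p q} → 0ℚ ≤ r → p ≤ q → r * p ≤ r * q
  *-monoˡ {r} 0≤r p≤q = *-monoˡ-≤-nonNeg r {{nonNegative 0≤r}} p≤q

  *-monoʳ : ∀ {r p q} → 0ℚ ≤ r → p ≤ q → p * r ≤ q * r
  *-monoʳ {r} 0≤r p≤q = *-monoʳ-≤-nonNeg r {{nonNegative 0≤r}} p≤q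

  *-≥0 : ∀ {p q} → 0ℚ ≤ p → 0ℚ ≤ q → 0ℚ ≤ p * q
  *-≥0 {p} {q} 0≤p 0≤q = subst (_≤ p * q) (*-zeroʳ p) (*-monoˡ 0≤p 0≤q)

  +-≥0 : ∀ {p q} → 0ℚ ≤ p → 0ℚ ≤ q → 0ℚ ≤ p + q
  +-≥0 {p} {q} 0≤p 0≤q = +-mono-≤ 0≤p 0≤q

  *-cancel : ∀ {r p q} → 0ℚ < r → r * p ≤ r * q → p ≤ q
  *-cancel {r} 0<r le = *-cancelˡ-≤-pos r {{positive 0<r}} le

  ≤-by : ∀ {p q} d → 0ℚ ≤ d → p + d ≡ q → p ≤ q
  ≤-by {p} d 0≤d eq = subst₂ _≤_ (+-identityʳ p) eq (+-monoʳ-≤ p 0≤d)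

  diff-≥0 : ∀ {p q} → p ≤ q → 0ℚ ≤ q - p
  diff-≥0 {p} {q} p≤q = subst (_≤ q - p) (+-inverseʳ p) (+-monoˡ-≤ (- p) p≤q)

  ≤-from-diff : ∀ {p q} → 0ℚ ≤ q - p → p ≤ q
  ≤-from-diff {p} {q} d = ≤-by (q - p) d (arith p q)
    where
    arith : ∀ p q → p + (q - p) ≡ q
    arith = solve-∀ ℚ-ring

  square-≥0 : ∀ p → 0ℚ ≤ p * p
  square-≥0 p with ≤-total 0ℚ p
  ... | inj₁ 0≤p = *-≥0 0≤p 0≤p
  ... | inj₂ p≤0 = subst (0ℚ ≤_) (arith p) (*-≥0 0≤-p 0≤-p)
    where
    0≤-p : 0ℚ ≤ - p
    0≤-p = neg-antimono-≤ p≤0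
    arith : ∀ p → - p * - p ≡ p * p
    arith = solve-∀ ℚ-ring

  square-bound : ∀ {d b} → - b ≤ d → d ≤ b → d * d ≤ b * b
  square-bound {d} {b} l u = ≤-by ((b - d) * (d - (- b))) (*-≥0 (diff-≥0 u) (diff-≥0 l)) (arith d b)
    where
    arith : ∀ d b → d * d + (b - d) * (d - (- b)) ≡ b * b
    arith = solve-∀ ℚ-ring

  -- A law is represented by its expectation alone, a positive normalised linear functional; sample
  -- spaces need not be enumerated.
  record Expectation (A : Set) : Set₁ where
    field
      E     : (A → ℚ) → ℚ
      mono  : ∀ {f g} → (∀ a → f a ≤ g a) → E f ≤ E g
      add   : ∀ f g → E (λ a → f a + g a) ≡ E f + E g
      scale : ∀ k f → E (λ a → k * f a) ≡ k * E f
      one   : E (λ _ → 1ℚ) ≡ 1ℚ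

    E-cong : ∀ {f g} → (∀ a → f a ≡ g a) → E f ≡ E g
    E-cong h = ≤-antisym (mono (≤-reflexive ∘ h)) (mono (≤-reflexive ∘ sym ∘ h))

    const : ∀ k → E (λ _ → k) ≡ k
    const k = trans (E-cong (λ _ → sym (*-identityʳ k))) (trans (scale k (λ _ → 1ℚ)) (trans (cong (k *_) one) (*-identityʳ k)))

    E-≥0 : ∀ {f} → (∀ a → 0ℚ ≤ f a) → 0ℚ ≤ E f
    E-≥0 {f} h = subst (_≤ E f) (const 0ℚ) (mono h)

  open Expectation

  -- The law of `k` independent samples as an iterated expectation. Independence is thereby built
  -- in: a factor that depends on the first sample only is a constant for the inner expectation.
  power : ∀ {A} → Expectation A → ∀ k → Expectation (Vec A k)
  power X zero = record
    { E = λ F → F [] ; mono = λ h → h [] ; add = λ _ _ → refl ; scale = λ _ _ → refl ; one = refl }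
  power X (suc k) = record
    { E     = λ F → E X (λ a → E Y (λ v → F (a ∷ v)))
    ; mono  = λ h → mono X (λ a → mono Y (λ v → h (a ∷ v)))
    ; add   = λ f g → trans (E-cong X (λ a → add Y _ _)) (add X _ _)
    ; scale = λ c f → trans (E-cong X (λ a → scale Y c _)) (scale X c _)
    ; one   = trans (E-cong X (λ a → one Y)) (one X)
    }
    where Y = power X k

  total : ∀ {A : Set} {k} → (A → ℚ) → Vec A k → ℚ
  total f []      = 0ℚ
  total f (a ∷ v) = f a + total f v

  module _ {A : Set} (X : Expectation A) where

    E-total : ∀ k f → E (power X k) (total f) ≡ nat k * E X f
    E-total zero    f = sym (trans (cong (_* E X f) nat-0) (*-zeroˡ (E X f)))
    E-total (suc k) f = begin
      E X (λ a → E Y (λ v → f a + total f v)) ≡⟨ E-cong X (λ a → trans (add Y (λ _ → f a) (total f)) (cong₂ _+_ (const Y (f a)) (E-total k f))) ⟩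
      E X (λ a → f a + nat k * E X f) ≡⟨ trans (add X f (λ _ → nat k * E X f)) (cong (E X f +_) (const X (nat k * E X f))) ⟩
      E X f + nat k * E X f ≡⟨ nat-suc-* k (E X f) ⟩
      nat (suc k) * E X f ∎
      where
      open ≡-Reasoning
      Y = power X k

    -- The cross term of the square vanishes because the remaining samples are centred, so only the
    -- `k` squares contribute.
    second-moment : ∀ k {b} (d : A → ℚ) → E X d ≡ 0ℚ → (∀ a → d a * d a ≤ b) →
      E (power X k) (λ v → total d v * total d v) ≤ nat k * b
    second-moment zero    {b} d centred bounded = ≤-reflexive (sym (trans (cong (_* b) nat-0) (*-zeroˡ b)))
    second-moment (suc k) {b} d centred bounded = begin
      E X (λ a → E Y (λ v → (d a + total d v) * (d a + total d v))) ≡⟨ E-cong X inner ⟩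
      E X (λ a → d a * d a + S) ≤⟨ mono X (λ a → +-mono-≤ (bounded a) (second-moment k d centred bounded)) ⟩
      E X (λ a → b + nat k * b) ≡⟨ const X (b + nat k * b) ⟩
      b + nat k * b ≡⟨ nat-suc-* k b ⟩
      nat (suc k) * b ∎
      where
      open ≤-Reasoning
      Y = power X k
      S = E Y (λ v → total d v * total d v)
      expand : ∀ x y → (x + y) * (x + y) ≡ x * x + ((x + x) * y + y * y)
      expand = solve-∀ ℚ-ring
      mean-zero : E Y (total d) ≡ 0ℚ
      mean-zero = trans (E-total k d) (trans (cong (nat k *_) centred) (*-zeroʳ (nat k)))
      inner : ∀ a → E Y (λ v → (d a + total d v) * (d a + total d v)) ≡ d a * d a + S
      inner a = trans (E-cong Y (λ v → expand (d a) (total d v)))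
        (trans (add Y (λ _ → d a * d a) (λ v → (d a + d a) * total d v + total d v * total d v)) (cong₂ _+_ (const Y (d a * d a))
          (trans (add Y (λ v → (d a + d a) * total d v) (λ v → total d v * total d v)) (trans (cong (_+ S) (trans (scale Y (d a + d a) (total d)) (trans (cong ((d a + d a) *_) mean-zero) (*-zeroʳ (d a + d a))))) (+-identityˡ S)))))

  indℚ : Bool → ℚ
  indℚ false = 0ℚ
  indℚ true  = 1ℚ

  indℚ-≥0 : ∀ b → 0ℚ ≤ indℚ b
  indℚ-≥0 false = ≤-refl
  indℚ-≥0 true  = nonNegative⁻¹ 1ℚ

  indℚ-markov : ∀ {x t} b → 0ℚ ≤ x → (T b → t ≤ x) → t * indℚ b ≤ x
  indℚ-markov {x} {t} false 0≤x h = subst (_≤ x) (sym (*-zeroʳ t)) 0≤x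
  indℚ-markov {x} {t} true  0≤x h = subst (_≤ x) (sym (*-identityʳ t)) (h _)

  countV : ∀ {A : Set} {k} → (A → Bool) → Vec A k → ℕ
  countV p []      = 0
  countV p (a ∷ v) with p a
  ... | true  = suc (countV p v)
  ... | false = countV p v

  module _ {A : Set} (X : Expectation A) (bad : A → Bool) (s : ℕ)
           (rare : nat (4 ℕ.^ s) * E X (indℚ ∘ bad) ≤ 1ℚ) where

    private
      weigh : ∀ {k} → Vec A k → ℚ
      weigh v = nat (4 ℕ.^ (s ℕ.* countV bad v))

      factor : Bool → ℚ
      factor b = 1ℚ + nat (4 ℕ.^ s) * indℚ b

      -- One sample multiplies the weight by 1 or by 4^s, which is at most 1 + 4^s times the
      -- indicator of `bad`. Under `rare` this bound has mean at most 2, so `k` independent samples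
      -- give at most 2^k.
      weigh-cons : ∀ {k} a (v : Vec A k) → weigh (a ∷ v) ≤ factor (bad a) * weigh v
      weigh-cons a v with bad a
      ... | true  = ≤-by (weigh v) (nat-≥0 _) (begin
          nat (4 ℕ.^ (s ℕ.* suc (countV bad v))) + weigh v ≡⟨ cong (λ e → nat (4 ℕ.^ e) + weigh v) (ℕ.*-suc s (countV bad v)) ⟩
          nat (4 ℕ.^ (s ℕ.+ s ℕ.* countV bad v)) + weigh v ≡⟨ cong (λ e → nat e + weigh v) (ℕ.^-distribˡ-+-* 4 s (s ℕ.* countV bad v)) ⟩
          nat (4 ℕ.^ s ℕ.* 4 ℕ.^ (s ℕ.* countV bad v)) + weigh v ≡⟨ cong (_+ weigh v) (nat-* (4 ℕ.^ s) (4 ℕ.^ (s ℕ.* countV bad v))) ⟩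
          nat (4 ℕ.^ s) * weigh v + weigh v ≡⟨ arith (nat (4 ℕ.^ s)) (weigh v) ⟩
          (1ℚ + nat (4 ℕ.^ s) * 1ℚ) * weigh v ∎)
        where
        open ≡-Reasoning
        arith : ∀ b w → b * w + w ≡ (1ℚ + b * 1ℚ) * w
        arith = solve-∀ ℚ-ring
      ... | false = ≤-reflexive (arith (nat (4 ℕ.^ s)) (weigh v))
        where
        arith : ∀ b w → w ≡ (1ℚ + b * 0ℚ) * w
        arith = solve-∀ ℚ-ring

      factor-mean : E X (factor ∘ bad) ≤ nat 2
      factor-mean = begin
        E X (λ a → 1ℚ + nat (4 ℕ.^ s) * indℚ (bad a)) ≡⟨ trans (add X (λ _ → 1ℚ) (λ a → nat (4 ℕ.^ s) * indℚ (bad a))) (cong₂ _+_ (one X) (scale X (nat (4 ℕ.^ s)) (indℚ ∘ bad))) ⟩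
        1ℚ + nat (4 ℕ.^ s) * E X (indℚ ∘ bad) ≤⟨ +-monoʳ-≤ 1ℚ rare ⟩
        1ℚ + 1ℚ ≡⟨ nat-2 ⟨
        nat 2 ∎
        where open ≤-Reasoning

      weigh-mean : ∀ k → E (power X k) weigh ≤ nat (2 ℕ.^ k)
      weigh-mean zero    = ≤-reflexive (cong (λ e → nat (4 ℕ.^ e)) (ℕ.*-zeroʳ s))
      weigh-mean (suc k) = begin
        E X (λ a → E Y (λ v → weigh (a ∷ v))) ≤⟨ mono X (λ a → mono Y (weigh-cons a)) ⟩
        E X (λ a → E Y (λ v → factor (bad a) * weigh v)) ≡⟨ E-cong X (λ a → scale Y (factor (bad a)) weigh) ⟩
        E X (λ a → factor (bad a) * E Y weigh) ≡⟨ E-cong X (λ a → *-comm (factor (bad a)) (E Y weigh)) ⟩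
        E X (λ a → E Y weigh * factor (bad a)) ≡⟨ scale X (E Y weigh) (factor ∘ bad) ⟩
        E Y weigh * E X (factor ∘ bad) ≤⟨ *-monoˡ (E-≥0 Y (λ v → nat-≥0 _)) factor-mean ⟩
        E Y weigh * nat 2 ≤⟨ *-monoʳ (nat-≥0 2) (weigh-mean k) ⟩
        nat (2 ℕ.^ k) * nat 2 ≡⟨ *-comm (nat (2 ℕ.^ k)) (nat 2) ⟩
        nat 2 * nat (2 ℕ.^ k) ≡⟨ nat-* 2 (2 ℕ.^ k) ⟨
        nat (2 ℕ.^ suc k) ∎
        where
        open ≤-Reasoning
        Y = power X k

    many-bad : ∀ {k} → Vec A k → Bool
    many-bad {k} v = k ℕ.≤ᵇ s ℕ.* countV bad v

    -- E[4^(s·#bad)] ≤ 2^k, whereas 4^(s·#bad) ≥ 4^k on the event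
    many-bad-rare : ∀ k → nat (2 ℕ.^ k) * E (power X k) (indℚ ∘ many-bad) ≤ 1ℚ
    many-bad-rare k = *-cancel {nat (2 ℕ.^ k)} (nat->0 (ℕ.m^n>0 2 k)) (begin
      c * (c * P) ≡⟨ *-assoc c c P ⟨
      c * c * P ≡⟨ cong (_* P) (nat-* (2 ℕ.^ k) (2 ℕ.^ k)) ⟨
      nat (2 ℕ.^ k ℕ.* 2 ℕ.^ k) * P ≡⟨ cong (λ e → nat e * P) (sym (four k)) ⟩
      nat (4 ℕ.^ k) * P ≡⟨ scale Y (nat (4 ℕ.^ k)) (indℚ ∘ many-bad) ⟨
      E Y (λ v → nat (4 ℕ.^ k) * indℚ (many-bad v)) ≤⟨ mono Y (λ v → indℚ-markov (many-bad v) (nat-≥0 _)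
                                                        (λ t → nat-mono-≤ (ℕ.^-monoʳ-≤ 4 (ℕ.≤ᵇ⇒≤ k _ t)))) ⟩
      E Y weigh ≤⟨ weigh-mean k ⟩
      c ≡⟨ *-identityʳ c ⟨
      c * 1ℚ ∎)
      where
      open ≤-Reasoning
      Y = power X k
      c = nat (2 ℕ.^ k)
      P = E Y (indℚ ∘ many-bad)
      four : ∀ k → 4 ℕ.^ k ≡ 2 ℕ.^ k ℕ.* 2 ℕ.^ k
      four k = trans (ℕ.^-*-assoc 2 2 k) (trans (cong (λ e → 2 ℕ.^ (k ℕ.+ e)) (ℕ.+-identityʳ k)) (ℕ.^-distribˡ-+-* 2 k k))

-- The law of the scan, and γ as the probability of the verdict `iso`.

module Excursions where

  open Matchings using (ind)
  open Scanning
  open CatalanNumbers using (paths; paths-catalan; pascal; binomPred)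
  open Expectations
  open import Data.Nat as ℕ using (ℕ; zero; suc; z≤n; s≤s; _∸_)
  import Data.Nat.Properties as ℕ
  import Data.Nat.Tactic.RingSolver as ℕRing
  open import Data.Nat.Combinatorics using (_C_; k>n⇒nCk≡0)
  import Data.Integer as ℤ
  open import Data.Rational
  open import Data.Rational.Properties
  open import Data.Vec using (Vec; _∷_; toList)
  open import Tactic.RingSolver using (solve-∀)

  open Expectation

  ¼ : ℚ
  ¼ = ℤ.+ 1 / 4

  ¼-≥0 : 0ℚ ≤ ¼
  ¼-≥0 = nonNegative⁻¹ ¼

  letterE : Expectation Letter
  letterE = record
    { E     = avg
    ; mono  = λ h → *-monoˡ ¼-≥0 (+-mono-≤ (+-mono-≤ (+-mono-≤ (h _) (h _)) (h _)) (h _))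
    ; add   = λ f g → add′ (f (true , true)) (f (true , false)) (f (false , true)) (f (false , false))
                           (g (true , true)) (g (true , false)) (g (false , true)) (g (false , false))
    ; scale = λ k f → scale′ k (f (true , true)) (f (true , false)) (f (false , true)) (f (false , false))
    ; one   = refl
    }
    where
    avg : (Letter → ℚ) → ℚ
    avg f = ¼ * (f (true , true) + f (true , false) + f (false , true) + f (false , false))
    add′ : ∀ a b c d a′ b′ c′ d′ →
      ¼ * ((a + a′) + (b + b′) + (c + c′) + (d + d′)) ≡ ¼ * (a + b + c + d) + ¼ * (a′ + b′ + c′ + d′)
    add′ = solve-∀ ℚ-ring
    scale′ : ∀ k a b c d → ¼ * (k * a + k * b + k * c + k * d) ≡ k * (¼ * (a + b + c + d))
    scale′ = solve-∀ ℚ-ring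

  words : ∀ n → Expectation (Vec Letter n)
  words = power letterE

  𝔼 : ℕ → (List Letter → ℚ) → ℚ
  𝔼 n F = E (words n) (F ∘ toList)

  𝔼-++ : ∀ a b F → 𝔼 (a ℕ.+ b) F ≡ 𝔼 a (λ u → 𝔼 b (λ v → F (u ++ v)))
  𝔼-++ zero    b F = refl
  𝔼-++ (suc a) b F = E-cong letterE (λ l → 𝔼-++ a b (λ w → F (l ∷ w)))

  avg-of : ℚ → ℚ → ℚ → ℚ → ℚ
  avg-of a b c d = ¼ * (a + b + c + d)

  -- expectation of the verdict of a scan of d letters that is worth i if it is iso, u if it is unknown and 0 otherwise
  mutual
    scanProb : ℚ → ℚ → ℕ → ℕ → ℕ → ℚ
    scanProb i u zero    hx hy = u
    scanProb i u (suc d) hx hy =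
      avg-of (scanProb i u d (suc hx) hy) (downX i u d hx hy) (scanProb i u d hx (suc hy)) (downY i u d hx hy)

    downX : ℚ → ℚ → ℕ → ℕ → ℕ → ℚ
    downX i u d zero     zero     = i
    downX i u d zero     (suc hy) = 0ℚ
    downX i u d (suc hx) hy       = scanProb i u d hx hy

    downY : ℚ → ℚ → ℕ → ℕ → ℕ → ℚ
    downY i u d hx zero     = 0ℚ
    downY i u d hx (suc hy) = scanProb i u d hx hy

  isoProb unkProb : ℕ → ℕ → ℕ → ℚ
  isoProb = scanProb 1ℚ 0ℚ
  unkProb = scanProb 0ℚ 1ℚ

  avg-cong : ∀ {a b c d a′ b′ c′ d′} → a ≡ a′ → b ≡ b′ → c ≡ c′ → d ≡ d′ → avg-of a b c d ≡ avg-of a′ b′ c′ d′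
  avg-cong refl refl refl refl = refl

  avg-swap : ∀ a b c d → ¼ * (a + b + c + d) ≡ ¼ * (c + d + a + b)
  avg-swap = solve-∀ ℚ-ring

  avg-mono : ∀ {a b c d a′ b′ c′ d′} → a ≤ a′ → b ≤ b′ → c ≤ c′ → d ≤ d′ → avg-of a b c d ≤ avg-of a′ b′ c′ d′
  avg-mono p q r t = *-monoˡ ¼-≥0 (+-mono-≤ (+-mono-≤ (+-mono-≤ p q) r) t)

  module _ (i u : ℚ) where

    value : Status → ℚ
    value iso     = i
    value non     = 0ℚ
    value unknown = u

    mutual
      scan-value : ∀ d X hx hy → 𝔼 d (λ w → value (scan X hx hy w)) ≡ scanProb i u d hx hy
      scan-value zero    X     hx hy = refl
      scan-value (suc d) true  hx hy =
        avg-cong (scan-value d true (suc hx) hy) (downX-value d true hx hy) (scan-value d true hx (suc hy)) (downY-value d true hx hy)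
      -- When a blue arc is scanned, the red letters are those of the other colour; the four
      -- averaged terms are the same in another order.
      scan-value (suc d) false hx hy = trans
        (avg-cong (scan-value d false hx (suc hy)) (downY-value d false hx hy) (scan-value d false (suc hx) hy) (downX-value d false hx hy))
        (avg-swap (scanProb i u d hx (suc hy)) (downY i u d hx hy) (scanProb i u d (suc hx) hy) (downX i u d hx hy))

      downX-value : ∀ d X hx hy → 𝔼 d (λ w → value (step X true false hx hy w)) ≡ downX i u d hx hy
      downX-value d X zero     zero     = const (words d) i
      downX-value d X zero     (suc hy) = const (words d) 0ℚ
      downX-value d X (suc hx) hy       = scan-value d X hx hy

      downY-value : ∀ d X hx hy → 𝔼 d (λ w → value (step X false false hx hy w)) ≡ downY i u d hx hy
      downY-value d X hx zero     = const (words d) 0ℚ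
      downY-value d X hx (suc hy) = scan-value d X hx hy

  scan-iso : ∀ d X hx hy → 𝔼 d (λ w → indℚ (isIso (scan X hx hy w))) ≡ isoProb d hx hy
  scan-iso d X hx hy = trans (E-cong (words d) (λ v → same (scan X hx hy (toList v)))) (scan-value 1ℚ 0ℚ d X hx hy)
    where
    same : ∀ t → indℚ (isIso t) ≡ value 1ℚ 0ℚ t
    same iso     = refl
    same non     = refl
    same unknown = refl

  scan-unknown : ∀ d X hx hy → 𝔼 d (λ w → indℚ (isUnknown (scan X hx hy w))) ≡ unkProb d hx hy
  scan-unknown d X hx hy = trans (E-cong (words d) (λ v → same (scan X hx hy (toList v)))) (scan-value 0ℚ 1ℚ d X hx hy)
    where
    same : ∀ t → indℚ (isUnknown t) ≡ value 0ℚ 1ℚ t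
    same iso     = refl
    same non     = refl
    same unknown = refl

  mutual
    -- Walks of `d` unit steps in the quarter plane from `(hx , hy)` to the origin.
    quadrant : ℕ → ℕ → ℕ → ℕ
    quadrant zero    zero     zero     = 1
    quadrant zero    zero     (suc hy) = 0
    quadrant zero    (suc hx) hy       = 0
    quadrant (suc d) hx       hy       =
      quadrant d (suc hx) hy ℕ.+ quadDownX d hx hy ℕ.+ quadrant d hx (suc hy) ℕ.+ quadDownY d hx hy

    quadDownX : ℕ → ℕ → ℕ → ℕ
    quadDownX d zero     hy = 0
    quadDownX d (suc hx) hy = quadrant d hx hy

    quadDownY : ℕ → ℕ → ℕ → ℕ
    quadDownY d hx zero     = 0
    quadDownY d hx (suc hy) = quadrant d hx hy

  4⁻ : ℕ → ℚ
  4⁻ zero    = 1ℚ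
  4⁻ (suc d) = ¼ * 4⁻ d

  4⁻-≥0 : ∀ d → 0ℚ ≤ 4⁻ d
  4⁻-≥0 zero    = nonNegative⁻¹ 1ℚ
  4⁻-≥0 (suc d) = *-≥0 ¼-≥0 (4⁻-≥0 d)

  mutual
    -- The scan says `iso` exactly at letter d+1 if the first `d` letters form a quarter-plane walk
    -- to the origin and the next one is the closing letter of the scanned colour; each such word of
    -- d+1 letters has probability 4^(-(d+1)).
    isoProb-suc : ∀ d hx hy → isoProb (suc d) hx hy ≡ isoProb d hx hy + nat (quadrant d hx hy) * 4⁻ (suc d)
    isoProb-suc zero zero zero = sym (trans (cong (λ t → 0ℚ + t * 4⁻ 1) nat-1) refl)
    isoProb-suc zero zero (suc hy) = sym (trans (cong (λ t → 0ℚ + t * 4⁻ 1) nat-0) refl)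
    isoProb-suc zero (suc hx) zero = sym (trans (cong (λ t → 0ℚ + t * 4⁻ 1) nat-0) refl)
    isoProb-suc zero (suc hx) (suc hy) = sym (trans (cong (λ t → 0ℚ + t * 4⁻ 1) nat-0) refl)
    isoProb-suc (suc d) hx hy = begin
      avg-of (isoProb (suc d) (suc hx) hy) (downX 1ℚ 0ℚ (suc d) hx hy) (isoProb (suc d) hx (suc hy)) (downY 1ℚ 0ℚ (suc d) hx hy)
        ≡⟨ avg-cong (isoProb-suc d (suc hx) hy) (downX-suc d hx hy) (isoProb-suc d hx (suc hy)) (downY-suc d hx hy) ⟩
      avg-of (a + nat q₁ * r) (b + nat q₂ * r) (c + nat q₃ * r) (e + nat q₄ * r)
        ≡⟨ arith a b c e (nat q₁) (nat q₂) (nat q₃) (nat q₄) r ⟩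
      avg-of a b c e + (nat q₁ + nat q₂ + nat q₃ + nat q₄) * (¼ * r)
        ≡⟨ cong (λ t → avg-of a b c e + t * (¼ * r)) (sym sums) ⟩
      avg-of a b c e + nat (q₁ ℕ.+ q₂ ℕ.+ q₃ ℕ.+ q₄) * (¼ * r) ∎
      where
      open ≡-Reasoning
      a = isoProb d (suc hx) hy
      b = downX 1ℚ 0ℚ d hx hy
      c = isoProb d hx (suc hy)
      e = downY 1ℚ 0ℚ d hx hy
      q₁ = quadrant d (suc hx) hy
      q₂ = quadDownX d hx hy
      q₃ = quadrant d hx (suc hy)
      q₄ = quadDownY d hx hy
      r = 4⁻ (suc d)
      sums : nat (q₁ ℕ.+ q₂ ℕ.+ q₃ ℕ.+ q₄) ≡ nat q₁ + nat q₂ + nat q₃ + nat q₄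
      sums = trans (nat-+ (q₁ ℕ.+ q₂ ℕ.+ q₃) q₄) (cong (_+ nat q₄)
        (trans (nat-+ (q₁ ℕ.+ q₂) q₃) (cong (_+ nat q₃) (nat-+ q₁ q₂))))
      arith : ∀ a b c e x y z w r → ¼ * ((a + x * r) + (b + y * r) + (c + z * r) + (e + w * r)) ≡
        ¼ * (a + b + c + e) + (x + y + z + w) * (¼ * r)
      arith = solve-∀ ℚ-ring

    downX-suc : ∀ d hx hy → downX 1ℚ 0ℚ (suc d) hx hy ≡ downX 1ℚ 0ℚ d hx hy + nat (quadDownX d hx hy) * 4⁻ (suc d)
    downX-suc d zero     zero     = no-change 1ℚ d
    downX-suc d zero     (suc hy) = no-change 0ℚ d
    downX-suc d (suc hx) hy       = isoProb-suc d hx hy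

    downY-suc : ∀ d hx hy → downY 1ℚ 0ℚ (suc d) hx hy ≡ downY 1ℚ 0ℚ d hx hy + nat (quadDownY d hx hy) * 4⁻ (suc d)
    downY-suc d hx zero     = no-change 0ℚ d
    downY-suc d hx (suc hy) = isoProb-suc d hx hy

    no-change : ∀ x d → x ≡ x + nat 0 * 4⁻ (suc d)
    no-change x d = sym (trans (cong (λ t → x + t * 4⁻ (suc d)) nat-0) (trans (cong (x +_) (*-zeroˡ (4⁻ (suc d)))) (+-identityʳ x)))

  isoProb-mono-+ : ∀ d e hx hy → isoProb d hx hy ≤ isoProb (e ℕ.+ d) hx hy
  isoProb-mono-+ d zero    hx hy = ≤-refl
  isoProb-mono-+ d (suc e) hx hy = ≤-trans (isoProb-mono-+ d e hx hy)
    (≤-by (nat (quadrant (e ℕ.+ d) hx hy) * 4⁻ (suc (e ℕ.+ d))) (*-≥0 (nat-≥0 _) (4⁻-≥0 (suc (e ℕ.+ d))))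
      (sym (isoProb-suc (e ℕ.+ d) hx hy)))

  isoProb-mono : ∀ {d d′} → d ℕ.≤ d′ → ∀ hx hy → isoProb d hx hy ≤ isoProb d′ hx hy
  isoProb-mono {d} {d′} d≤d′ hx hy =
    subst (λ k → isoProb d hx hy ≤ isoProb k hx hy) (ℕ.m∸n+n≡m d≤d′) (isoProb-mono-+ d (d′ ∸ d) hx hy)

  -- exponential convolution, defined by the Leibniz rule
  conv : ℕ → (ℕ → ℕ) → (ℕ → ℕ) → ℕ
  conv zero    f g = f 0 ℕ.* g 0
  conv (suc k) f g = conv k (f ∘ suc) g ℕ.+ conv k f (g ∘ suc)

  conv-+ˡ : ∀ k f f′ g → conv k (λ j → f j ℕ.+ f′ j) g ≡ conv k f g ℕ.+ conv k f′ g
  conv-+ˡ zero    f f′ g = ℕ.*-distribʳ-+ (g 0) (f 0) (f′ 0)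
  conv-+ˡ (suc k) f f′ g = trans
    (cong₂ ℕ._+_ (conv-+ˡ k (f ∘ suc) (f′ ∘ suc) g) (conv-+ˡ k f f′ (g ∘ suc)))
    (swap (conv k (f ∘ suc) g) (conv k (f′ ∘ suc) g) (conv k f (g ∘ suc)) (conv k f′ (g ∘ suc)))
    where
    swap : ∀ a b c d → (a ℕ.+ b) ℕ.+ (c ℕ.+ d) ≡ (a ℕ.+ c) ℕ.+ (b ℕ.+ d)
    swap = ℕRing.solve-∀

  conv-+ʳ : ∀ k f g g′ → conv k f (λ j → g j ℕ.+ g′ j) ≡ conv k f g ℕ.+ conv k f g′
  conv-+ʳ zero    f g g′ = ℕ.*-distribˡ-+ (f 0) (g 0) (g′ 0)
  conv-+ʳ (suc k) f g g′ = trans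
    (cong₂ ℕ._+_ (conv-+ʳ k (f ∘ suc) g g′) (conv-+ʳ k f (g ∘ suc) (g′ ∘ suc)))
    (swap (conv k (f ∘ suc) g) (conv k (f ∘ suc) g′) (conv k f (g ∘ suc)) (conv k f (g′ ∘ suc)))
    where
    swap : ∀ a b c d → (a ℕ.+ b) ℕ.+ (c ℕ.+ d) ≡ (a ℕ.+ c) ℕ.+ (b ℕ.+ d)
    swap = ℕRing.solve-∀

  -- A walk in the quarter plane is a shuffle of two paths on the half-line, and the Leibniz rule of
  -- `conv` chooses at each step the coordinate that moves.
  quadrant-conv : ∀ k hx hy → quadrant k hx hy ≡ conv k (λ j → paths j hx) (λ j → paths j hy)
  quadrant-conv zero    zero     zero     = refl
  quadrant-conv zero    zero     (suc hy) = refl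
  quadrant-conv zero    (suc hx) hy       = refl
  quadrant-conv (suc k) hx hy = trans
    (ℕ.+-assoc (quadrant k (suc hx) hy ℕ.+ quadDownX k hx hy) (quadrant k hx (suc hy)) (quadDownY k hx hy))
    (cong₂ ℕ._+_ (left hx) (right hy))
    where
    left : ∀ hx → quadrant k (suc hx) hy ℕ.+ quadDownX k hx hy ≡ conv k (λ j → paths (suc j) hx) (λ j → paths j hy)
    left zero     = trans (ℕ.+-identityʳ _) (quadrant-conv k 1 hy)
    left (suc hx) = trans (cong₂ ℕ._+_ (quadrant-conv k (2 ℕ.+ hx) hy) (quadrant-conv k hx hy))
      (sym (conv-+ˡ k (λ j → paths j (2 ℕ.+ hx)) (λ j → paths j hx) (λ j → paths j hy)))
    right : ∀ hy → quadrant k hx (suc hy) ℕ.+ quadDownY k hx hy ≡ conv k (λ j → paths j hx) (λ j → paths (suc j) hy)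
    right zero     = trans (ℕ.+-identityʳ _) (quadrant-conv k hx 1)
    right (suc hy) = trans (cong₂ ℕ._+_ (quadrant-conv k hx (2 ℕ.+ hy)) (quadrant-conv k hx hy))
      (sym (conv-+ʳ k (λ j → paths j hx) (λ j → paths j (2 ℕ.+ hy)) (λ j → paths j hy)))

  Σ< : ℕ → (ℕ → ℕ) → ℕ
  Σ< zero    f = 0
  Σ< (suc n) f = f 0 ℕ.+ Σ< n (f ∘ suc)

  Σ<-cong : ∀ n {f g} → (∀ j → j ℕ.< n → f j ≡ g j) → Σ< n f ≡ Σ< n g
  Σ<-cong zero    h = refl
  Σ<-cong (suc n) h = cong₂ ℕ._+_ (h 0 (s≤s z≤n)) (Σ<-cong n (λ j j<n → h (suc j) (s≤s j<n)))

  Σ<-+ : ∀ n f g → Σ< n (λ j → f j ℕ.+ g j) ≡ Σ< n f ℕ.+ Σ< n g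
  Σ<-+ zero    f g = refl
  Σ<-+ (suc n) f g = trans (cong (f 0 ℕ.+ g 0 ℕ.+_) (Σ<-+ n (f ∘ suc) (g ∘ suc)))
    (swap (f 0) (g 0) (Σ< n (f ∘ suc)) (Σ< n (g ∘ suc)))
    where
    swap : ∀ a b c d → (a ℕ.+ b) ℕ.+ (c ℕ.+ d) ≡ (a ℕ.+ c) ℕ.+ (b ℕ.+ d)
    swap = ℕRing.solve-∀

  Σ<-last : ∀ n f → Σ< (suc n) f ≡ Σ< n f ℕ.+ f n
  Σ<-last zero    f = ℕ.+-comm (f 0) 0
  Σ<-last (suc n) f = trans (cong (f 0 ℕ.+_) (Σ<-last n (f ∘ suc))) (sym (ℕ.+-assoc (f 0) _ _))

  conv-sum : ∀ k f g → conv k f g ≡ Σ< (suc k) (λ j → (k C j) ℕ.* (f j ℕ.* g (k ∸ j)))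
  conv-sum zero    f g = sym (trans (ℕ.+-identityʳ _) (ℕ.*-identityˡ (f 0 ℕ.* g 0)))
  conv-sum (suc k) f g = begin
    conv k (f ∘ suc) g ℕ.+ conv k f (g ∘ suc)
      ≡⟨ cong₂ ℕ._+_ (conv-sum k (f ∘ suc) g) (conv-sum k f (g ∘ suc)) ⟩
    Σ< (suc k) (λ j → (k C j) ℕ.* (f (suc j) ℕ.* g (k ∸ j))) ℕ.+ Σ< (suc k) (λ j → (k C j) ℕ.* (f j ℕ.* g (suc (k ∸ j))))
      ≡⟨ cong (Σ< (suc (suc k)) shifted ℕ.+_) tailSum ⟩
    Σ< (suc (suc k)) shifted ℕ.+ Σ< (suc (suc k)) plain
      ≡⟨ Σ<-+ (suc (suc k)) shifted plain ⟨
    Σ< (suc (suc k)) (λ j → shifted j ℕ.+ plain j)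
      ≡⟨ Σ<-cong (suc (suc k)) (λ j _ → trans (sym (ℕ.*-distribʳ-+ (F j) (binomPred k j) (k C j))) (cong (ℕ._* F j) (sym (pascal k j)))) ⟩
    Σ< (suc (suc k)) (λ j → (suc k C j) ℕ.* F j) ∎
    where
    open ≡-Reasoning
    F shifted plain : ℕ → ℕ
    F j = f j ℕ.* g (suc k ∸ j)
    shifted j = binomPred k j ℕ.* F j
    plain j = (k C j) ℕ.* F j
    tailSum : Σ< (suc k) (λ j → (k C j) ℕ.* (f j ℕ.* g (suc (k ∸ j)))) ≡ Σ< (suc (suc k)) plain
    tailSum = sym (trans (Σ<-last (suc k) plain)
      (trans (cong (Σ< (suc k) plain ℕ.+_) (cong (ℕ._* F (suc k)) (k>n⇒nCk≡0 (ℕ.n<1+n k))))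
      (trans (ℕ.+-identityʳ _) (Σ<-cong (suc k) (λ j j<k → cong (λ t → (k C j) ℕ.* (f j ℕ.* g t)) (ℕ.+-∸-assoc 1 (ℕ.≤-pred j<k)))))))

  paths-parity : ∀ k h → oddᵇ (k ℕ.+ h) ≡ true → paths k h ≡ 0
  paths-parity zero    zero    ()
  paths-parity zero    (suc h) _ = refl
  paths-parity (suc k) zero    o = paths-parity k 1 (subst (λ t → oddᵇ t ≡ true) (trans (cong suc (ℕ.+-identityʳ k)) (ℕ.+-comm 1 k)) o)
  paths-parity (suc k) (suc h) o = cong₂ ℕ._+_
    (paths-parity k (2 ℕ.+ h) (subst (λ t → oddᵇ t ≡ true) (trans (cong suc (ℕ.+-suc k h)) (trans (sym (cong suc (ℕ.+-suc k h))) (sym (ℕ.+-suc k (suc h))))) o))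
    (paths-parity k h (trans (sym (not-involutive (oddᵇ (k ℕ.+ h)))) (subst (λ t → oddᵇ (suc t) ≡ true) (ℕ.+-suc k h) o)))

  odd-double : ∀ b → oddᵇ (suc (b ℕ.+ b)) ≡ true
  odd-double zero    = refl
  odd-double (suc b) rewrite ℕ.+-suc b b | odd-double b = refl

  Σ<-even : ∀ m F → (∀ b → F (suc (b ℕ.+ b)) ≡ 0) → Σ< (suc (m ℕ.+ m)) F ≡ Σ< (suc m) (λ b → F (b ℕ.+ b))
  Σ<-even zero    F h = refl
  Σ<-even (suc m) F h rewrite ℕ.+-suc m m = cong (F 0 ℕ.+_) (trans (cong (ℕ._+ Σ< (suc (m ℕ.+ m)) (F ∘ suc ∘ suc)) (h 0))
    (trans (Σ<-even m (F ∘ suc ∘ suc) (λ b → trans (cong F (cong (suc ∘ suc) (sym (ℕ.+-suc b b)))) (h (suc b))))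
      (Σ<-cong (suc m) (λ b _ → cong F (cong suc (sym (ℕ.+-suc b b)))))))

  double : ∀ m → 2 ℕ.* m ≡ m ℕ.+ m
  double m = cong (m ℕ.+_) (ℕ.+-identityʳ m)

  catalan≡paths : ∀ j → catalan j ≡ nat (paths (j ℕ.+ j) 0)
  catalan≡paths j = begin
    toℚ ((2 ℕ.* j) C j) * inv (suc j) ≡⟨ cong₂ _*_ (nat≡toℚ ((2 ℕ.* j) C j)) (recip≡inv (suc j)) ⟨
    nat ((2 ℕ.* j) C j) * recip (suc j) ≡⟨ cong (λ t → nat (t C j) * recip (suc j)) (double j) ⟩
    nat ((j ℕ.+ j) C j) * recip (suc j) ≡⟨ cong (λ t → nat t * recip (suc j)) (sym (paths-catalan j)) ⟩
    nat (suc j ℕ.* p) * recip (suc j) ≡⟨ cong (_* recip (suc j)) (nat-* (suc j) p) ⟩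
    nat (suc j) * nat p * recip (suc j) ≡⟨ arith (nat (suc j)) (nat p) (recip (suc j)) ⟩
    nat (suc j) * recip (suc j) * nat p ≡⟨ cong (_* nat p) (nat-recip (suc j)) ⟩
    1ℚ * nat p ≡⟨ *-identityˡ (nat p) ⟩
    nat p ∎
    where
    open ≡-Reasoning
    p = paths (j ℕ.+ j) 0
    arith : ∀ a b c → a * b * c ≡ a * c * b
    arith = solve-∀ ℚ-ring

  sumℚ-nat : ∀ n (h : ℕ → ℕ) F G → (∀ j → j ℕ.< n → F (h j) ≡ nat (G j)) → sumℚ (map F (applyUpTo h n)) ≡ nat (Σ< n G)
  sumℚ-nat zero    h F G eq = sym nat-0
  sumℚ-nat (suc n) h F G eq = trans (cong₂ _+_ (eq 0 (s≤s z≤n)) (sumℚ-nat n (h ∘ suc) F (G ∘ suc) (λ j j<n → eq (suc j) (s≤s j<n))))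
    (sym (nat-+ (G 0) (Σ< n (G ∘ suc))))

  -- The convolution is a binomial sum over the number `j` of steps of one coordinate. No path of
  -- odd length returns to 0, so only `j = b + b` survives, and there the path counts are Catalan
  -- numbers.
  innerSum≡quadrant : ∀ m → innerSum (suc m) ≡ nat (quadrant (m ℕ.+ m) 0 0)
  innerSum≡quadrant m = trans
    (sumℚ-nat (suc m) id (λ b → toℚ ((2 ℕ.* suc m ∸ 2) C (2 ℕ.* b)) * (catalan (m ∸ b) * catalan b)) (λ b → term (b ℕ.+ b)) (λ b b<m → same b (ℕ.≤-pred b<m)))
    (cong nat (sym (trans (quadrant-conv (m ℕ.+ m) 0 0) (trans (conv-sum (m ℕ.+ m) (λ j → paths j 0) (λ j → paths j 0))
      (Σ<-even m term (λ b → trans (cong (λ t → ((m ℕ.+ m) C suc (b ℕ.+ b)) ℕ.* (t ℕ.* paths (m ℕ.+ m ∸ suc (b ℕ.+ b)) 0))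
        (paths-parity (suc (b ℕ.+ b)) 0 (trans (cong oddᵇ (ℕ.+-identityʳ (suc (b ℕ.+ b)))) (odd-double b)))) (ℕ.*-zeroʳ ((m ℕ.+ m) C suc (b ℕ.+ b)))))))))
    where
    term : ℕ → ℕ
    term j = ((m ℕ.+ m) C j) ℕ.* (paths j 0 ℕ.* paths (m ℕ.+ m ∸ j) 0)
    index : 2 ℕ.* suc m ∸ 2 ≡ m ℕ.+ m
    index = trans (cong (_∸ 2) (double (suc m))) (cong (_∸ 1) (ℕ.+-suc m m))
    split : ∀ b → b ℕ.≤ m → m ℕ.+ m ∸ (b ℕ.+ b) ≡ (m ∸ b) ℕ.+ (m ∸ b)
    split b b≤m = trans (cong (_∸ (b ℕ.+ b)) (trans (cong₂ ℕ._+_ e e) (arith (m ∸ b) b))) (ℕ.m+n∸n≡m ((m ∸ b) ℕ.+ (m ∸ b)) (b ℕ.+ b))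
      where
      e : m ≡ (m ∸ b) ℕ.+ b
      e = sym (ℕ.m∸n+n≡m b≤m)
      arith : ∀ x b → (x ℕ.+ b) ℕ.+ (x ℕ.+ b) ≡ (x ℕ.+ x) ℕ.+ (b ℕ.+ b)
      arith = ℕRing.solve-∀
    same : ∀ b → b ℕ.≤ m → toℚ ((2 ℕ.* suc m ∸ 2) C (2 ℕ.* b)) * (catalan (m ∸ b) * catalan b) ≡ nat (term (b ℕ.+ b))
    same b b≤m = begin
      toℚ ((2 ℕ.* suc m ∸ 2) C (2 ℕ.* b)) * (catalan (m ∸ b) * catalan b)
        ≡⟨ cong₂ (λ x y → x * y) (trans (sym (nat≡toℚ ((2 ℕ.* suc m ∸ 2) C (2 ℕ.* b)))) (cong₂ (λ x y → nat (x C y)) index (double b)))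
             (cong₂ (λ x y → x * y) (trans (catalan≡paths (m ∸ b)) (cong (λ t → nat (paths t 0)) (sym (split b b≤m)))) (catalan≡paths b)) ⟩
      nat c * (nat q * nat p) ≡⟨ cong (nat c *_) (trans (*-comm (nat q) (nat p)) (sym (nat-* p q))) ⟩
      nat c * nat (p ℕ.* q) ≡⟨ nat-* c (p ℕ.* q) ⟨
      nat (c ℕ.* (p ℕ.* q)) ∎
      where
      open ≡-Reasoning
      c = (m ℕ.+ m) C (b ℕ.+ b)
      p = paths (b ℕ.+ b) 0
      q = paths (m ℕ.+ m ∸ (b ℕ.+ b)) 0

  quadrant-parity : ∀ k hx hy → oddᵇ (k ℕ.+ hx ℕ.+ hy) ≡ true → quadrant k hx hy ≡ 0
  quadrant-parity zero    zero     zero     ()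
  quadrant-parity zero    zero     (suc hy) _ = refl
  quadrant-parity zero    (suc hx) hy       _ = refl
  quadrant-parity (suc k) hx hy o = cong₂ ℕ._+_ (cong₂ ℕ._+_ (cong₂ ℕ._+_
      (quadrant-parity k (suc hx) hy (subst (λ t → oddᵇ (t ℕ.+ hy) ≡ true) (sym (ℕ.+-suc k hx)) o)) (parityX hx o))
      (quadrant-parity k hx (suc hy) (subst (λ t → oddᵇ t ≡ true) (sym (ℕ.+-suc (k ℕ.+ hx) hy)) o))) (parityY hy o)
    where
    parityX : ∀ hx → oddᵇ (suc k ℕ.+ hx ℕ.+ hy) ≡ true → quadDownX k hx hy ≡ 0
    parityX zero     _ = refl
    parityX (suc hx) o = quadrant-parity k hx hy (trans (sym (not-involutive _))
      (subst (λ t → oddᵇ (suc (t ℕ.+ hy)) ≡ true) (ℕ.+-suc k hx) o))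
    parityY : ∀ hy → oddᵇ (suc k ℕ.+ hx ℕ.+ hy) ≡ true → quadDownY k hx hy ≡ 0
    parityY zero     _ = refl
    parityY (suc hy) o = quadrant-parity k hx hy (trans (sym (not-involutive _))
      (subst (λ t → oddᵇ (suc t) ≡ true) (ℕ.+-suc (k ℕ.+ hx) hy) o))

  4⁻-inv : ∀ m → nat (16 ℕ.^ m) * 4⁻ (m ℕ.+ m) ≡ 1ℚ
  4⁻-inv zero    = trans (cong (_* 1ℚ) nat-1) (*-identityʳ 1ℚ)
  4⁻-inv (suc m) rewrite ℕ.+-suc m m = begin
    nat (16 ℕ.* 16 ℕ.^ m) * (¼ * (¼ * r)) ≡⟨ cong (_* (¼ * (¼ * r))) (nat-* 16 (16 ℕ.^ m)) ⟩
    nat 16 * nat (16 ℕ.^ m) * (¼ * (¼ * r)) ≡⟨ cong (λ t → t * nat (16 ℕ.^ m) * (¼ * (¼ * r))) (nat≡toℚ 16) ⟩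
    toℚ 16 * nat (16 ℕ.^ m) * (¼ * (¼ * r)) ≡⟨ arith (nat (16 ℕ.^ m)) r ⟩
    nat (16 ℕ.^ m) * r ≡⟨ 4⁻-inv m ⟩
    1ℚ ∎
    where
    open ≡-Reasoning
    r = 4⁻ (m ℕ.+ m)
    arith : ∀ x r → toℚ 16 * x * (¼ * (¼ * r)) ≡ x * r
    arith x r = trans (regroup (toℚ 16) x ¼ r) (*-identityˡ (x * r))
      where
      regroup : ∀ s x q r → s * x * (q * (q * r)) ≡ s * q * q * (x * r)
      regroup = solve-∀ ℚ-ring

  -- The origin of the factor 4 in γ: there are 2m letters for the walk and one for the closing
  -- letter, hence 4^(-(2m+1)).
  inv-16 : ∀ m → toℚ 4 * inv (16 ℕ.^ suc m) ≡ 4⁻ (suc (m ℕ.+ m))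
  inv-16 m = begin
    toℚ 4 * inv N ≡⟨ cong (toℚ 4 *_) (sym (recip≡inv N)) ⟩
    toℚ 4 * recip N ≡⟨ *-identityʳ (toℚ 4 * recip N) ⟨
    toℚ 4 * recip N * 1ℚ ≡⟨ cong (toℚ 4 * recip N *_) (sym (4⁻-inv (suc m))) ⟩
    toℚ 4 * recip N * (nat N * 4⁻ (suc m ℕ.+ suc m)) ≡⟨ cong (λ t → toℚ 4 * recip N * (nat N * 4⁻ t)) (cong suc (ℕ.+-suc m m)) ⟩
    toℚ 4 * recip N * (nat N * (¼ * r)) ≡⟨ regroup (toℚ 4) (recip N) (nat N) ¼ r ⟩
    toℚ 4 * ¼ * (nat N * recip N) * r ≡⟨ cong (λ t → toℚ 4 * ¼ * t * r) (nat-recip N {{ℕ.m^n≢0 16 (suc m)}}) ⟩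
    toℚ 4 * ¼ * 1ℚ * r ≡⟨ *-identityˡ r ⟩
    r ∎
    where
    open ≡-Reasoning
    N = 16 ℕ.^ suc m
    r = 4⁻ (suc (m ℕ.+ m))
    regroup : ∀ a b c q r → a * b * (c * (q * r)) ≡ a * q * (c * b) * r
    regroup = solve-∀ ℚ-ring

  -- Each new summand of γ accounts for two more letters. The second of them adds nothing, since an
  -- odd number of steps cannot lead back to the origin.
  γPartial≡isoProb : ∀ M → γPartial M ≡ isoProb (M ℕ.+ M) 0 0
  γPartial≡isoProb zero    = refl
  γPartial≡isoProb (suc m) = begin
    γPartial m + toℚ 4 * (inv (16 ℕ.^ suc m) * innerSum (suc m))
      ≡⟨ cong (γPartial m +_) (sym (*-assoc (toℚ 4) (inv (16 ℕ.^ suc m)) (innerSum (suc m)))) ⟩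
    γPartial m + toℚ 4 * inv (16 ℕ.^ suc m) * innerSum (suc m)
      ≡⟨ cong₂ (λ x y → x + y) (γPartial≡isoProb m) (cong₂ (λ x y → x * y) (inv-16 m) (innerSum≡quadrant m)) ⟩
    isoProb k 0 0 + 4⁻ (suc k) * nat (quadrant k 0 0)
      ≡⟨ cong (isoProb k 0 0 +_) (*-comm (4⁻ (suc k)) (nat (quadrant k 0 0))) ⟩
    isoProb k 0 0 + nat (quadrant k 0 0) * 4⁻ (suc k)
      ≡⟨ isoProb-suc k 0 0 ⟨
    isoProb (suc k) 0 0
      ≡⟨ no-change (isoProb (suc k) 0 0) (suc k) ⟩
    isoProb (suc k) 0 0 + nat 0 * 4⁻ (suc (suc k))
      ≡⟨ cong (λ t → isoProb (suc k) 0 0 + nat t * 4⁻ (suc (suc k))) (sym odd-zero) ⟩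
    isoProb (suc k) 0 0 + nat (quadrant (suc k) 0 0) * 4⁻ (suc (suc k))
      ≡⟨ isoProb-suc (suc k) 0 0 ⟨
    isoProb (suc (suc k)) 0 0
      ≡⟨ cong (λ t → isoProb (suc t) 0 0) (sym (ℕ.+-suc m m)) ⟩
    isoProb (suc m ℕ.+ suc m) 0 0 ∎
    where
    open ≡-Reasoning
    k = m ℕ.+ m
    odd-zero : quadrant (suc k) 0 0 ≡ 0
    odd-zero = quadrant-parity (suc k) 0 0 (trans (cong oddᵇ (trans (ℕ.+-identityʳ (suc k ℕ.+ 0)) (ℕ.+-identityʳ (suc k)))) (odd-double m))

-- Undecided scans: additivity of the count, and recurrence of the walk.

module Survival where

  open Matchings using (ind)
  open Scanning
  open Expectations
  open Excursions
  open import Data.Nat as ℕ using (ℕ; zero; suc; z≤n; _∸_)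
  import Data.Nat.Properties as ℕ
  import Data.Nat.Tactic.RingSolver as ℕRing
  open import Data.Rational
  open import Data.Rational.Properties
  open import Data.Vec using ([]; _∷_; toList)
  open import Tactic.RingSolver using (solve-∀)

  open Expectation

  mutual
    -- A verdict is final: letters appended later matter only to a scan that has run off the end of
    -- `u`.
    scan-++ : ∀ X hx hy u v → scan X hx hy (u ++ v) ≡ scan X hx hy u ⊎ scan X hx hy u ≡ unknown
    scan-++ X hx hy []            v = inj₂ refl
    scan-++ X hx hy ((c , o) ∷ u) v = step-++ X (agree X c) o hx hy u v

    step-++ : ∀ X a o hx hy u v → step X a o hx hy (u ++ v) ≡ step X a o hx hy u ⊎ step X a o hx hy u ≡ unknown
    step-++ X true  true  hx       hy       u v = scan-++ X (suc hx) hy u v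
    step-++ X true  false (suc hx) hy       u v = scan-++ X hx hy u v
    step-++ X true  false zero     zero     u v = inj₁ refl
    step-++ X true  false zero     (suc hy) u v = inj₁ refl
    step-++ X false true  hx       hy       u v = scan-++ X hx (suc hy) u v
    step-++ X false false hx       (suc hy) u v = scan-++ X hx hy u v
    step-++ X false false hx       zero     u v = inj₁ refl

  status-++ : ∀ l u v → status (l ∷ u ++ v) ≡ status (l ∷ u) ⊎ status (l ∷ u) ≡ unknown
  status-++ (c , false) u v = inj₁ refl
  status-++ (c , true)  u v = scan-++ c 0 0 u v

  private
    ind-lower : ∀ {s t} → s ≡ t ⊎ t ≡ unknown → ind (isIso t) ℕ.≤ ind (isIso s)
    ind-lower (inj₁ refl) = ℕ.≤-refl
    ind-lower (inj₂ refl) = z≤n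

    ind-upper : ∀ {s t} → s ≡ t ⊎ t ≡ unknown → ind (isIso s) ℕ.≤ ind (isIso t) ℕ.+ ind (isUnknown t)
    ind-upper {s} (inj₁ refl) = ℕ.m≤m+n _ _
    ind-upper {iso}     (inj₂ refl) = ℕ.≤-refl
    ind-upper {non}     (inj₂ refl) = z≤n
    ind-upper {unknown} (inj₂ refl) = z≤n

  isoCount-++-≥ : ∀ u v → isoCount u ℕ.+ isoCount v ℕ.≤ isoCount (u ++ v)
  isoCount-++-≥ []      v = ℕ.≤-refl
  isoCount-++-≥ (l ∷ u) v = ℕ.≤-trans (ℕ.≤-reflexive (ℕ.+-assoc (ind (isIso (status (l ∷ u)))) _ _))
    (ℕ.+-mono-≤ (ind-lower (status-++ l u v)) (isoCount-++-≥ u v))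

  isoCount-++-≤ : ∀ u v → isoCount (u ++ v) ℕ.≤ (isoCount u ℕ.+ unknownCount u) ℕ.+ isoCount v
  isoCount-++-≤ []      v = ℕ.≤-refl
  isoCount-++-≤ (l ∷ u) v = ℕ.≤-trans (ℕ.+-mono-≤ (ind-upper (status-++ l u v)) (isoCount-++-≤ u v))
    (ℕ.≤-reflexive (arith (ind (isIso (status (l ∷ u)))) (ind (isUnknown (status (l ∷ u)))) (isoCount u) (unknownCount u) (isoCount v)))
    where
    arith : ∀ i j a b c → (i ℕ.+ j) ℕ.+ ((a ℕ.+ b) ℕ.+ c) ≡ ((i ℕ.+ a) ℕ.+ (j ℕ.+ b)) ℕ.+ c
    arith = ℕRing.solve-∀

  ind-≤1 : ∀ b → ind b ℕ.≤ 1
  ind-≤1 false = z≤n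
  ind-≤1 true  = ℕ.≤-refl

  isoCount-≤ : ∀ w → isoCount w ℕ.≤ length w
  isoCount-≤ []      = z≤n
  isoCount-≤ (l ∷ w) = ℕ.+-mono-≤ (ind-≤1 (isIso (status (l ∷ w)))) (isoCount-≤ w)

  unknownCount-≤ : ∀ w → unknownCount w ℕ.≤ length w
  unknownCount-≤ []      = z≤n
  unknownCount-≤ (l ∷ w) = ℕ.+-mono-≤ (ind-≤1 (isUnknown (status (l ∷ w)))) (unknownCount-≤ w)

  Σℚ : ℕ → (ℕ → ℚ) → ℚ
  Σℚ zero    f = 0ℚ
  Σℚ (suc n) f = Σℚ n f + f n

  Σℚ-front : ∀ n f → Σℚ (suc n) f ≡ f 0 + Σℚ n (f ∘ suc)
  Σℚ-front zero    f = +-comm 0ℚ (f 0)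
  Σℚ-front (suc n) f = trans (cong (_+ f (suc n)) (Σℚ-front n f)) (+-assoc (f 0) (Σℚ n (f ∘ suc)) (f (suc n)))

  Σℚ-cong : ∀ n {f g} → (∀ j → f j ≡ g j) → Σℚ n f ≡ Σℚ n g
  Σℚ-cong zero    h = refl
  Σℚ-cong (suc n) h = cong₂ _+_ (Σℚ-cong n h) (h n)

  Σℚ-zero : ∀ n → Σℚ n (λ _ → 0ℚ) ≡ 0ℚ
  Σℚ-zero zero    = refl
  Σℚ-zero (suc n) = trans (cong (_+ 0ℚ) (Σℚ-zero n)) refl

  Σℚ-+ : ∀ n f g → Σℚ n (λ j → f j + g j) ≡ Σℚ n f + Σℚ n g
  Σℚ-+ zero    f g = refl
  Σℚ-+ (suc n) f g = trans (cong (_+ (f n + g n)) (Σℚ-+ n f g)) (swap (Σℚ n f) (Σℚ n g) (f n) (g n))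
    where
    swap : ∀ a b c d → (a + b) + (c + d) ≡ (a + c) + (b + d)
    swap = solve-∀ ℚ-ring

  Σℚ-avg : ∀ n f g h k → Σℚ n (λ j → avg-of (f j) (g j) (h j) (k j)) ≡ avg-of (Σℚ n f) (Σℚ n g) (Σℚ n h) (Σℚ n k)
  Σℚ-avg zero    f g h k = refl
  Σℚ-avg (suc n) f g h k = trans (cong (_+ avg-of (f n) (g n) (h n) (k n)) (Σℚ-avg n f g h k))
    (merge (Σℚ n f) (Σℚ n g) (Σℚ n h) (Σℚ n k) (f n) (g n) (h n) (k n))
    where
    merge : ∀ a b c d a′ b′ c′ d′ → ¼ * (a + b + c + d) + ¼ * (a′ + b′ + c′ + d′) ≡
      ¼ * ((a + a′) + (b + b′) + (c + c′) + (d + d′))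
    merge = solve-∀ ℚ-ring

  Σℚ-upper : ∀ n {f c} → (∀ j → j ℕ.< n → f j ≤ c) → Σℚ n f ≤ nat n * c
  Σℚ-upper zero    {f} {c} h = ≤-reflexive (sym (trans (cong (_* c) nat-0) (*-zeroˡ c)))
  Σℚ-upper (suc n) {f} {c} h = ≤-trans (+-mono-≤ (Σℚ-upper n (λ j j<n → h j (ℕ.m<n⇒m<1+n j<n))) (h n ℕ.≤-refl))
    (≤-reflexive (trans (+-comm (nat n * c) c) (nat-suc-* n c)))

  Σℚ-lower : ∀ n {f c} → (∀ j → c ≤ f j) → nat n * c ≤ Σℚ n f
  Σℚ-lower zero    {f} {c} h = ≤-reflexive (trans (cong (_* c) nat-0) (*-zeroˡ c))
  Σℚ-lower (suc n) {f} {c} h = ≤-trans (≤-reflexive (sym (trans (+-comm (nat n * c) c) (nat-suc-* n c))))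
    (+-mono-≤ (Σℚ-lower n h) (h n))

  -- expected number of steps among the first t that a lazy walk started at x makes before reaching 0
  survival : ℕ → ℕ → ℚ
  survival zero    x       = 0ℚ
  survival (suc t) zero    = 0ℚ
  survival (suc t) (suc x) = 1ℚ + avg-of (survival t (2 ℕ.+ x)) (survival t x) (survival t (suc x)) (survival t (suc x))

  avg-≥0 : ∀ {a b c d} → 0ℚ ≤ a → 0ℚ ≤ b → 0ℚ ≤ c → 0ℚ ≤ d → 0ℚ ≤ avg-of a b c d
  avg-≥0 p q r s = *-≥0 ¼-≥0 (+-≥0 (+-≥0 (+-≥0 p q) r) s)

  survival-≥0 : ∀ t x → 0ℚ ≤ survival t x
  survival-≥0 zero    x       = ≤-refl
  survival-≥0 (suc t) zero    = ≤-refl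
  survival-≥0 (suc t) (suc x) = +-≥0 (nonNegative⁻¹ 1ℚ)
    (avg-≥0 (survival-≥0 t (2 ℕ.+ x)) (survival-≥0 t x) (survival-≥0 t (suc x)) (survival-≥0 t (suc x)))

  survival-0 : ∀ t → 0ℚ ≡ survival t 0
  survival-0 zero    = refl
  survival-0 (suc t) = refl

  -- The sum is the expected number of steps of the undecided scan. Only the scanned colour is kept:
  -- letters of the other colour become the lazy steps, and stopping because of them only shortens
  -- the scan. The height is shifted by one since a closing letter at `hx = 0` still has to be read.
  Σ-unkProb-≤ : ∀ t hx hy → Σℚ t (λ d → unkProb d hx hy) ≤ survival t (suc hx)
  Σ-unkProb-≤ zero    hx hy = ≤-refl
  Σ-unkProb-≤ (suc t) hx hy = begin
    Σℚ (suc t) (λ d → unkProb d hx hy) ≡⟨ Σℚ-front t (λ d → unkProb d hx hy) ⟩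
    1ℚ + Σℚ t (λ d → unkProb (suc d) hx hy) ≡⟨ cong (1ℚ +_) (Σℚ-avg t (λ d → unkProb d (suc hx) hy) (λ d → downX 0ℚ 1ℚ d hx hy) (λ d → unkProb d hx (suc hy)) (λ d → downY 0ℚ 1ℚ d hx hy)) ⟩
    1ℚ + avg-of (Σℚ t (λ d → unkProb d (suc hx) hy)) (Σℚ t (λ d → downX 0ℚ 1ℚ d hx hy)) (Σℚ t (λ d → unkProb d hx (suc hy))) (Σℚ t (λ d → downY 0ℚ 1ℚ d hx hy))
      ≤⟨ +-monoʳ-≤ 1ℚ (avg-mono (Σ-unkProb-≤ t (suc hx) hy) (sumX hx hy) (Σ-unkProb-≤ t hx (suc hy)) (sumY hy)) ⟩
    survival (suc t) (suc hx) ∎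
    where
    open ≤-Reasoning
    sumX : ∀ hx hy → Σℚ t (λ d → downX 0ℚ 1ℚ d hx hy) ≤ survival t hx
    sumX zero     zero     = ≤-reflexive (trans (Σℚ-zero t) (survival-0 t))
    sumX zero     (suc hy) = ≤-reflexive (trans (Σℚ-zero t) (survival-0 t))
    sumX (suc hx) hy       = Σ-unkProb-≤ t hx hy
    sumY : ∀ hy → Σℚ t (λ d → downY 0ℚ 1ℚ d hx hy) ≤ survival t (suc hx)
    sumY zero     = ≤-trans (≤-reflexive (Σℚ-zero t)) (survival-≥0 t (suc hx))
    sumY (suc hy) = Σ-unkProb-≤ t hx hy

  module _ (H : ℕ) where

    -- x (2H - x) for x ≤ H, and constant afterwards
    cap : ℕ → ℕ
    cap zero    = 0
    cap (suc x) = cap x ℕ.+ ((H ∸ x) ℕ.+ (H ∸ suc x))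

    -- t x pays (after division by H) for the steps at heights ≥ H, as the height is a martingale;
    -- cap decreases by 1/2 on average at each step below H, so 2 H cap x pays for those
    potential : ℕ → ℕ → ℕ
    potential t x = t ℕ.* x ℕ.+ 2 ℕ.* H ℕ.* cap x

    -- For `suc x < H` the second difference of `cap` is -2, which yields the 4H; otherwise
    -- `4 * suc x` is already as large.
    concave : ∀ x → 4 ℕ.* H ℕ.+ 2 ℕ.* H ℕ.* (H ∸ (2 ℕ.+ x)) ℕ.≤ 4 ℕ.* suc x ℕ.+ 2 ℕ.* H ℕ.* (H ∸ x)
    concave x with suc x ℕ.<? H
    ... | yes x<H = ℕ.≤-trans (ℕ.≤-reflexive (trans (arith H (H ∸ (2 ℕ.+ x))) (cong (2 ℕ.* H ℕ.*_) two)))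
                      (ℕ.m≤n+m _ (4 ℕ.* suc x))
      where
      two : 2 ℕ.+ (H ∸ (2 ℕ.+ x)) ≡ H ∸ x
      two = trans (sym (ℕ.+-∸-assoc 2 x<H)) refl
      arith : ∀ H a → 4 ℕ.* H ℕ.+ 2 ℕ.* H ℕ.* a ≡ 2 ℕ.* H ℕ.* (2 ℕ.+ a)
      arith = ℕRing.solve-∀
    ... | no  x≮H = ℕ.+-mono-≤ (ℕ.*-monoʳ-≤ 4 (ℕ.≮⇒≥ x≮H)) (ℕ.*-monoʳ-≤ (2 ℕ.* H) (ℕ.∸-monoʳ-≤ H (ℕ.m≤n+m x 2)))

    potential-step : ∀ t x → 4 ℕ.* H ℕ.+ (potential t (2 ℕ.+ x) ℕ.+ potential t x ℕ.+ potential t (suc x) ℕ.+ potential t (suc x))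
      ℕ.≤ 4 ℕ.* potential (suc t) (suc x)
    potential-step t x = ℕ.≤-trans (ℕ.≤-reflexive (arith₁ H t x (cap x) (H ∸ x) (H ∸ suc x) (H ∸ (2 ℕ.+ x))))
      (ℕ.≤-trans (ℕ.+-monoʳ-≤ _ (concave x)) (ℕ.≤-reflexive (arith₂ H t x (cap x) (H ∸ x) (H ∸ suc x))))
      where
      arith₁ : ∀ H t x q c b a →
        4 ℕ.* H ℕ.+ ((t ℕ.* (2 ℕ.+ x) ℕ.+ 2 ℕ.* H ℕ.* ((q ℕ.+ (c ℕ.+ b)) ℕ.+ (b ℕ.+ a))) ℕ.+ (t ℕ.* x ℕ.+ 2 ℕ.* H ℕ.* q)
          ℕ.+ (t ℕ.* suc x ℕ.+ 2 ℕ.* H ℕ.* (q ℕ.+ (c ℕ.+ b))) ℕ.+ (t ℕ.* suc x ℕ.+ 2 ℕ.* H ℕ.* (q ℕ.+ (c ℕ.+ b)))) ≡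
        (4 ℕ.* t ℕ.* suc x ℕ.+ 2 ℕ.* H ℕ.* (4 ℕ.* q ℕ.+ 3 ℕ.* c ℕ.+ 4 ℕ.* b)) ℕ.+ (4 ℕ.* H ℕ.+ 2 ℕ.* H ℕ.* a)
      arith₁ = ℕRing.solve-∀
      arith₂ : ∀ H t x q c b →
        (4 ℕ.* t ℕ.* suc x ℕ.+ 2 ℕ.* H ℕ.* (4 ℕ.* q ℕ.+ 3 ℕ.* c ℕ.+ 4 ℕ.* b)) ℕ.+ (4 ℕ.* suc x ℕ.+ 2 ℕ.* H ℕ.* c) ≡
        4 ℕ.* (suc t ℕ.* suc x ℕ.+ 2 ℕ.* H ℕ.* (q ℕ.+ (c ℕ.+ b)))
      arith₂ = ℕRing.solve-∀

    ¼-nat-4 : ∀ k → ¼ * nat (4 ℕ.* k) ≡ nat k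
    ¼-nat-4 k = trans (cong (¼ *_) (trans (nat-* 4 k) (cong (_* nat k) (nat≡toℚ 4)))) (trans (sym (*-assoc ¼ (toℚ 4) (nat k))) (*-identityˡ (nat k)))

    survival-potential : ∀ t x → nat H * survival t x ≤ nat (potential t x)
    survival-potential zero    x       = ≤-trans (≤-reflexive (*-zeroʳ (nat H))) (nat-≥0 _)
    survival-potential (suc t) zero    = ≤-trans (≤-reflexive (*-zeroʳ (nat H))) (nat-≥0 _)
    survival-potential (suc t) (suc x) = begin
      nat H * (1ℚ + avg-of a b c c) ≡⟨ distribute (nat H) a b c ⟩
      ¼ * (((1ℚ + 1ℚ) * (1ℚ + 1ℚ)) * nat H + (nat H * a + nat H * b + nat H * c + nat H * c))
        ≤⟨ *-monoˡ ¼-≥0 (+-mono-≤ (≤-reflexive (sym four)) (+-mono-≤ (+-mono-≤ (+-mono-≤ (survival-potential t (2 ℕ.+ x)) (survival-potential t x)) ih) ih)) ⟩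
      ¼ * (nat (4 ℕ.* H) + (nat p + nat q + nat r + nat r)) ≡⟨ cong (¼ *_) (sym sums) ⟩
      ¼ * nat (4 ℕ.* H ℕ.+ (p ℕ.+ q ℕ.+ r ℕ.+ r)) ≤⟨ *-monoˡ ¼-≥0 (nat-mono-≤ (potential-step t x)) ⟩
      ¼ * nat (4 ℕ.* potential (suc t) (suc x)) ≡⟨ ¼-nat-4 (potential (suc t) (suc x)) ⟩
      nat (potential (suc t) (suc x)) ∎
      where
      open ≤-Reasoning
      a = survival t (2 ℕ.+ x)
      b = survival t x
      c = survival t (suc x)
      p = potential t (2 ℕ.+ x)
      q = potential t x
      r = potential t (suc x)
      ih = survival-potential t (suc x)
      distribute : ∀ h a b c → h * (1ℚ + ¼ * (a + b + c + c)) ≡ ¼ * (((1ℚ + 1ℚ) * (1ℚ + 1ℚ)) * h + (h * a + h * b + h * c + h * c))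
      distribute = solve-∀ ℚ-ring
      four : nat (4 ℕ.* H) ≡ ((1ℚ + 1ℚ) * (1ℚ + 1ℚ)) * nat H
      four = trans (nat-* 4 H) (cong (_* nat H) (nat≡toℚ 4))
      sums : nat (4 ℕ.* H ℕ.+ (p ℕ.+ q ℕ.+ r ℕ.+ r)) ≡ nat (4 ℕ.* H) + (nat p + nat q + nat r + nat r)
      sums = trans (nat-+ (4 ℕ.* H) (p ℕ.+ q ℕ.+ r ℕ.+ r)) (cong (nat (4 ℕ.* H) +_)
        (trans (nat-+ (p ℕ.+ q ℕ.+ r) r) (cong (_+ nat r) (trans (nat-+ (p ℕ.+ q) r) (cong (_+ nat r) (nat-+ p q))))))

  μ υ : ℕ → ℚ
  μ n = 𝔼 n (nat ∘ isoCount)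
  υ n = 𝔼 n (nat ∘ unknownCount)

  nat-ind : ∀ b → nat (ind b) ≡ indℚ b
  nat-ind true  = nat-1
  nat-ind false = nat-0

  𝔼-count : ∀ d (p : List Letter → Bool) (f : List Letter → ℕ) {q m} → 𝔼 d (indℚ ∘ p) ≡ q → 𝔼 d (nat ∘ f) ≡ m →
    𝔼 d (λ w → nat (ind (p w) ℕ.+ f w)) ≡ q + m
  𝔼-count d p f {q} {m} ep ef = trans (E-cong (words d) (λ v → trans (nat-+ (ind (p (toList v))) (f (toList v))) (cong (_+ nat (f (toList v))) (nat-ind (p (toList v))))))
    (trans (add (words d) (indℚ ∘ p ∘ toList) (nat ∘ f ∘ toList)) (cong₂ _+_ ep ef))

  two-avg : ∀ s m → (1ℚ + 1ℚ) * (¼ * ((s + m) + (0ℚ + m) + (s + m) + (0ℚ + m))) ≡ (1ℚ + 1ℚ) * m + s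
  two-avg = solve-∀ ℚ-ring

  -- The letter that is followed by `d` others is an opening letter with probability 1/2, whence the
  -- factor 2, and then its scan over `d` letters says `iso` with probability `isoProb d 0 0`.
  2μ≡Σ : ∀ n → (1ℚ + 1ℚ) * μ n ≡ Σℚ n (λ d → isoProb d 0 0)
  2μ≡Σ zero    = trans (cong ((1ℚ + 1ℚ) *_) nat-0) refl
  2μ≡Σ (suc n) = trans (cong ((1ℚ + 1ℚ) *_) (avg-cong
      (𝔼-count n (isIso ∘ scan true 0 0) isoCount (scan-iso n true 0 0) refl)
      (𝔼-count n (λ _ → false) isoCount (const (words n) 0ℚ) refl)
      (𝔼-count n (isIso ∘ scan false 0 0) isoCount (scan-iso n false 0 0) refl)
      (𝔼-count n (λ _ → false) isoCount (const (words n) 0ℚ) refl)))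
    (trans (two-avg (isoProb n 0 0) (μ n)) (cong (_+ isoProb n 0 0) (2μ≡Σ n)))

  2υ≡Σ : ∀ n → (1ℚ + 1ℚ) * υ n ≡ Σℚ n (λ d → unkProb d 0 0)
  2υ≡Σ zero    = trans (cong ((1ℚ + 1ℚ) *_) nat-0) refl
  2υ≡Σ (suc n) = trans (cong ((1ℚ + 1ℚ) *_) (avg-cong
      (𝔼-count n (isUnknown ∘ scan true 0 0) unknownCount (scan-unknown n true 0 0) refl)
      (𝔼-count n (λ _ → false) unknownCount (const (words n) 0ℚ) refl)
      (𝔼-count n (isUnknown ∘ scan false 0 0) unknownCount (scan-unknown n false 0 0) refl)
      (𝔼-count n (λ _ → false) unknownCount (const (words n) 0ℚ) refl)))
    (trans (two-avg (unkProb n 0 0) (υ n)) (cong (_+ unkProb n 0 0) (2υ≡Σ n)))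

  iso-or-unknown : ∀ d e → isoProb (d ℕ.+ e) 0 0 ≤ isoProb d 0 0 + unkProb d 0 0
  iso-or-unknown d e = begin
    isoProb (d ℕ.+ e) 0 0 ≡⟨ scan-iso (d ℕ.+ e) true 0 0 ⟨
    𝔼 (d ℕ.+ e) F ≡⟨ 𝔼-++ d e F ⟩
    𝔼 d (λ u → 𝔼 e (λ v → F (u ++ v))) ≤⟨ mono (words d) (λ u → mono (words e) (λ v → compare (scan-++ true 0 0 (toList u) (toList v)))) ⟩
    𝔼 d (λ u → 𝔼 e (λ v → F u + G u)) ≡⟨ E-cong (words d) (λ u → const (words e) (F (toList u) + G (toList u))) ⟩
    𝔼 d (λ u → F u + G u) ≡⟨ add (words d) (F ∘ toList) (G ∘ toList) ⟩
    𝔼 d F + 𝔼 d G ≡⟨ cong₂ (λ x y → x + y) (scan-iso d true 0 0) (scan-unknown d true 0 0) ⟩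
    isoProb d 0 0 + unkProb d 0 0 ∎
    where
    open ≤-Reasoning
    F G : List Letter → ℚ
    F w = indℚ (isIso (scan true 0 0 w))
    G w = indℚ (isUnknown (scan true 0 0 w))
    compare : ∀ {s t} → s ≡ t ⊎ t ≡ unknown → indℚ (isIso s) ≤ indℚ (isIso t) + indℚ (isUnknown t)
    compare {s} {t} (inj₁ refl) = ≤-by (indℚ (isUnknown t)) (indℚ-≥0 (isUnknown t)) refl
    compare {iso}     (inj₂ refl) = ≤-refl
    compare {non}     (inj₂ refl) = nonNegative⁻¹ 1ℚ
    compare {unknown} (inj₂ refl) = nonNegative⁻¹ 1ℚ

  2μ≤ : ∀ n → (1ℚ + 1ℚ) * μ n ≤ nat n * γPartial n
  2μ≤ n = subst₂ _≤_ (sym (2μ≡Σ n)) (cong (nat n *_) (sym (γPartial≡isoProb n)))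
    (Σℚ-upper n (λ j j<n → isoProb-mono (ℕ.≤-trans (ℕ.<⇒≤ j<n) (ℕ.m≤m+n n n)) 0 0))

  -- A scan that says `iso` after d+2M letters has said so after `d` letters or was undecided then.
  -- Truncating all scans to a word thus loses at most the undecided ones, uniformly in `M`.
  γ≤2μ+2υ : ∀ n M → nat n * γPartial M ≤ (1ℚ + 1ℚ) * μ n + (1ℚ + 1ℚ) * υ n
  γ≤2μ+2υ n M = subst₂ _≤_ (cong (nat n *_) (sym (γPartial≡isoProb M)))
    (trans (Σℚ-+ n (λ d → isoProb d 0 0) (λ d → unkProb d 0 0)) (cong₂ _+_ (sym (2μ≡Σ n)) (sym (2υ≡Σ n))))
    (Σℚ-lower n (λ d → ≤-trans (isoProb-mono (ℕ.m≤n+m (M ℕ.+ M) d) 0 0) (iso-or-unknown d (M ℕ.+ M))))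

  -- The choice ℓ = 4H^2 balances the two terms of the potential at height 1: the martingale part is
  -- ℓ, and 2H times the cap is at most 2H times 2H.
  υ-bound : ∀ H → nat H * υ (4 ℕ.* (H ℕ.* H)) ≤ nat (4 ℕ.* (H ℕ.* H))
  υ-bound H = *-cancel {1ℚ + 1ℚ} (positive⁻¹ (1ℚ + 1ℚ)) (begin
    (1ℚ + 1ℚ) * (nat H * υ ℓ) ≡⟨ swap (1ℚ + 1ℚ) (nat H) (υ ℓ) ⟩
    nat H * ((1ℚ + 1ℚ) * υ ℓ) ≡⟨ cong (nat H *_) (2υ≡Σ ℓ) ⟩
    nat H * Σℚ ℓ (λ d → unkProb d 0 0) ≤⟨ *-monoˡ (nat-≥0 H) (Σ-unkProb-≤ ℓ 0 0) ⟩
    nat H * survival ℓ 1 ≤⟨ survival-potential H ℓ 1 ⟩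
    nat (potential H ℓ 1) ≤⟨ nat-mono-≤ small ⟩
    nat (2 ℕ.* ℓ) ≡⟨ trans (nat-* 2 ℓ) (cong (_* nat ℓ) nat-2) ⟩
    (1ℚ + 1ℚ) * nat ℓ ∎)
    where
    open ≤-Reasoning
    ℓ = 4 ℕ.* (H ℕ.* H)
    swap : ∀ a b c → a * (b * c) ≡ b * (a * c)
    swap = solve-∀ ℚ-ring
    arith : ∀ H → 4 ℕ.* (H ℕ.* H) ℕ.* 1 ℕ.+ 2 ℕ.* H ℕ.* (0 ℕ.+ (H ℕ.+ H)) ≡ 2 ℕ.* (4 ℕ.* (H ℕ.* H))
    arith = ℕRing.solve-∀
    small : potential H ℓ 1 ℕ.≤ 2 ℕ.* ℓ
    small = ℕ.≤-trans (ℕ.+-monoʳ-≤ (ℓ ℕ.* 1) (ℕ.*-monoʳ-≤ (2 ℕ.* H) (ℕ.+-monoʳ-≤ H (ℕ.m∸n≤m H 1)))) (ℕ.≤-reflexive (arith H))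

-- Blocks and superblocks of uniform words, and the exponential bound.

module BlockDecomposition where

  open Scanning
  open Expectations
  open Excursions
  open Survival
  open import Data.Nat as ℕ using (ℕ; zero; suc; z≤n; s≤s; _∸_)
  import Data.Nat.Properties as ℕ
  import Data.Nat.Tactic.RingSolver as ℕRing
  open import Data.Rational
  open import Data.Rational.Properties
  open import Data.Vec using (Vec; []; _∷_; toList)
  open import Data.Vec.Properties using (length-toList)
  open import Tactic.RingSolver using (solve-∀)

  open Expectation

  flat : ∀ {A : Set} {k} → (A → List Letter) → Vec A k → List Letter
  flat c []      = []
  flat c (a ∷ v) = c a ++ flat c v

  𝔼-flat : ∀ {A : Set} (X : Expectation A) (c : A → List Letter) n → (∀ F → 𝔼 n F ≡ E X (F ∘ c)) →
    ∀ k F → 𝔼 (k ℕ.* n) F ≡ E (power X k) (F ∘ flat c)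
  𝔼-flat X c n h zero    F = refl
  𝔼-flat X c n h (suc k) F = trans (𝔼-++ n (k ℕ.* n) F)
    (trans (h (λ u → 𝔼 (k ℕ.* n) (λ v → F (u ++ v)))) (E-cong X (λ a → 𝔼-flat X c n h k (λ v → F (c a ++ v)))))

  indℚ-∨ : ∀ a b → indℚ (a ∨ b) ≤ indℚ a + indℚ b
  indℚ-∨ true  b = ≤-by (indℚ b) (indℚ-≥0 b) refl
  indℚ-∨ false b = ≤-reflexive (sym (+-identityˡ (indℚ b)))

  indℚ-≤1 : ∀ b → indℚ b ≤ 1ℚ
  indℚ-≤1 false = nonNegative⁻¹ 1ℚ
  indℚ-≤1 true  = ≤-refl

  root-≤ : ∀ {x t} → 0ℚ ≤ t → x * x ≤ t * t → x ≤ t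
  root-≤ {x} {t} 0≤t le = ≮⇒≥ λ t<x → <-irrefl refl (<-≤-trans
    (≤-<-trans (*-monoˡ 0≤t (<⇒≤ t<x)) (*-monoˡ-<-pos x {{positive (≤-<-trans 0≤t t<x)}} t<x)) le)

  neg-root-≤ : ∀ {x t} → 0ℚ ≤ t → x * x ≤ t * t → - t ≤ x
  neg-root-≤ {x} {t} 0≤t le = subst (- t ≤_) (neg-involutive x) (neg-antimono-≤ (root-≤ 0≤t (subst (_≤ t * t) (sq x) le)))
    where
    sq : ∀ x → x * x ≡ - x * - x
    sq = solve-∀ ℚ-ring
    neg-involutive : ∀ x → - - x ≡ x
    neg-involutive = solve-∀ ℚ-ring

  total-mono : ∀ {A : Set} {k} (f : A → ℚ) {c} → (∀ a → f a ≤ c) → (v : Vec A k) → total f v ≤ nat k * c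
  total-mono f {c} h []      = ≤-reflexive (sym (trans (cong (_* c) nat-0) (*-zeroˡ c)))
  total-mono f {c} h (_∷_ {n = k} a v) = ≤-trans (+-mono-≤ (h a) (total-mono f h v))
    (≤-reflexive (nat-suc-* k c))

  total-≥0 : ∀ {A : Set} {k} (f : A → ℚ) → (∀ a → 0ℚ ≤ f a) → (v : Vec A k) → 0ℚ ≤ total f v
  total-≥0 f h []      = ≤-refl
  total-≥0 f h (a ∷ v) = +-≥0 (h a) (total-≥0 f h v)

  total-shift : ∀ {A : Set} {k} (f : A → ℚ) c (v : Vec A k) → total (λ a → f a - c) v ≡ total f v - nat k * c
  total-shift f c [] = sym (trans (cong (λ t → 0ℚ - t * c) nat-0) (trans (cong (λ t → 0ℚ - t) (*-zeroˡ c)) refl))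
  total-shift f c (_∷_ {n = k} a v) = trans (cong (f a - c +_) (total-shift f c v))
    (trans (arith (f a) c (total f v) (nat k)) (cong (λ t → f a + total f v - t * c) (sym (nat-suc k))))
    where
    arith : ∀ x c y k → (x - c) + (y - k * c) ≡ x + y - (1ℚ + k) * c
    arith = solve-∀ ℚ-ring

  countV-cons : ∀ {A : Set} {k} (p : A → Bool) a (v : Vec A k) → nat (countV p (a ∷ v)) ≡ indℚ (p a) + nat (countV p v)
  countV-cons p a v with p a
  ... | true  = nat-suc (countV p v)
  ... | false = sym (+-identityˡ (nat (countV p v)))

  does-true : ∀ {P : Set} (d : Dec P) → does d ≡ true → P
  does-true (yes p) _ = p

  does-false : ∀ {P : Set} (d : Dec P) → does d ≡ false → ¬ P
  does-false (no ¬p) _ = ¬p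

  T⇒true : ∀ {b} → T b → b ≡ true
  T⇒true {true} _ = refl

  ∨-false : ∀ a b → a ∨ b ≡ false → a ≡ false × b ≡ false
  ∨-false false false _ = refl , refl

  not-∧-false : ∀ a b → not (a ∧ b) ≡ false → a ≡ true × b ≡ true
  not-∧-false true true _ = refl , refl

  -- A superblock has J blocks of ℓ letters, Λ letters in all, and tolerance t = Hℓ = Λ/s. Chebyshev
  -- bounds a large deviation by Jℓ^2/t^2, and Markov with `υ-bound` bounds many undecided letters
  -- by J(ℓ/H)/t. Both equal J/H^2 = s/H = 1/G for J = Hs and H = Gs, and G = 2*4^s lets the two
  -- events together have probability at most 4^(-s).
  module Blocks (s G H ℓ J Λ : ℕ) (0<s : 0 ℕ.< s) (G≡ : G ≡ 2 ℕ.* 4 ℕ.^ s) (H≡ : H ≡ G ℕ.* s)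
                (ℓ≡ : ℓ ≡ 4 ℕ.* (H ℕ.* H)) (J≡ : J ≡ H ℕ.* s) (Λ≡ : Λ ≡ J ℕ.* ℓ) where

    0<G : 0 ℕ.< G
    0<G = subst (0 ℕ.<_) (sym G≡) (ℕ.*-mono-< {0} {2} {0} {4 ℕ.^ s} (s≤s z≤n) (ℕ.m^n>0 4 s))
    0<H : 0 ℕ.< H
    0<H = subst (0 ℕ.<_) (sym H≡) (ℕ.*-mono-< 0<G 0<s)
    0<ℓ : 0 ℕ.< ℓ
    0<ℓ = subst (0 ℕ.<_) (sym ℓ≡) (ℕ.*-mono-< {0} {4} {0} (s≤s z≤n) (ℕ.*-mono-< 0<H 0<H))
    0<J : 0 ℕ.< J
    0<J = subst (0 ℕ.<_) (sym J≡) (ℕ.*-mono-< 0<H 0<s)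
    0<Λ : 0 ℕ.< Λ
    0<Λ = subst (0 ℕ.<_) (sym Λ≡) (ℕ.*-mono-< 0<J 0<ℓ)

    Block Super : Set
    Block = Vec Letter ℓ
    Super = Vec Block J

    blockE : Expectation Block
    blockE = words ℓ

    superE : Expectation Super
    superE = power blockE J

    isoB unkB dev : Block → ℚ
    isoB B = nat (isoCount (toList B))
    unkB B = nat (unknownCount (toList B))
    dev B  = isoB B - μ ℓ

    t : ℚ
    t = nat (H ℕ.* ℓ)

    t≥0 : 0ℚ ≤ t
    t≥0 = nat-≥0 (H ℕ.* ℓ)

    isoB-≤ : ∀ B → isoB B ≤ nat ℓ
    isoB-≤ B = nat-mono-≤ (subst (isoCount (toList B) ℕ.≤_) (length-toList B) (isoCount-≤ (toList B)))

    unkB-≤ : ∀ B → unkB B ≤ nat ℓ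
    unkB-≤ B = nat-mono-≤ (subst (unknownCount (toList B) ℕ.≤_) (length-toList B) (unknownCount-≤ (toList B)))

    μ-≥0 : 0ℚ ≤ μ ℓ
    μ-≥0 = E-≥0 blockE (λ B → nat-≥0 (isoCount (toList B)))

    μ-≤ : μ ℓ ≤ nat ℓ
    μ-≤ = ≤-trans (mono blockE isoB-≤) (≤-reflexive (const blockE (nat ℓ)))

    dev-mean : E blockE dev ≡ 0ℚ
    dev-mean = trans (add blockE isoB (λ _ → - μ ℓ)) (trans (cong (μ ℓ +_) (const blockE (- μ ℓ))) (+-inverseʳ (μ ℓ)))

    dev-square : ∀ B → dev B * dev B ≤ nat ℓ * nat ℓ
    dev-square B = square-bound
      (≤-trans (neg-antimono-≤ μ-≤) (≤-by (isoB B) (nat-≥0 (isoCount (toList B))) (+-comm (- μ ℓ) (isoB B))))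
      (≤-trans (≤-by (μ ℓ) μ-≥0 (cancel (isoB B) (μ ℓ))) (isoB-≤ B))
      where
      cancel : ∀ x m → x - m + m ≡ x
      cancel = solve-∀ ℚ-ring

    devHigh unkHigh bad : Super → Bool
    devHigh S = does (t * t <? total dev S * total dev S)
    unkHigh S = does (t <? total unkB S)
    bad S     = devHigh S ∨ unkHigh S

    T-does-< : ∀ x y → T (does (x <? y)) → x ≤ y
    T-does-< x y h = <⇒≤ (does-true (x <? y) (T⇒true h))

    devHigh-rare : nat G * E superE (indℚ ∘ devHigh) ≤ 1ℚ
    devHigh-rare = *-cancel {nat (J ℕ.* (ℓ ℕ.* ℓ))} (nat->0 (ℕ.*-mono-< 0<J (ℕ.*-mono-< 0<ℓ 0<ℓ))) (begin
      nat (J ℕ.* (ℓ ℕ.* ℓ)) * (nat G * P) ≡⟨ sym (*-assoc (nat (J ℕ.* (ℓ ℕ.* ℓ))) (nat G) P) ⟩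
      nat (J ℕ.* (ℓ ℕ.* ℓ)) * nat G * P ≡⟨ cong (_* P) (nat-* (J ℕ.* (ℓ ℕ.* ℓ)) G) ⟨
      nat (J ℕ.* (ℓ ℕ.* ℓ) ℕ.* G) * P ≡⟨ cong (λ k → nat k * P) (trans (cong (λ j → j ℕ.* (ℓ ℕ.* ℓ) ℕ.* G) (trans J≡ (cong (ℕ._* s) H≡))) (trans (arith G s ℓ) (cong (λ h → h ℕ.* ℓ ℕ.* (h ℕ.* ℓ)) (sym H≡)))) ⟩
      nat (H ℕ.* ℓ ℕ.* (H ℕ.* ℓ)) * P ≡⟨ cong (_* P) (nat-* (H ℕ.* ℓ) (H ℕ.* ℓ)) ⟩
      t * t * P ≡⟨ scale superE (t * t) (indℚ ∘ devHigh) ⟨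
      E superE (λ S → t * t * indℚ (devHigh S)) ≤⟨ mono superE (λ S → indℚ-markov (devHigh S) (square-≥0 (total dev S)) (T-does-< (t * t) (total dev S * total dev S))) ⟩
      E superE (λ S → total dev S * total dev S) ≤⟨ second-moment blockE J dev dev-mean dev-square ⟩
      nat J * (nat ℓ * nat ℓ) ≡⟨ cong (nat J *_) (sym (nat-* ℓ ℓ)) ⟩
      nat J * nat (ℓ ℕ.* ℓ) ≡⟨ sym (nat-* J (ℓ ℕ.* ℓ)) ⟩
      nat (J ℕ.* (ℓ ℕ.* ℓ)) ≡⟨ sym (*-identityʳ (nat (J ℕ.* (ℓ ℕ.* ℓ)))) ⟩
      nat (J ℕ.* (ℓ ℕ.* ℓ)) * 1ℚ ∎)
      where
      open ≤-Reasoning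
      P = E superE (indℚ ∘ devHigh)
      arith : ∀ G s l → (G ℕ.* s ℕ.* s) ℕ.* (l ℕ.* l) ℕ.* G ≡ (G ℕ.* s) ℕ.* l ℕ.* ((G ℕ.* s) ℕ.* l)
      arith = ℕRing.solve-∀

    unkHigh-rare : nat G * E superE (indℚ ∘ unkHigh) ≤ 1ℚ
    unkHigh-rare = *-cancel {t} (nat->0 (ℕ.*-mono-< 0<H 0<ℓ)) (begin
      t * (nat G * P) ≡⟨ swap t (nat G) P ⟩
      nat G * (t * P) ≤⟨ *-monoˡ (nat-≥0 G) (≤-trans (≤-reflexive (sym (scale superE t (indℚ ∘ unkHigh)))) (≤-trans
                                                 (mono superE (λ S → indℚ-markov (unkHigh S) (total-≥0 unkB (λ B → nat-≥0 (unknownCount (toList B))) S) (T-does-< t (total unkB S))))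
                                                 (≤-reflexive (E-total blockE J unkB)))) ⟩
      nat G * (nat J * υ ℓ) ≡⟨ cong (λ k → nat G * (k * υ ℓ)) (trans (cong nat J≡) (nat-* H s)) ⟩
      nat G * (nat H * nat s * υ ℓ) ≡⟨ regroup (nat G) (nat H) (nat s) (υ ℓ) ⟩
      nat H * (nat G * nat s * υ ℓ) ≡⟨ cong (λ k → nat H * (k * υ ℓ)) (trans (sym (nat-* G s)) (cong nat (sym H≡))) ⟩
      nat H * (nat H * υ ℓ) ≤⟨ *-monoˡ (nat-≥0 H) (subst (λ k → nat H * υ k ≤ nat k) (sym ℓ≡) (υ-bound H)) ⟩
      nat H * nat ℓ ≡⟨ sym (nat-* H ℓ) ⟩
      t ≡⟨ sym (*-identityʳ t) ⟩
      t * 1ℚ ∎)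
      where
      open ≤-Reasoning
      P = E superE (indℚ ∘ unkHigh)
      swap : ∀ a b c → a * (b * c) ≡ b * (a * c)
      swap = solve-∀ ℚ-ring
      regroup : ∀ g h s u → g * (h * s * u) ≡ h * (g * s * u)
      regroup = solve-∀ ℚ-ring

    bad-rare : nat (4 ℕ.^ s) * E superE (indℚ ∘ bad) ≤ 1ℚ
    bad-rare = *-cancel {1ℚ + 1ℚ} (positive⁻¹ (1ℚ + 1ℚ)) (begin
      (1ℚ + 1ℚ) * (nat (4 ℕ.^ s) * P) ≡⟨ sym (*-assoc (1ℚ + 1ℚ) (nat (4 ℕ.^ s)) P) ⟩
      (1ℚ + 1ℚ) * nat (4 ℕ.^ s) * P ≡⟨ cong (_* P) (trans (cong (_* nat (4 ℕ.^ s)) (sym nat-2)) (trans (sym (nat-* 2 (4 ℕ.^ s))) (cong nat (sym G≡)))) ⟩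
      nat G * P ≤⟨ *-monoˡ (nat-≥0 G) (≤-trans (mono superE (λ S → indℚ-∨ (devHigh S) (unkHigh S))) (≤-reflexive (add superE (indℚ ∘ devHigh) (indℚ ∘ unkHigh)))) ⟩
      nat G * (P₁ + P₂) ≡⟨ *-distribˡ-+ (nat G) P₁ P₂ ⟩
      nat G * P₁ + nat G * P₂ ≤⟨ +-mono-≤ devHigh-rare unkHigh-rare ⟩
      1ℚ + 1ℚ ≡⟨ sym (*-identityʳ (1ℚ + 1ℚ)) ⟩
      (1ℚ + 1ℚ) * 1ℚ ∎)
      where
      open ≤-Reasoning
      P = E superE (indℚ ∘ bad)
      P₁ = E superE (indℚ ∘ devHigh)
      P₂ = E superE (indℚ ∘ unkHigh)

    good-bounds : ∀ S → bad S ≡ false → - t ≤ total dev S × total dev S ≤ t × total unkB S ≤ t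
    good-bounds S eq = neg-root-≤ t≥0 small , root-≤ t≥0 small , ≮⇒≥ (does-false (t <? total unkB S) (proj₂ both))
      where
      both = ∨-false (devHigh S) (unkHigh S) eq
      small : total dev S * total dev S ≤ t * t
      small = ≮⇒≥ (does-false (t * t <? total dev S * total dev S) (proj₁ both))

    Jμ : ℚ
    Jμ = nat J * μ ℓ

    Jℓ : ℚ
    Jℓ = nat J * nat ℓ

    Jμ-≥0 : 0ℚ ≤ Jμ
    Jμ-≥0 = *-≥0 (nat-≥0 J) μ-≥0

    -- A good superblock is within `t` of its mean; a bad one is charged its whole length `Jℓ`,
    -- which covers the trivial bound 0.
    super-lower-case : ∀ S b → bad S ≡ b → Jμ - t - indℚ b * Jℓ ≤ total isoB S
    super-lower-case S false eq = ≤-from-diff (subst (0ℚ ≤_)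
        (trans (cong (λ x → x - - t) (total-shift isoB (μ ℓ) S)) (arith (total isoB S) Jμ t Jℓ))
        (diff-≥0 (proj₁ (good-bounds S eq))))
      where
      arith : ∀ i m t l → (i - m) - - t ≡ i - (m - t - 0ℚ * l)
      arith = solve-∀ ℚ-ring
    super-lower-case S true _ = ≤-trans
      (≤-by (Jℓ - Jμ + t) (+-≥0 (diff-≥0 (*-monoˡ (nat-≥0 J) μ-≤)) t≥0) (arith Jμ t Jℓ))
      (total-≥0 isoB (λ B → nat-≥0 (isoCount (toList B))) S)
      where
      arith : ∀ m t l → (m - t - 1ℚ * l) + (l - m + t) ≡ 0ℚ
      arith = solve-∀ ℚ-ring

    -- The second `t` is for the letters undecided at the end of their block, which later letters
    -- may turn into isolated ones; in a bad superblock both counts are bounded by its length.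
    super-upper-case : ∀ S b → bad S ≡ b → total isoB S + total unkB S ≤ Jμ + (t + t) + indℚ b * (Jℓ + Jℓ)
    super-upper-case S false eq = ≤-from-diff (subst (0ℚ ≤_)
        (trans (cong (λ x → (t - x) + (t - total unkB S)) (total-shift isoB (μ ℓ) S)) (arith (total isoB S) (total unkB S) Jμ t Jℓ))
        (+-≥0 (diff-≥0 (proj₁ (proj₂ (good-bounds S eq)))) (diff-≥0 (proj₂ (proj₂ (good-bounds S eq))))))
      where
      arith : ∀ i v m t l → (t - (i - m)) + (t - v) ≡ m + (t + t) + 0ℚ * (l + l) - (i + v)
      arith = solve-∀ ℚ-ring
    super-upper-case S true _ = ≤-trans (+-mono-≤ (total-mono isoB isoB-≤ S) (total-mono unkB unkB-≤ S))
      (≤-by (Jμ + (t + t)) (+-≥0 Jμ-≥0 (+-≥0 t≥0 t≥0)) (arith Jμ t Jℓ))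
      where
      arith : ∀ m t l → (l + l) + (m + (t + t)) ≡ m + (t + t) + 1ℚ * (l + l)
      arith = solve-∀ ℚ-ring

    super-lower : ∀ S → Jμ - t - indℚ (bad S) * Jℓ ≤ total isoB S
    super-lower S = super-lower-case S (bad S) refl

    super-upper : ∀ S → total isoB S + total unkB S ≤ Jμ + (t + t) + indℚ (bad S) * (Jℓ + Jℓ)
    super-upper S = super-upper-case S (bad S) refl

    superWord : Super → List Letter
    superWord = flat toList

    flat-lower : ∀ {k} (S : Vec Block k) r → total isoB S + nat (isoCount r) ≤ nat (isoCount (flat toList S ++ r))
    flat-lower []      r = ≤-reflexive (+-identityˡ (nat (isoCount r)))
    flat-lower (B ∷ S) r = begin
      isoB B + total isoB S + nat (isoCount r) ≡⟨ +-assoc (isoB B) (total isoB S) (nat (isoCount r)) ⟩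
      isoB B + (total isoB S + nat (isoCount r)) ≤⟨ +-monoʳ-≤ (isoB B) (flat-lower S r) ⟩
      isoB B + nat (isoCount (flat toList S ++ r)) ≡⟨ nat-+ (isoCount (toList B)) (isoCount (flat toList S ++ r)) ⟨
      nat (isoCount (toList B) ℕ.+ isoCount (flat toList S ++ r)) ≤⟨ nat-mono-≤ (isoCount-++-≥ (toList B) (flat toList S ++ r)) ⟩
      nat (isoCount (toList B ++ flat toList S ++ r)) ≡⟨ cong (nat ∘ isoCount) (++-assoc (toList B) (flat toList S) r) ⟨
      nat (isoCount ((toList B ++ flat toList S) ++ r)) ∎
      where open ≤-Reasoning

    flat-upper : ∀ {k} (S : Vec Block k) r → nat (isoCount (flat toList S ++ r)) ≤ total isoB S + total unkB S + nat (isoCount r)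
    flat-upper []      r = ≤-reflexive (sym (+-identityˡ (nat (isoCount r))))
    flat-upper (B ∷ S) r = begin
      nat (isoCount ((toList B ++ flat toList S) ++ r)) ≡⟨ cong (nat ∘ isoCount) (++-assoc (toList B) (flat toList S) r) ⟩
      nat (isoCount (toList B ++ flat toList S ++ r)) ≤⟨ nat-mono-≤ (isoCount-++-≤ (toList B) (flat toList S ++ r)) ⟩
      nat (isoCount (toList B) ℕ.+ unknownCount (toList B) ℕ.+ isoCount (flat toList S ++ r))
        ≡⟨ trans (nat-+ (isoCount (toList B) ℕ.+ unknownCount (toList B)) (isoCount (flat toList S ++ r))) (cong (_+ nat (isoCount (flat toList S ++ r))) (nat-+ (isoCount (toList B)) (unknownCount (toList B)))) ⟩
      isoB B + unkB B + nat (isoCount (flat toList S ++ r)) ≤⟨ +-monoʳ-≤ (isoB B + unkB B) (flat-upper S r) ⟩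
      isoB B + unkB B + (total isoB S + total unkB S + nat (isoCount r)) ≡⟨ arith (isoB B) (unkB B) (total isoB S) (total unkB S) (nat (isoCount r)) ⟩
      isoB B + total isoB S + (unkB B + total unkB S) + nat (isoCount r) ∎
      where
      open ≤-Reasoning
      arith : ∀ a b c d e → a + b + (c + d + e) ≡ a + c + (b + d) + e
      arith = solve-∀ ℚ-ring

    all-lower : ∀ {k} (v : Vec Super k) r →
      nat k * (Jμ - t) - nat (countV bad v) * Jℓ ≤ nat (isoCount (flat superWord v ++ r))
    all-lower []      r = ≤-trans (≤-reflexive (trans (cong (λ x → x * (Jμ - t) - x * Jℓ) nat-0) (arith (Jμ - t) Jℓ))) (nat-≥0 (isoCount r))
      where
      arith : ∀ a b → 0ℚ * a - 0ℚ * b ≡ 0ℚ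
      arith = solve-∀ ℚ-ring
    all-lower (_∷_ {n = k} S v) r = begin
      nat (suc k) * (Jμ - t) - nat (countV bad (S ∷ v)) * Jℓ ≡⟨ cong₂ (λ x y → x * (Jμ - t) - y * Jℓ) (nat-suc k) (countV-cons bad S v) ⟩
      (1ℚ + nat k) * (Jμ - t) - (indℚ (bad S) + nat (countV bad v)) * Jℓ ≡⟨ arith (nat k) (Jμ - t) (indℚ (bad S)) (nat (countV bad v)) Jℓ ⟩
      (Jμ - t - indℚ (bad S) * Jℓ) + (nat k * (Jμ - t) - nat (countV bad v) * Jℓ) ≤⟨ +-mono-≤ (super-lower S) (all-lower v r) ⟩
      total isoB S + nat (isoCount (flat superWord v ++ r)) ≤⟨ flat-lower S (flat superWord v ++ r) ⟩
      nat (isoCount (superWord S ++ flat superWord v ++ r)) ≡⟨ cong (nat ∘ isoCount) (++-assoc (superWord S) (flat superWord v) r) ⟨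
      nat (isoCount ((superWord S ++ flat superWord v) ++ r)) ∎
      where
      open ≤-Reasoning
      arith : ∀ k m i c l → (1ℚ + k) * m - (i + c) * l ≡ (m - i * l) + (k * m - c * l)
      arith = solve-∀ ℚ-ring

    all-upper : ∀ {k} (v : Vec Super k) r →
      nat (isoCount (flat superWord v ++ r)) ≤ nat k * (Jμ + (t + t)) + nat (countV bad v) * (Jℓ + Jℓ) + nat (isoCount r)
    all-upper []      r = ≤-reflexive (sym (trans (cong (λ x → x * (Jμ + (t + t)) + x * (Jℓ + Jℓ) + nat (isoCount r)) nat-0) (arith (Jμ + (t + t)) (Jℓ + Jℓ) (nat (isoCount r)))))
      where
      arith : ∀ a b c → 0ℚ * a + 0ℚ * b + c ≡ c
      arith = solve-∀ ℚ-ring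
    all-upper (_∷_ {n = k} S v) r = begin
      nat (isoCount ((superWord S ++ flat superWord v) ++ r)) ≡⟨ cong (nat ∘ isoCount) (++-assoc (superWord S) (flat superWord v) r) ⟩
      nat (isoCount (superWord S ++ flat superWord v ++ r)) ≤⟨ flat-upper S (flat superWord v ++ r) ⟩
      total isoB S + total unkB S + nat (isoCount (flat superWord v ++ r)) ≤⟨ +-mono-≤ (super-upper S) (all-upper v r) ⟩
      (Jμ + (t + t) + indℚ (bad S) * (Jℓ + Jℓ)) + (nat k * (Jμ + (t + t)) + nat (countV bad v) * (Jℓ + Jℓ) + nat (isoCount r))
        ≡⟨ arith (nat k) (Jμ + (t + t)) (indℚ (bad S)) (nat (countV bad v)) (Jℓ + Jℓ) (nat (isoCount r)) ⟩
      (1ℚ + nat k) * (Jμ + (t + t)) + (indℚ (bad S) + nat (countV bad v)) * (Jℓ + Jℓ) + nat (isoCount r)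
        ≡⟨ cong₂ (λ x y → x * (Jμ + (t + t)) + y * (Jℓ + Jℓ) + nat (isoCount r)) (sym (nat-suc k)) (sym (countV-cons bad S v)) ⟩
      nat (suc k) * (Jμ + (t + t)) + nat (countV bad (S ∷ v)) * (Jℓ + Jℓ) + nat (isoCount r) ∎
      where
      open ≤-Reasoning
      arith : ∀ k m i c l r → (m + i * l) + (k * m + c * l + r) ≡ (1ℚ + k) * m + (i + c) * l + r
      arith = solve-∀ ℚ-ring

    many : ∀ {k} → Vec Super k → Bool
    many = many-bad superE bad s bad-rare

    -- J ℓ = s t, so a 1/s fraction of bad superblocks costs as much as one t per superblock
    bad-cost : ∀ {k} (v : Vec Super k) → many v ≡ false → nat (countV bad v) * Jℓ ≤ nat k * t
    bad-cost {k} v eq = begin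
      nat (countV bad v) * (nat J * nat ℓ) ≡⟨ cong (nat (countV bad v) *_) (sym (nat-* J ℓ)) ⟩
      nat (countV bad v) * nat (J ℕ.* ℓ) ≡⟨ sym (nat-* (countV bad v) (J ℕ.* ℓ)) ⟩
      nat (countV bad v ℕ.* (J ℕ.* ℓ)) ≡⟨ cong (λ j → nat (countV bad v ℕ.* (j ℕ.* ℓ))) J≡ ⟩
      nat (countV bad v ℕ.* (H ℕ.* s ℕ.* ℓ)) ≡⟨ cong nat (arith (countV bad v) H s ℓ) ⟩
      nat (s ℕ.* countV bad v ℕ.* (H ℕ.* ℓ)) ≤⟨ nat-mono-≤ (ℕ.*-monoˡ-≤ (H ℕ.* ℓ) few) ⟩
      nat (k ℕ.* (H ℕ.* ℓ)) ≡⟨ nat-* k (H ℕ.* ℓ) ⟩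
      nat k * t ∎
      where
      open ≤-Reasoning
      arith : ∀ c h s l → c ℕ.* (h ℕ.* s ℕ.* l) ≡ s ℕ.* c ℕ.* (h ℕ.* l)
      arith = ℕRing.solve-∀
      few : s ℕ.* countV bad v ℕ.≤ k
      few = ℕ.<⇒≤ (ℕ.≰⇒> (λ le → subst T eq (ℕ.≤⇒≤ᵇ le)))

    density : ℚ
    density = μ ℓ * recip ℓ

    nonZero-ℓ : ℕ.NonZero ℓ
    nonZero-ℓ = ℕ.>-nonZero 0<ℓ

    ℓ-density : nat ℓ * density ≡ μ ℓ
    ℓ-density = trans (swap (nat ℓ) (μ ℓ) (recip ℓ)) (trans (cong (_* μ ℓ) (nat-recip ℓ {{nonZero-ℓ}})) (*-identityˡ (μ ℓ)))
      where
      swap : ∀ a b c → a * (b * c) ≡ a * c * b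
      swap = solve-∀ ℚ-ring

    density-≥0 : 0ℚ ≤ density
    density-≥0 = *-cancel {nat ℓ} (nat->0 0<ℓ) (subst₂ _≤_ (sym (*-zeroʳ (nat ℓ))) (sym ℓ-density) μ-≥0)

    density-≤1 : density ≤ 1ℚ
    density-≤1 = *-cancel {nat ℓ} (nat->0 0<ℓ) (subst₂ _≤_ (sym ℓ-density) (sym (*-identityʳ (nat ℓ))) μ-≤)

    Jμ≡ : Jμ ≡ nat Λ * density
    Jμ≡ = trans (cong (nat J *_) (sym ℓ-density)) (trans (sym (*-assoc (nat J) (nat ℓ) density)) (cong (_* density) (trans (sym (nat-* J ℓ)) (cong nat (sym Λ≡)))))

    st≡Λ : nat s * t ≡ nat Λ
    st≡Λ = trans (sym (nat-* s (H ℕ.* ℓ))) (cong nat (trans (arith s H ℓ) (trans (cong (ℕ._* ℓ) (sym J≡)) (sym Λ≡))))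
      where
      arith : ∀ s h l → s ℕ.* (h ℕ.* l) ≡ (h ℕ.* s) ℕ.* l
      arith = ℕRing.solve-∀

    module _ (K r : ℕ) where

      N : ℕ
      N = K ℕ.* Λ ℕ.+ r

      -- The allowed error times `s`. There are four errors of `t` per superblock, for deviation,
      -- undecided letters and twice for bad superblocks; as st = Λ they cost 4KΛ, at most 4N. Each
      -- of the `r` leftover letters costs at most one.
      tolerance : ℚ
      tolerance = nat (4 ℕ.* N ℕ.+ s ℕ.* r)

      Near : ℚ → Set
      Near x = nat s * (x - nat N * density) ≤ tolerance × nat s * (nat N * density - x) ≤ tolerance

      -- A function of the count alone, so that one event serves both for uniform words and for
      -- outcomes.
      farValue : ℕ → Bool
      farValue x = not (does (nat s * (nat x - nat N * density) ≤? tolerance) ∧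
                        does (nat s * (nat N * density - nat x) ≤? tolerance))

      far : List Letter → Bool
      far w = farValue (isoCount w)

      not-far⇒near : ∀ x → farValue x ≡ false → Near (nat x)
      not-far⇒near x eq with not-∧-false _ _ eq
      ... | p , q = does-true (nat s * (nat x - nat N * density) ≤? tolerance) p
                  , does-true (nat s * (nat N * density - nat x) ≤? tolerance) q

      near⇒not-far : ∀ x → Near (nat x) → farValue x ≡ false
      near⇒not-far x (p , q) = cong not (cong₂ _∧_
        (dec-true (nat s * (nat x - nat N * density) ≤? tolerance) p)
        (dec-true (nat s * (nat N * density - nat x) ≤? tolerance) q))

      nat-N : nat N ≡ nat K * nat Λ + nat r
      nat-N = trans (nat-+ (K ℕ.* Λ) r) (cong (_+ nat r) (nat-* K Λ))

      tolerance≡ : tolerance ≡ nat 4 * (nat K * nat Λ + nat r) + nat s * nat r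
      tolerance≡ = trans (nat-+ (4 ℕ.* N) (s ℕ.* r)) (cong₂ _+_ (trans (nat-* 4 N) (cong (nat 4 *_) nat-N)) (nat-* s r))

      near-from : ∀ x → nat K * (Jμ - t) - nat K * t ≤ x → x ≤ nat K * (Jμ + (t + t)) + (nat K * t + nat K * t) + nat r → Near x
      near-from x lo hi = upper , lower
        where
        k = nat K
        S = nat s
        m = density
        R = nat r
        rm≤r : R * m ≤ R
        rm≤r = subst (R * m ≤_) (*-identityʳ R) (*-monoˡ (nat-≥0 r) density-≤1)
        upper : S * (x - nat N * m) ≤ tolerance
        upper = begin
          S * (x - nat N * m) ≤⟨ *-monoˡ (nat-≥0 s) (+-monoˡ-≤ (- (nat N * m)) hi) ⟩
          S * (k * (Jμ + (t + t)) + (k * t + k * t) + R - nat N * m) ≡⟨ cong₂ (λ a b → S * (k * (a + (t + t)) + (k * t + k * t) + R - b * m)) Jμ≡ nat-N ⟩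
          S * (k * (nat Λ * m + (t + t)) + (k * t + k * t) + R - (k * nat Λ + R) * m) ≡⟨ arith S k (nat Λ) m t R ⟩
          k * (S * t) + k * (S * t) + k * (S * t) + k * (S * t) + S * R - S * (R * m) ≡⟨ cong (λ z → k * z + k * z + k * z + k * z + S * R - S * (R * m)) st≡Λ ⟩
          k * nat Λ + k * nat Λ + k * nat Λ + k * nat Λ + S * R - S * (R * m)
            ≤⟨ ≤-by (S * (R * m) + toℚ 4 * R) (+-≥0 (*-≥0 (nat-≥0 s) (*-≥0 (nat-≥0 r) density-≥0)) (*-≥0 (nonNegative⁻¹ (toℚ 4)) (nat-≥0 r))) (arith₂ k (nat Λ) S R (S * (R * m))) ⟩
          toℚ 4 * (k * nat Λ + R) + S * R ≡⟨ cong (λ z → z * (k * nat Λ + R) + S * R) (sym (nat≡toℚ 4)) ⟩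
          nat 4 * (k * nat Λ + R) + S * R ≡⟨ sym tolerance≡ ⟩
          tolerance ∎
          where
          open ≤-Reasoning
          arith : ∀ S k L m t R → S * (k * (L * m + (t + t)) + (k * t + k * t) + R - (k * L + R) * m) ≡
            k * (S * t) + k * (S * t) + k * (S * t) + k * (S * t) + S * R - S * (R * m)
          arith = solve-∀ ℚ-ring
          arith₂ : ∀ k L S R z → k * L + k * L + k * L + k * L + S * R - z + (z + ((1ℚ + 1ℚ) * (1ℚ + 1ℚ)) * R) ≡ ((1ℚ + 1ℚ) * (1ℚ + 1ℚ)) * (k * L + R) + S * R
          arith₂ = solve-∀ ℚ-ring
        lower : S * (nat N * m - x) ≤ tolerance
        lower = begin
          S * (nat N * m - x) ≤⟨ *-monoˡ (nat-≥0 s) (+-monoʳ-≤ (nat N * m) (neg-antimono-≤ lo)) ⟩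
          S * (nat N * m - (k * (Jμ - t) - k * t)) ≡⟨ cong₂ (λ a b → S * (b * m - (k * (a - t) - k * t))) Jμ≡ nat-N ⟩
          S * ((k * nat Λ + R) * m - (k * (nat Λ * m - t) - k * t)) ≡⟨ arith S k (nat Λ) m t R ⟩
          k * (S * t) + k * (S * t) + S * (R * m) ≡⟨ cong (λ z → k * z + k * z + S * (R * m)) st≡Λ ⟩
          k * nat Λ + k * nat Λ + S * (R * m) ≤⟨ +-monoʳ-≤ (k * nat Λ + k * nat Λ) (*-monoˡ (nat-≥0 s) rm≤r) ⟩
          k * nat Λ + k * nat Λ + S * R
            ≤⟨ ≤-by (k * nat Λ + k * nat Λ + toℚ 4 * R) (+-≥0 (+-≥0 kΛ kΛ) (*-≥0 (nonNegative⁻¹ (toℚ 4)) (nat-≥0 r))) (arith₂ k (nat Λ) S R) ⟩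
          toℚ 4 * (k * nat Λ + R) + S * R ≡⟨ cong (λ z → z * (k * nat Λ + R) + S * R) (sym (nat≡toℚ 4)) ⟩
          nat 4 * (k * nat Λ + R) + S * R ≡⟨ sym tolerance≡ ⟩
          tolerance ∎
          where
          open ≤-Reasoning
          kΛ : 0ℚ ≤ k * nat Λ
          kΛ = *-≥0 (nat-≥0 K) (nat-≥0 Λ)
          arith : ∀ S k L m t R → S * ((k * L + R) * m - (k * (L * m - t) - k * t)) ≡ k * (S * t) + k * (S * t) + S * (R * m)
          arith = solve-∀ ℚ-ring
          arith₂ : ∀ k L S R → k * L + k * L + S * R + (k * L + k * L + ((1ℚ + 1ℚ) * (1ℚ + 1ℚ)) * R) ≡ ((1ℚ + 1ℚ) * (1ℚ + 1ℚ)) * (k * L + R) + S * R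
          arith₂ = solve-∀ ℚ-ring

      few-bad⇒not-far : ∀ (v : Vec Super K) (u : Vec Letter r) → many v ≡ false → far (flat superWord v ++ toList u) ≡ false
      few-bad⇒not-far v u eq = near⇒not-far (isoCount (flat superWord v ++ toList u)) (near-from _
        (≤-trans (+-monoʳ-≤ (nat K * (Jμ - t)) (neg-antimono-≤ (bad-cost v eq))) (all-lower v (toList u)))
        (≤-trans (all-upper v (toList u)) (+-mono-≤ (+-monoʳ-≤ (nat K * (Jμ + (t + t)))
          (≤-trans (≤-reflexive (*-distribˡ-+ (nat (countV bad v)) Jℓ Jℓ)) (+-mono-≤ (bad-cost v eq) (bad-cost v eq))))
          (nat-mono-≤ (subst (isoCount (toList u) ℕ.≤_) (length-toList u) (isoCount-≤ (toList u)))))))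

      far-≤-many : ∀ (v : Vec Super K) (u : Vec Letter r) b → many v ≡ b → indℚ (far (flat superWord v ++ toList u)) ≤ indℚ b
      far-≤-many v u false eq = ≤-reflexive (cong indℚ (few-bad⇒not-far v u eq))
      far-≤-many v u true  _  = indℚ-≤1 (far (flat superWord v ++ toList u))

      -- The uniform word is read as `K` independent superblocks followed by `r` letters; by
      -- `few-bad⇒not-far` the count can be far only if many superblocks are bad, whatever the last
      -- letters are.
      far-rare : nat (2 ℕ.^ K) * 𝔼 N (indℚ ∘ far) ≤ 1ℚ
      far-rare = begin
        nat (2 ℕ.^ K) * 𝔼 N (indℚ ∘ far) ≡⟨ cong (nat (2 ℕ.^ K) *_) (trans (𝔼-++ (K ℕ.* Λ) r (indℚ ∘ far))
          (𝔼-flat superE superWord Λ (λ F → trans (cong (λ k → 𝔼 k F) Λ≡) (𝔼-flat blockE toList ℓ (λ F → refl) J F)) K (λ u → 𝔼 r (λ v → indℚ (far (u ++ v)))))) ⟩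
        nat (2 ℕ.^ K) * E (power superE K) (λ v → 𝔼 r (λ u → indℚ (far (flat superWord v ++ u))))
          ≤⟨ *-monoˡ (nat-≥0 (2 ℕ.^ K)) (mono (power superE K) (λ v → ≤-trans (mono (words r) (λ u → far-≤-many v u (many v) refl)) (≤-reflexive (const (words r) (indℚ (many v)))))) ⟩
        nat (2 ℕ.^ K) * E (power superE K) (indℚ ∘ many) ≤⟨ many-bad-rare superE bad s bad-rare K ⟩
        1ℚ ∎
        where open ≤-Reasoning

-- Comparing the law of outcomes with the uniform law on words.

module LawDomination where

  open Matchings using (∈-concatMap-elim)
  open Scanning
  open Outcomes
  open CatalanNumbers using (bound; matchings-lower-bound)
  open Expectations
  open Excursions
  open import Data.Nat as ℕ using (ℕ; zero; suc; z≤n; s≤s; _∸_)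
  import Data.Nat.Properties as ℕ
  import Data.Nat.Tactic.RingSolver as ℕRing
  open import Data.Rational
  open import Data.Rational.Properties
  open import Tactic.RingSolver using (solve-∀)

  open Expectation

  mass : ∀ {A : Set} → List (ℚ × A) → ℚ
  mass Ω = sumℚ (map proj₁ Ω)

  mass-++ : ∀ {A : Set} (Ω Ω′ : List (ℚ × A)) → mass (Ω ++ Ω′) ≡ mass Ω + mass Ω′
  mass-++ []            Ω′ = sym (+-identityˡ (mass Ω′))
  mass-++ ((w , _) ∷ Ω) Ω′ = trans (cong (w +_) (mass-++ Ω Ω′)) (sym (+-assoc w (mass Ω) (mass Ω′)))

  mass-constant : ∀ {A : Set} (Ω : List (ℚ × A)) w → (∀ {p} → p ∈ Ω → proj₁ p ≡ w) → mass Ω ≡ nat (length Ω) * w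
  mass-constant []      w h = sym (trans (cong (_* w) nat-0) (*-zeroˡ w))
  mass-constant (p ∷ Ω) w h = trans (cong₂ _+_ (h (here refl)) (mass-constant Ω w (h ∘ there)))
    (nat-suc-* (length Ω) w)

  mass-concatMap : ∀ {A B : Set} (f : B → List (ℚ × A)) xs v → (∀ {x} → x ∈ xs → mass (f x) ≡ v) →
    mass (concatMap f xs) ≡ nat (length xs) * v
  mass-concatMap f []       v h = sym (trans (cong (_* v) nat-0) (*-zeroˡ v))
  mass-concatMap f (x ∷ xs) v h = trans (mass-++ (f x) (concatMap f xs))
    (trans (cong₂ _+_ (h (here refl)) (mass-concatMap f xs v (h ∘ there)))
    (nat-suc-* (length xs) v))

  weightOf-split : ∀ {A : Set} (Ω : List (ℚ × A)) (b : A → Bool) → weightOf Ω (not ∘ b) + weightOf Ω b ≡ mass Ω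
  weightOf-split []            b = refl
  weightOf-split ((w , o) ∷ Ω) b with b o
  ... | true  = trans (arith (weightOf Ω (not ∘ b)) w (weightOf Ω b)) (cong (w +_) (weightOf-split Ω b))
    where
    arith : ∀ x w y → x + (w + y) ≡ w + (x + y)
    arith = solve-∀ ℚ-ring
  ... | false = trans (+-assoc w (weightOf Ω (not ∘ b)) (weightOf Ω b)) (cong (w +_) (weightOf-split Ω b))

  weightOf-cong : ∀ {A : Set} (Ω : List (ℚ × A)) {b c : A → Bool} → (∀ {p} → p ∈ Ω → b (proj₂ p) ≡ c (proj₂ p)) →
    weightOf Ω b ≡ weightOf Ω c
  weightOf-cong []            h = refl
  weightOf-cong ((w , o) ∷ Ω) {b} {c} h with b o | c o | h (here refl)
  ... | true  | .true  | refl = cong (w +_) (weightOf-cong Ω (h ∘ there))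
  ... | false | .false | refl = weightOf-cong Ω (h ∘ there)

  weightOf-≥0 : ∀ {A : Set} (Ω : List (ℚ × A)) b → (∀ {p} → p ∈ Ω → 0ℚ ≤ proj₁ p) → 0ℚ ≤ weightOf Ω b
  weightOf-≥0 []            b h = ≤-refl
  weightOf-≥0 ((w , o) ∷ Ω) b h with b o
  ... | true  = +-≥0 (h (here refl)) (weightOf-≥0 Ω b (h ∘ there))
  ... | false = weightOf-≥0 Ω b (h ∘ there)

  weightOf-≤ : ∀ {A : Set} (Ω : List (ℚ × A)) (b : A → Bool) c W → (∀ {p} → p ∈ Ω → c * proj₁ p ≤ W) →
    c * weightOf Ω b ≤ nat (length (filterᵇ (b ∘ proj₂) Ω)) * W
  weightOf-≤ []            b c W h = ≤-reflexive (trans (*-zeroʳ c) (sym (trans (cong (_* W) nat-0) (*-zeroˡ W))))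
  weightOf-≤ ((w , o) ∷ Ω) b c W h with b o
  ... | true  = ≤-trans (≤-reflexive (*-distribˡ-+ c w (weightOf Ω b)))
    (≤-trans (+-mono-≤ (h (here refl)) (weightOf-≤ Ω b c W (h ∘ there)))
      (≤-reflexive (nat-suc-* (length (filterᵇ (b ∘ proj₂) Ω)) W)))
  ... | false = weightOf-≤ Ω b c W (h ∘ there)

  -- A deviation bound `a` that may be exceeded by `d` on a rare event passes to the mean, the
  -- excess being multiplied by the weight of the event. The total mass stays in the formula so that
  -- the induction can run over sublists.
  expectation-≤ : ∀ {A : Set} (Ω : List (ℚ × A)) (X : A → ℚ) (b : A → Bool) c g a d →
    (∀ {p} → p ∈ Ω → 0ℚ ≤ proj₁ p) → (∀ {p} → p ∈ Ω → c * (X (proj₂ p) - g) ≤ a + indℚ (b (proj₂ p)) * d) →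
    c * (expectation Ω X - g * mass Ω) ≤ a * mass Ω + d * weightOf Ω b
  expectation-≤ [] X b c g a d _ _ = ≤-reflexive (arith c g a d)
    where
    arith : ∀ c g a d → c * (0ℚ - g * 0ℚ) ≡ a * 0ℚ + d * 0ℚ
    arith = solve-∀ ℚ-ring
  expectation-≤ ((w , o) ∷ Ω) X b c g a d nn h with b o | h (here refl)
  ... | true | le = ≤-trans (≤-reflexive (arith₁ c w (X o) (expectation Ω X) g (mass Ω)))
    (≤-trans (+-mono-≤ (*-monoˡ (nn (here refl)) le) (expectation-≤ Ω X b c g a d (nn ∘ there) (h ∘ there)))
      (≤-reflexive (arith₂ a d w (mass Ω) (weightOf Ω b))))
    where
    arith₁ : ∀ c w x e g m → c * (w * x + e - g * (w + m)) ≡ w * (c * (x - g)) + c * (e - g * m)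
    arith₁ = solve-∀ ℚ-ring
    arith₂ : ∀ a d w m v → w * (a + 1ℚ * d) + (a * m + d * v) ≡ a * (w + m) + d * (w + v)
    arith₂ = solve-∀ ℚ-ring
  ... | false | le = ≤-trans (≤-reflexive (arith₁ c w (X o) (expectation Ω X) g (mass Ω)))
    (≤-trans (+-mono-≤ (*-monoˡ (nn (here refl)) le) (expectation-≤ Ω X b c g a d (nn ∘ there) (h ∘ there)))
      (≤-reflexive (arith₂ a d w (mass Ω) (weightOf Ω b))))
    where
    arith₁ : ∀ c w x e g m → c * (w * x + e - g * (w + m)) ≡ w * (c * (x - g)) + c * (e - g * m)
    arith₁ = solve-∀ ℚ-ring
    arith₂ : ∀ a d w m v → w * (a + 0ℚ * d) + (a * m + d * v) ≡ a * (w + m) + d * v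
    arith₂ = solve-∀ ℚ-ring

  length-filterᵇ-++ : ∀ {A : Set} (p : A → Bool) xs ys → length (filterᵇ p (xs ++ ys)) ≡ length (filterᵇ p xs) ℕ.+ length (filterᵇ p ys)
  length-filterᵇ-++ p []       ys = refl
  length-filterᵇ-++ p (x ∷ xs) ys with p x
  ... | true  = cong suc (length-filterᵇ-++ p xs ys)
  ... | false = length-filterᵇ-++ p xs ys

  length-filterᵇ-map : ∀ {A B : Set} (p : B → Bool) (f : A → B) xs → length (filterᵇ p (map f xs)) ≡ length (filterᵇ (p ∘ f) xs)
  length-filterᵇ-map p f []       = refl
  length-filterᵇ-map p f (x ∷ xs) with p (f x)
  ... | true  = cong suc (length-filterᵇ-map p f xs)
  ... | false = length-filterᵇ-map p f xs

  count-words : ∀ N (p : List Letter → Bool) → nat (length (filterᵇ p (allWords N))) ≡ nat (4 ℕ.^ N) * 𝔼 N (indℚ ∘ p)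
  count-words zero p with p []
  ... | true  = trans nat-1 (sym (trans (*-identityʳ (nat 1)) nat-1))
  ... | false = trans nat-0 (sym (*-zeroʳ (nat 1)))
  count-words (suc N) p = begin
    nat (length (filterᵇ p (ws tt ++ (ws tf ++ (ws ft ++ (ws ff ++ []))))))
      ≡⟨ trans (split (ws tt) (ws tf ++ (ws ft ++ (ws ff ++ [])))) (cong (nat (# (ws tt)) +_)
          (trans (split (ws tf) (ws ft ++ (ws ff ++ []))) (cong (nat (# (ws tf)) +_)
            (trans (split (ws ft) (ws ff ++ [])) (cong (nat (# (ws ft)) +_) (trans (split (ws ff) []) (cong (nat (# (ws ff)) +_) nat-0))))))) ⟩
    nat (# (ws tt)) + (nat (# (ws tf)) + (nat (# (ws ft)) + (nat (# (ws ff)) + 0ℚ)))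
      ≡⟨ cong₂ _+_ (each tt) (cong₂ _+_ (each tf) (cong₂ _+_ (each ft) (cong (_+ 0ℚ) (each ff)))) ⟩
    f * e tt + (f * e tf + (f * e ft + (f * e ff + 0ℚ)))
      ≡⟨ arith f (e tt) (e tf) (e ft) (e ff) ⟩
    toℚ 4 * f * (¼ * (e tt + e tf + e ft + e ff))
      ≡⟨ cong (_* (¼ * (e tt + e tf + e ft + e ff))) (trans (cong (_* f) (sym (nat≡toℚ 4))) (sym (nat-* 4 (4 ℕ.^ N)))) ⟩
    nat (4 ℕ.* 4 ℕ.^ N) * (¼ * (e tt + e tf + e ft + e ff)) ∎
    where
    open ≡-Reasoning
    tt tf ft ff : Letter
    tt = true , true
    tf = true , false
    ft = false , true
    ff = false , false
    f = nat (4 ℕ.^ N)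
    e : Letter → ℚ
    e l = 𝔼 N (λ w → indℚ (p (l ∷ w)))
    ws : Letter → List (List Letter)
    ws l = map (l ∷_) (allWords N)
    # : List (List Letter) → ℕ
    # xs = length (filterᵇ p xs)
    split : ∀ xs ys → nat (# (xs ++ ys)) ≡ nat (# xs) + nat (# ys)
    split xs ys = trans (cong nat (length-filterᵇ-++ p xs ys)) (nat-+ (# xs) (# ys))
    each : ∀ l → nat (# (ws l)) ≡ f * e l
    each l = trans (cong nat (length-filterᵇ-map p (l ∷_) (allWords N))) (count-words N (p ∘ (l ∷_)))
    arith : ∀ f a b c d → f * a + (f * b + (f * c + (f * d + 0ℚ))) ≡ ((1ℚ + 1ℚ) * (1ℚ + 1ℚ)) * f * (¼ * (a + b + c + d))
    arith = solve-∀ ℚ-ring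

  recip-≥0 : ∀ k → 0ℚ ≤ recip k
  recip-≥0 zero    = ≤-reflexive (sym (recip≡inv 0))
  recip-≥0 (suc k) = *-cancel {nat (suc k)} (nat->0 (s≤s z≤n))
    (subst₂ _≤_ (sym (*-zeroʳ (nat (suc k)))) (sym (nat-recip (suc k))) (nonNegative⁻¹ 1ℚ))

  length-allColourings : ∀ k → length (allColourings k) ≡ 2 ℕ.^ k
  length-allColourings zero    = refl
  length-allColourings (suc k) = trans (go (allColourings k)) (cong (2 ℕ.*_) (length-allColourings k))
    where
    go : ∀ cs → length (concatMap (λ bs → (true ∷ bs) ∷ (false ∷ bs) ∷ []) cs) ≡ 2 ℕ.* length cs
    go []       = refl
    go (c ∷ cs) = trans (cong (2 ℕ.+_) (go cs)) (sym (ℕ.*-distribˡ-+ 2 1 (length cs)))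

  length-concatMap-const : ∀ {A B : Set} (f : A → List B) xs k → (∀ x → length (f x) ≡ k) → length (concatMap f xs) ≡ length xs ℕ.* k
  length-concatMap-const f []       k h = refl
  length-concatMap-const f (x ∷ xs) k h = trans (length-++ (f x)) (cong₂ ℕ._+_ (h x) (length-concatMap-const f xs k h))

  module _ (n : ℕ) where

    private
      q : ℕ
      q = 2 ℕ.^ (2 ℕ.* suc n ∸ 1)

      reds blues : List Bool → ℕ
      reds c  = length (catalanMatchings (redPoints (suc n) c))
      blues c = length (catalanMatchings (bluePoints (suc n) c))

      b² : ℕ
      b² = bound (suc n) ℕ.* bound (suc n)

    weight≡ : ∀ c → weight (suc n) c ≡ recip q * (recip (reds c) * recip (blues c))
    weight≡ c = sym (cong₂ _*_ (recip≡inv q) (cong₂ _*_ (recip≡inv (reds c)) (recip≡inv (blues c))))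

    weight-≥0 : ∀ c → 0ℚ ≤ weight (suc n) c
    weight-≥0 c = subst (0ℚ ≤_) (sym (weight≡ c)) (*-≥0 (recip-≥0 q) (*-≥0 (recip-≥0 (reds c)) (recip-≥0 (blues c))))

    private
      -- Both lists of matchings are nonempty because the product of their lengths has a positive
      -- lower bound. This matters because `inv 0` is 0 and an empty list would destroy the
      -- normalisation.
      nonzero : ∀ {c} → c ∈ allColourings (2 ℕ.* suc n ∸ 1) → ℕ.NonZero (reds c) × ℕ.NonZero (blues c)
      nonzero {c} c∈ = ℕ.≢-nonZero (λ e → zero-product (trans (cong (ℕ._* blues c) e) refl))
                     , ℕ.≢-nonZero (λ e → zero-product (trans (cong (reds c ℕ.*_) e) (ℕ.*-zeroʳ (reds c))))
        where
        zero-product : reds c ℕ.* blues c ≢ 0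
        zero-product e = ℕ.<⇒≱ (ℕ.m^n>0 4 (suc n)) (ℕ.≤-trans (matchings-lower-bound n c∈)
          (ℕ.≤-reflexive (trans (cong (b² ℕ.*_) e) (ℕ.*-zeroʳ b²))))

    matchings-weight : ∀ {c} → c ∈ allColourings (2 ℕ.* suc n ∸ 1) →
      nat (reds c ℕ.* blues c) * weight (suc n) c ≡ recip q
    matchings-weight {c} c∈ = begin
      nat (reds c ℕ.* blues c) * weight (suc n) c
        ≡⟨ cong₂ _*_ (nat-* (reds c) (blues c)) (weight≡ c) ⟩
      nat (reds c) * nat (blues c) * (recip q * (recip (reds c) * recip (blues c)))
        ≡⟨ arith (nat (reds c)) (nat (blues c)) (recip q) (recip (reds c)) (recip (blues c)) ⟩
      nat (reds c) * recip (reds c) * (nat (blues c) * recip (blues c)) * recip q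
        ≡⟨ cong₂ (λ x y → x * y * recip q) (nat-recip (reds c) {{proj₁ (nonzero c∈)}}) (nat-recip (blues c) {{proj₂ (nonzero c∈)}}) ⟩
      1ℚ * 1ℚ * recip q
        ≡⟨ *-identityˡ (recip q) ⟩
      recip q ∎
      where
      open ≡-Reasoning
      arith : ∀ a b r x y → a * b * (r * (x * y)) ≡ a * x * (b * y) * r
      arith = solve-∀ ℚ-ring

    mass-outcomes : mass (outcomes (suc n)) ≡ 1ℚ
    mass-outcomes = begin
      mass (outcomes (suc n))
        ≡⟨ mass-concatMap (perColouring (suc n)) (allColourings (2 ℕ.* suc n ∸ 1)) (recip q) per ⟩
      nat (length (allColourings (2 ℕ.* suc n ∸ 1))) * recip q
        ≡⟨ cong (λ k → nat k * recip q) (length-allColourings (2 ℕ.* suc n ∸ 1)) ⟩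
      nat q * recip q
        ≡⟨ nat-recip q {{ℕ.m^n≢0 2 (2 ℕ.* suc n ∸ 1)}} ⟩
      1ℚ ∎
      where
      open ≡-Reasoning
      size : ∀ c → length (perColouring (suc n) c) ≡ reds c ℕ.* blues c
      size c = length-concatMap-const (λ mr → map (λ mb → weight (suc n) c , (c , mr , mb)) (catalanMatchings (bluePoints (suc n) c)))
        (catalanMatchings (redPoints (suc n) c)) (blues c)
        (λ mr → length-map (λ mb → weight (suc n) c , (c , mr , mb)) (catalanMatchings (bluePoints (suc n) c)))
      per : ∀ {c} → c ∈ allColourings (2 ℕ.* suc n ∸ 1) → mass (perColouring (suc n) c) ≡ recip q
      per {c} c∈ = trans (mass-constant (perColouring (suc n) c) (weight (suc n) c) (λ p∈ → proj₁ (perColouring-elim (suc n) c p∈)))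
        (trans (cong (λ k → nat k * weight (suc n) c) (size c)) (matchings-weight c∈))

    -- For n vertices, 4^(2n) is 4^n times 4^n. One factor is twice the number `q` of colourings,
    -- the other is at most `b²` times the number of pairs of matchings, and the weight is the
    -- reciprocal of `q` times that number.
    weight-≤ : ∀ {c} → c ∈ allColourings (2 ℕ.* suc n ∸ 1) → nat (4 ℕ.^ (2 ℕ.* suc n)) * weight (suc n) c ≤ nat (2 ℕ.* b²)
    weight-≤ {c} c∈ = begin
      nat (4 ℕ.^ (2 ℕ.* suc n)) * weight (suc n) c
        ≤⟨ *-monoʳ (weight-≥0 c) (nat-mono-≤ size) ⟩
      nat (2 ℕ.* b² ℕ.* q ℕ.* (reds c ℕ.* blues c)) * weight (suc n) c
        ≡⟨ cong (_* weight (suc n) c) (nat-* (2 ℕ.* b² ℕ.* q) (reds c ℕ.* blues c)) ⟩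
      nat (2 ℕ.* b² ℕ.* q) * nat (reds c ℕ.* blues c) * weight (suc n) c
        ≡⟨ *-assoc (nat (2 ℕ.* b² ℕ.* q)) (nat (reds c ℕ.* blues c)) (weight (suc n) c) ⟩
      nat (2 ℕ.* b² ℕ.* q) * (nat (reds c ℕ.* blues c) * weight (suc n) c)
        ≡⟨ cong₂ _*_ (nat-* (2 ℕ.* b²) q) (matchings-weight c∈) ⟩
      nat (2 ℕ.* b²) * nat q * recip q
        ≡⟨ trans (*-assoc (nat (2 ℕ.* b²)) (nat q) (recip q)) (cong (nat (2 ℕ.* b²) *_) (nat-recip q {{ℕ.m^n≢0 2 (2 ℕ.* suc n ∸ 1)}})) ⟩
      nat (2 ℕ.* b²) * 1ℚ
        ≡⟨ *-identityʳ (nat (2 ℕ.* b²)) ⟩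
      nat (2 ℕ.* b²) ∎
      where
      open ≤-Reasoning
      power-split : 4 ℕ.^ suc n ≡ 2 ℕ.* q
      power-split = trans (ℕ.^-*-assoc 2 2 (suc n)) refl
      arith : ∀ q b r → 2 ℕ.* q ℕ.* (b ℕ.* r) ≡ 2 ℕ.* b ℕ.* q ℕ.* r
      arith = ℕRing.solve-∀
      size : 4 ℕ.^ (2 ℕ.* suc n) ℕ.≤ 2 ℕ.* b² ℕ.* q ℕ.* (reds c ℕ.* blues c)
      size = ℕ.≤-trans (ℕ.≤-reflexive (trans (cong (4 ℕ.^_) (double (suc n))) (ℕ.^-distribˡ-+-* 4 (suc n) (suc n))))
        (ℕ.≤-trans (ℕ.*-mono-≤ (ℕ.≤-reflexive power-split) (matchings-lower-bound n c∈))
          (ℕ.≤-reflexive (arith q b² (reds c ℕ.* blues c))))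

    outcome-colouring : ∀ {p} → p ∈ outcomes (suc n) → proj₁ (proj₂ p) ∈ allColourings (2 ℕ.* suc n ∸ 1) × proj₁ p ≡ weight (suc n) (proj₁ (proj₂ p))
    outcome-colouring {w , c , mr , mb} p∈ = OutcomeData.c∈ d , OutcomeData.w≡ d
      where d = outcomes-elim (suc n) p∈

    -- Distinct outcomes have distinct words, so an event contains at most as many outcomes as
    -- words, and each outcome weighs at most `2 * b²` times a uniform word.
    law-domination : ∀ (p : List Letter → Bool) → weightOf (outcomes (suc n)) (p ∘ wordOf) ≤ nat (2 ℕ.* b²) * 𝔼 (2 ℕ.* suc n) (indℚ ∘ p)
    law-domination p = *-cancel {nat f} (nat->0 (ℕ.m^n>0 4 (2 ℕ.* suc n))) (begin
      nat f * weightOf (outcomes (suc n)) (p ∘ wordOf)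
        ≤⟨ weightOf-≤ (outcomes (suc n)) (p ∘ wordOf) (nat f) (nat (2 ℕ.* b²)) each ⟩
      nat (length (filterᵇ (λ o → p (wordOf (proj₂ o))) (outcomes (suc n)))) * nat (2 ℕ.* b²)
        ≤⟨ *-monoʳ (nat-≥0 (2 ℕ.* b²)) (nat-mono-≤ (count-outcomes-≤ n p)) ⟩
      nat (length (filterᵇ p (allWords (2 ℕ.* suc n)))) * nat (2 ℕ.* b²)
        ≡⟨ cong (_* nat (2 ℕ.* b²)) (count-words (2 ℕ.* suc n) p) ⟩
      nat f * e * nat (2 ℕ.* b²)
        ≡⟨ arith (nat f) e (nat (2 ℕ.* b²)) ⟩
      nat f * (nat (2 ℕ.* b²) * e) ∎)
      where
      open ≤-Reasoning
      f = 4 ℕ.^ (2 ℕ.* suc n)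
      e = 𝔼 (2 ℕ.* suc n) (indℚ ∘ p)
      arith : ∀ f e b → f * e * b ≡ f * (b * e)
      arith = solve-∀ ℚ-ring
      each : ∀ {o} → o ∈ outcomes (suc n) → nat f * proj₁ o ≤ nat (2 ℕ.* b²)
      each {o} o∈ = subst (λ w → nat f * w ≤ nat (2 ℕ.* b²)) (sym (proj₂ (outcome-colouring o∈))) (weight-≤ (proj₁ (outcome-colouring o∈)))

    outcome-isolated : ∀ {p} → p ∈ outcomes (suc n) → isolated (proj₂ p) ≡ isoCount (wordOf (proj₂ p))
    outcome-isolated {w , c , mr , mb} p∈ = isolated≡isoCount-word c (isOutcome (outcomes-elim (suc n) p∈))

    outcome-length : ∀ {p} → p ∈ outcomes (suc n) → length (wordOf (proj₂ p)) ≡ 2 ℕ.* suc n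
    outcome-length {w , c , mr , mb} p∈ = trans (length-wordFrom (map proj₁ (mr ++ mb)) 1 (fullColouring c))
      (length-fullColouring n (proj₁ (outcome-colouring p∈)))

    outcome-weight-≥0 : ∀ {p} → p ∈ outcomes (suc n) → 0ℚ ≤ proj₁ p
    outcome-weight-≥0 {w , c , o} p∈ = subst (0ℚ ≤_) (sym (proj₂ (outcome-colouring p∈))) (weight-≥0 c)

-- Choice of the parameters and the two limit statements.

module Conclusion where

  open Scanning using (isoCount; Letter)
  open Outcomes using (wordOf)
  open CatalanNumbers using (bound)
  open Expectations
  open Excursions
  open Survival
  open BlockDecomposition
  open LawDomination
  open import Data.Nat as ℕ using (ℕ; zero; suc; z≤n; s≤s; _∸_)
  import Data.Nat.Properties as ℕ
  open import Data.Nat.DivMod using (m≡m%n+[m/n]*n; m%n<n; /-monoˡ-≤; m*n/n≡m)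
  import Data.Nat.Tactic.RingSolver as ℕRing
  import Data.Integer as ℤ
  import Data.Integer.Properties as ℤ
  open import Data.Rational
  open import Data.Rational.Properties
  import Data.Rational.Unnormalised as ℚᵘ
  import Data.Rational.Unnormalised.Properties as ℚᵘ
  open import Tactic.RingSolver using (solve-∀)

  open Expectation

  archimedean : ∀ {ε} → 0ℚ < ε → ∃[ e ] 1ℚ ≤ nat e * ε
  archimedean {mkℚ (ℤ.+ zero) d c}    0<ε = ⊥-elim (ℤ.<-irrefl refl (drop-*<* 0<ε))
  archimedean {mkℚ (ℤ.-[1+ a ]) d c}  0<ε = ⊥-elim (ℤ.<-asym (drop-*<* 0<ε) ℤ.-<+)
  -- A positive fraction is at least the reciprocal of its denominator `suc d`.
  archimedean {ε@(mkℚ (ℤ.+ suc a) d c)} _ = suc d , subst (λ k → 1ℚ ≤ k * ε) (sym (nat≡toℚ (suc d)))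
    (toℚᵘ-cancel-≤ (ℚᵘ.≤-trans le (ℚᵘ.≤-reflexive (ℚᵘ.≃-sym (ℚᵘ.≃-trans (toℚᵘ-homo-* (toℚ (suc d)) ε)
      (ℚᵘ.*-cong (toℚᵘ-toℚ (suc d)) ℚᵘ.≃-refl))))))
    where
    le : toℚᵘ 1ℚ ℚᵘ.≤ frac (suc d) 0 ℚᵘ.* toℚᵘ ε
    le = ℚᵘ.*≤* (ℤ.+≤+ (s≤s (ℕ.≤-trans (ℕ.≤-reflexive (trans (ℕ.+-identityʳ (d ℕ.+ 0)) (ℕ.+-identityʳ d)))
      (ℕ.≤-trans (ℕ.≤-trans (ℕ.m≤n+m d a) (ℕ.+-monoʳ-≤ a (ℕ.m≤m*n d (suc a)))) (ℕ.≤-reflexive (sym (ℕ.*-identityʳ (a ℕ.+ d ℕ.* suc a))))))))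

  suc≤2^ : ∀ k → suc k ℕ.≤ 2 ℕ.^ k
  suc≤2^ zero    = ℕ.≤-refl
  suc≤2^ (suc k) = ℕ.≤-trans (ℕ.+-mono-≤ (ℕ.m^n>0 2 k) (suc≤2^ k)) (ℕ.≤-reflexive (cong (2 ℕ.^ k ℕ.+_) (sym (ℕ.+-identityʳ (2 ℕ.^ k)))))

  expectation-neg : ∀ {A : Set} (Ω : List (ℚ × A)) X → expectation Ω (λ o → - X o) ≡ - expectation Ω X
  expectation-neg []            X = refl
  expectation-neg ((w , o) ∷ Ω) X = trans (cong (w * - X o +_) (expectation-neg Ω X)) (arith w (X o) (expectation Ω X))
    where
    arith : ∀ w x e → w * - x + - e ≡ - (w * x + e)
    arith = solve-∀ ℚ-ring

  scaled : ∀ s n x g c .{{_ : ℕ.NonZero n}} → nat s * (x - nat n * g) ≤ nat n * c → nat s * (x * recip n - g) ≤ c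
  scaled s n x g c le = subst₂ _≤_
    (trans (arith (nat s) x (nat n) (recip n) g) (trans (cong (λ z → nat s * (x * recip n - z * g)) (nat-recip n)) (cong (λ z → nat s * (x * recip n - z)) (*-identityˡ g))))
    (trans (arith′ (nat n) c (recip n)) (trans (cong (_* c) (nat-recip n)) (*-identityˡ c)))
    (*-monoʳ (recip-≥0 n) le)
    where
    arith : ∀ s x n r g → s * (x - n * g) * r ≡ s * (x * r - n * r * g)
    arith = solve-∀ ℚ-ring
    arith′ : ∀ n c r → n * c * r ≡ n * r * c
    arith′ = solve-∀ ℚ-ring

  scaled′ : ∀ s n x g c .{{_ : ℕ.NonZero n}} → nat s * (nat n * g - x) ≤ nat n * c → nat s * (g - x * recip n) ≤ c
  scaled′ s n x g c le = subst₂ _≤_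
    (trans (arith (nat s) x (nat n) (recip n) g) (trans (cong (λ z → nat s * (z * g - x * recip n)) (nat-recip n)) (cong (λ z → nat s * (z - x * recip n)) (*-identityˡ g))))
    (trans (arith′ (nat n) c (recip n)) (trans (cong (_* c) (nat-recip n)) (*-identityˡ c)))
    (*-monoʳ (recip-≥0 n) le)
    where
    arith : ∀ s x n r g → s * (n * g - x) * r ≡ s * (n * r * g - x * r)
    arith = solve-∀ ℚ-ring
    arith′ : ∀ n c r → n * c * r ≡ n * r * c
    arith′ = solve-∀ ℚ-ring

  module Concentration (s G H ℓ J Λ : ℕ) (0<s : 0 ℕ.< s) (G≡ : G ≡ 2 ℕ.* 4 ℕ.^ s) (H≡ : H ≡ G ℕ.* s)
                       (ℓ≡ : ℓ ≡ 4 ℕ.* (H ℕ.* H)) (J≡ : J ≡ H ℕ.* s) (Λ≡ : Λ ≡ J ℕ.* ℓ) where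

    open Blocks s G H ℓ J Λ 0<s G≡ H≡ ℓ≡ J≡ Λ≡

    -- The stand-in for γ: isolated arcs per vertex in a block, twice the number per letter since a
    -- vertex has two endpoints.
    g : ℚ
    g = density + density

    ℓ-g : nat ℓ * g ≡ (1ℚ + 1ℚ) * μ ℓ
    ℓ-g = trans (arith (nat ℓ) density) (cong ((1ℚ + 1ℚ) *_) ℓ-density)
      where
      arith : ∀ l d → l * (d + d) ≡ (1ℚ + 1ℚ) * (l * d)
      arith = solve-∀ ℚ-ring

    g≤γ : g ≤ γPartial ℓ
    g≤γ = *-cancel {nat ℓ} (nat->0 0<ℓ) (subst (_≤ nat ℓ * γPartial ℓ) (sym ℓ-g) (2μ≤ ℓ))

    -- The gap is due to undecided scans. Per letter they amount to at most 1/H in the mean, and `s`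
    -- is at most `H`.
    γ≤g : ∀ M → nat s * (γPartial M - g) ≤ 1ℚ + 1ℚ
    γ≤g M = *-cancel {nat ℓ} (nat->0 0<ℓ) (begin
      nat ℓ * (nat s * (γPartial M - g)) ≡⟨ arith₁ (nat ℓ) (nat s) (γPartial M) g ⟩
      nat s * (nat ℓ * γPartial M - nat ℓ * g) ≤⟨ *-monoˡ (nat-≥0 s) (+-mono-≤ (γ≤2μ+2υ ℓ M) (≤-reflexive (cong (λ z → - z) ℓ-g))) ⟩
      nat s * (((1ℚ + 1ℚ) * μ ℓ + (1ℚ + 1ℚ) * υ ℓ) - (1ℚ + 1ℚ) * μ ℓ) ≡⟨ arith₂ (nat s) (μ ℓ) (υ ℓ) ⟩
      (1ℚ + 1ℚ) * (nat s * υ ℓ) ≤⟨ *-monoˡ (nonNegative⁻¹ (1ℚ + 1ℚ)) (≤-trans (*-monoʳ υ-≥0 (nat-mono-≤ s≤H)) (subst (λ k → nat H * υ k ≤ nat k) (sym ℓ≡) (υ-bound H))) ⟩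
      (1ℚ + 1ℚ) * nat ℓ ≡⟨ *-comm (1ℚ + 1ℚ) (nat ℓ) ⟩
      nat ℓ * (1ℚ + 1ℚ) ∎)
      where
      open ≤-Reasoning
      s≤H : s ℕ.≤ H
      s≤H = ℕ.≤-trans (ℕ.≤-trans (ℕ.≤-reflexive (sym (ℕ.*-identityˡ s))) (ℕ.*-monoˡ-≤ s 0<G)) (ℕ.≤-reflexive (sym H≡))
      υ-≥0 : 0ℚ ≤ υ ℓ
      υ-≥0 = E-≥0 blockE (λ B → nat-≥0 _)
      arith₁ : ∀ l s p g → l * (s * (p - g)) ≡ s * (l * p - l * g)
      arith₁ = solve-∀ ℚ-ring
      arith₂ : ∀ s m u → s * (((1ℚ + 1ℚ) * m + (1ℚ + 1ℚ) * u) - (1ℚ + 1ℚ) * m) ≡ (1ℚ + 1ℚ) * (s * u)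
      arith₂ = solve-∀ ℚ-ring

    recip-s>0 : 0ℚ < recip s
    recip-s>0 = *-cancelˡ-<-nonNeg (nat s) {{nonNegative (nat-≥0 s)}}
      (subst₂ _<_ (sym (*-zeroʳ (nat s))) (sym (nat-recip s {{ℕ.>-nonZero 0<s}})) (positive⁻¹ 1ℚ))

    -- Scaled by `s`, the 14 is made of 11 for the distance from `y` to `g`, 2 for the distance from
    -- `g` up to any partial sum of γ, and 1 for the margin `recip s` that `AboveGamma` asks for.
    near-γ : ∀ ε y → nat 14 ≤ nat s * ε → nat s * (y - g) ≤ nat 11 → nat s * (g - y) ≤ nat 11 → NearGamma ε y
    near-γ ε y large above below = (ℓ , low) , (recip s , recip-s>0 , high)
      where
      14≡ : nat 14 ≡ nat 11 + nat 3
      14≡ = nat-+ 11 3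
      3≡ : nat 3 ≡ 1ℚ + (1ℚ + 1ℚ)
      3≡ = trans (nat-suc 2) (cong (1ℚ +_) nat-2)
      low : y - ε < γPartial ℓ
      low = *-cancelˡ-<-nonNeg (nat s) {{nonNegative (nat-≥0 s)}} (begin-strict
        nat s * (y - ε) ≡⟨ arith (nat s) y ε g ⟩
        nat s * (y - g) + nat s * g - nat s * ε ≤⟨ +-mono-≤ (+-monoˡ-≤ (nat s * g) above) (neg-antimono-≤ (subst (_≤ nat s * ε) 14≡ large)) ⟩
        nat 11 + nat s * g - (nat 11 + nat 3) ≡⟨ arith′ (nat 11) (nat s * g) (nat 3) ⟩
        nat s * g + - nat 3 <⟨ +-monoʳ-< (nat s * g) (neg-antimono-< (nat->0 (s≤s z≤n))) ⟩
        nat s * g + 0ℚ ≡⟨ +-identityʳ (nat s * g) ⟩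
        nat s * g ≤⟨ *-monoˡ (nat-≥0 s) g≤γ ⟩
        nat s * γPartial ℓ ∎)
        where
        open ≤-Reasoning
        arith : ∀ s y e g → s * (y - e) ≡ s * (y - g) + s * g - s * e
        arith = solve-∀ ℚ-ring
        arith′ : ∀ a b c → a + b - (a + c) ≡ b + - c
        arith′ = solve-∀ ℚ-ring
      high : ∀ M → γPartial M + recip s ≤ y + ε
      high M = *-cancel {nat s} (nat->0 0<s) (begin
        nat s * (γPartial M + recip s) ≡⟨ arith₁ (nat s) (γPartial M) (recip s) g ⟩
        nat s * g + nat s * (γPartial M - g) + nat s * recip s ≤⟨ +-mono-≤ (+-monoʳ-≤ (nat s * g) (γ≤g M)) (≤-reflexive (nat-recip s {{ℕ.>-nonZero 0<s}})) ⟩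
        nat s * g + (1ℚ + 1ℚ) + 1ℚ ≡⟨ arith₂ (nat s * g) ⟩
        nat s * g + (1ℚ + (1ℚ + 1ℚ)) ≡⟨ cong (nat s * g +_) (sym 3≡) ⟩
        nat s * g + nat 3 ≡⟨ arith₃ (nat s * g) (nat 3) (nat 11) ⟩
        nat s * g + - nat 11 + (nat 11 + nat 3) ≤⟨ +-mono-≤ (+-monoʳ-≤ (nat s * g) (neg-antimono-≤ below)) (subst (_≤ nat s * ε) 14≡ large) ⟩
        nat s * g + - (nat s * (g - y)) + nat s * ε ≡⟨ arith₄ (nat s) g y ε ⟩
        nat s * (y + ε) ∎)
        where
        open ≤-Reasoning
        arith₁ : ∀ s p r g → s * (p + r) ≡ s * g + s * (p - g) + s * r
        arith₁ = solve-∀ ℚ-ring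
        arith₂ : ∀ x → x + (1ℚ + 1ℚ) + 1ℚ ≡ x + (1ℚ + (1ℚ + 1ℚ))
        arith₂ = solve-∀ ℚ-ring
        arith₃ : ∀ x a b → x + a ≡ x + - b + (b + a)
        arith₃ = solve-∀ ℚ-ring
        arith₄ : ∀ s g y e → s * g + - (s * (g - y)) + s * e ≡ s * (y + e)
        arith₄ = solve-∀ ℚ-ring

    farOutcome : ℕ → ℕ → Outcome → Bool
    farOutcome K r o = farValue K r (isolated o)

    far-weight : ∀ n K r → K ℕ.* Λ ℕ.+ r ≡ 2 ℕ.* suc n →
      nat (2 ℕ.^ K) * weightOf (outcomes (suc n)) (farOutcome K r) ≤ nat (2 ℕ.* (bound (suc n) ℕ.* bound (suc n)))
    far-weight n K r N≡ = begin
      nat (2 ℕ.^ K) * weightOf (outcomes (suc n)) (farOutcome K r)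
        ≡⟨ cong (nat (2 ℕ.^ K) *_) (weightOf-cong (outcomes (suc n)) (λ p∈ → cong (farValue K r) (outcome-isolated n p∈))) ⟩
      nat (2 ℕ.^ K) * weightOf (outcomes (suc n)) (far K r ∘ wordOf)
        ≤⟨ *-monoˡ (nat-≥0 (2 ℕ.^ K)) (law-domination n (far K r)) ⟩
      nat (2 ℕ.^ K) * (B * 𝔼 (2 ℕ.* suc n) (indℚ ∘ far K r))
        ≡⟨ swap (nat (2 ℕ.^ K)) B (𝔼 (2 ℕ.* suc n) (indℚ ∘ far K r)) ⟩
      B * (nat (2 ℕ.^ K) * 𝔼 (2 ℕ.* suc n) (indℚ ∘ far K r))
        ≡⟨ cong (λ k → B * (nat (2 ℕ.^ K) * 𝔼 k (indℚ ∘ far K r))) (sym N≡) ⟩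
      B * (nat (2 ℕ.^ K) * 𝔼 (K ℕ.* Λ ℕ.+ r) (indℚ ∘ far K r))
        ≤⟨ *-monoˡ (nat-≥0 (2 ℕ.* (bound (suc n) ℕ.* bound (suc n)))) (far-rare K r) ⟩
      B * 1ℚ
        ≡⟨ *-identityʳ B ⟩
      B ∎
      where
      open ≤-Reasoning
      B = nat (2 ℕ.* (bound (suc n) ℕ.* bound (suc n)))
      swap : ∀ a b c → a * (b * c) ≡ b * (a * c)
      swap = solve-∀ ℚ-ring

    -- Superblocks are taken in groups of five. The density bound is a polynomial of degree four,
    -- and `k` groups give 2^(5k), at least the fifth power of k+1, one power more than needed to
    -- match it.
    P : ℕ
    P = 5 ℕ.* Λ

    0<P : 0 ℕ.< P
    0<P = ℕ.*-mono-< {0} {5} (s≤s z≤n) 0<Λ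

    instance
      nonZero-P : ℕ.NonZero P
      nonZero-P = ℕ.>-nonZero 0<P

    P⁴ : ℕ
    P⁴ = 2 ℕ.* ((P ℕ.* P) ℕ.* (P ℕ.* P))

    polynomial-bound : ∀ n k → suc (2 ℕ.* suc n) ℕ.≤ suc k ℕ.* P →
      2 ℕ.* (bound (suc n) ℕ.* bound (suc n)) ℕ.≤ (suc k ℕ.* suc k ℕ.* (suc k ℕ.* suc k)) ℕ.* P⁴
    polynomial-bound n k le = ℕ.≤-trans (ℕ.*-monoʳ-≤ 2 (ℕ.*-mono-≤ small small)) (ℕ.≤-reflexive (arith (suc k) P))
      where
      Q = suc k ℕ.* P
      small : bound (suc n) ℕ.≤ Q ℕ.* Q
      small = ℕ.*-mono-≤ (ℕ.≤-trans (s≤s (ℕ.≤-reflexive (sym (double (suc n))))) le)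
        (ℕ.≤-trans (s≤s (ℕ.m≤m+n (suc n) (suc n ℕ.+ 0))) le)
      arith : ∀ k p → 2 ℕ.* ((k ℕ.* p) ℕ.* (k ℕ.* p) ℕ.* ((k ℕ.* p) ℕ.* (k ℕ.* p))) ≡ (k ℕ.* k ℕ.* (k ℕ.* k)) ℕ.* (2 ℕ.* ((p ℕ.* p) ℕ.* (p ℕ.* p)))
      arith = ℕRing.solve-∀

    fifth-power : ∀ k → (suc k ℕ.* suc k ℕ.* (suc k ℕ.* suc k)) ℕ.* suc k ℕ.≤ 2 ℕ.^ (k ℕ.* 5)
    fifth-power k = ℕ.≤-trans (ℕ.*-mono-≤ (ℕ.*-mono-≤ (ℕ.*-mono-≤ h h) (ℕ.*-mono-≤ h h)) h)
      (ℕ.≤-reflexive (trans (arith (2 ℕ.^ k)) (ℕ.^-*-assoc 2 k 5)))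
      where
      h = suc≤2^ k
      arith : ∀ x → (x ℕ.* x ℕ.* (x ℕ.* x)) ℕ.* x ≡ x ℕ.* (x ℕ.* (x ℕ.* (x ℕ.* (x ℕ.* 1))))
      arith = ℕRing.solve-∀

    far-weight-linear : ∀ n k r → k ℕ.* 5 ℕ.* Λ ℕ.+ r ≡ 2 ℕ.* suc n → r ℕ.< P →
      nat (suc k) * weightOf (outcomes (suc n)) (farOutcome (k ℕ.* 5) r) ≤ nat P⁴
    far-weight-linear n k r N≡ r<P = *-cancel {nat k⁴} (nat->0 (s≤s z≤n)) (begin
      nat k⁴ * (nat (suc k) * w) ≡⟨ trans (sym (*-assoc (nat k⁴) (nat (suc k)) w)) (cong (_* w) (sym (nat-* k⁴ (suc k)))) ⟩
      nat (k⁴ ℕ.* suc k) * w ≤⟨ *-monoʳ (weightOf-≥0 (outcomes (suc n)) (farOutcome (k ℕ.* 5) r) (outcome-weight-≥0 n)) (nat-mono-≤ (fifth-power k)) ⟩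
      nat (2 ℕ.^ (k ℕ.* 5)) * w ≤⟨ far-weight n (k ℕ.* 5) r N≡ ⟩
      nat (2 ℕ.* (bound (suc n) ℕ.* bound (suc n))) ≤⟨ nat-mono-≤ (polynomial-bound n k size) ⟩
      nat (k⁴ ℕ.* P⁴) ≡⟨ nat-* k⁴ P⁴ ⟩
      nat k⁴ * nat P⁴ ∎)
      where
      open ≤-Reasoning
      k⁴ = suc k ℕ.* suc k ℕ.* (suc k ℕ.* suc k)
      w = weightOf (outcomes (suc n)) (farOutcome (k ℕ.* 5) r)
      size : suc (2 ℕ.* suc n) ℕ.≤ suc k ℕ.* P
      size = ℕ.≤-trans (s≤s (ℕ.≤-reflexive (sym N≡))) (ℕ.≤-trans (ℕ.≤-reflexive (cong suc (trans (ℕ.+-comm (k ℕ.* 5 ℕ.* Λ) r) (cong (r ℕ.+_) (ℕ.*-assoc k 5 Λ)))))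
        (ℕ.+-monoˡ-≤ (k ℕ.* P) r<P))

    -- A division of the 2(n+1) letters into superblocks and a rest, long enough for the far
    -- outcomes to be rare and with a rest that is negligible against n/s.
    record Scale (η : ℚ) (n : ℕ) : Set where
      field
        K r   : ℕ
        N≡    : K ℕ.* Λ ℕ.+ r ≡ 2 ℕ.* suc n
        sr≤n  : s ℕ.* r ℕ.≤ suc n
        rare  : weightOf (outcomes (suc n)) (farOutcome K r) < η

    scale-exists : ∀ {η} → 0ℚ < η → ∃[ N₀ ] (∀ n → N₀ ℕ.≤ n → Scale η n)
    scale-exists {η} 0<η = N₀ , λ n N₀≤n → record
      { K = quotient n ℕ.* 5 ; r = remainder n ; N≡ = N≡ n
      ; sr≤n = ℕ.≤-trans (ℕ.*-monoʳ-≤ s (ℕ.<⇒≤ (m%n<n (2 ℕ.* suc n) P))) (ℕ.≤-trans (ℕ.m≤n+m (s ℕ.* P) (Z ℕ.* P)) (ℕ.≤-trans N₀≤n (ℕ.n≤1+n n)))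
      ; rare = rare n N₀≤n }
      where
      e = proj₁ (archimedean 0<η)
      Z = e ℕ.* P⁴
      -- The first summand makes the quotient at least `Z`, hence the weight of far outcomes below
      -- `η`; the second makes `s` times the remainder, which is below `P`, at most `n`.
      N₀ = Z ℕ.* P ℕ.+ s ℕ.* P
      quotient remainder : ℕ → ℕ
      quotient n = (2 ℕ.* suc n) ℕ./ P
      remainder n = (2 ℕ.* suc n) ℕ.% P
      N≡ : ∀ n → quotient n ℕ.* 5 ℕ.* Λ ℕ.+ remainder n ≡ 2 ℕ.* suc n
      N≡ n = trans (trans (cong (ℕ._+ remainder n) (ℕ.*-assoc (quotient n) 5 Λ)) (ℕ.+-comm (quotient n ℕ.* P) (remainder n)))
        (sym (m≡m%n+[m/n]*n (2 ℕ.* suc n) P))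
      Z≤quotient : ∀ n → N₀ ℕ.≤ n → Z ℕ.≤ quotient n
      Z≤quotient n N₀≤n = subst (ℕ._≤ quotient n) (m*n/n≡m Z P) (/-monoˡ-≤ P (ℕ.≤-trans (ℕ.m≤m+n (Z ℕ.* P) (s ℕ.* P))
        (ℕ.≤-trans N₀≤n (ℕ.≤-trans (ℕ.n≤1+n n) (ℕ.m≤m+n (suc n) (suc n ℕ.+ 0))))))
      rare : ∀ n → N₀ ℕ.≤ n → weightOf (outcomes (suc n)) (farOutcome (quotient n ℕ.* 5) (remainder n)) < η
      rare n N₀≤n = ≰⇒> λ η≤w → <-irrefl refl (begin-strict
        nat (suc k) ≡⟨ *-identityʳ (nat (suc k)) ⟨
        nat (suc k) * 1ℚ ≤⟨ *-monoˡ (nat-≥0 (suc k)) (≤-trans (proj₂ (archimedean 0<η)) (*-monoˡ (nat-≥0 e) η≤w)) ⟩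
        nat (suc k) * (nat e * w) ≡⟨ swap (nat (suc k)) (nat e) w ⟩
        nat e * (nat (suc k) * w) ≤⟨ *-monoˡ (nat-≥0 e) (far-weight-linear n k (remainder n) (N≡ n) (m%n<n (2 ℕ.* suc n) P)) ⟩
        nat e * nat P⁴ ≡⟨ nat-* e P⁴ ⟨
        nat Z <⟨ nat-mono-< (s≤s (Z≤quotient n N₀≤n)) ⟩
        nat (suc k) ∎)
        where
        open ≤-Reasoning
        k = quotient n
        w = weightOf (outcomes (suc n)) (farOutcome (k ℕ.* 5) (remainder n))
        swap : ∀ a b c → a * (b * c) ≡ b * (a * c)
        swap = solve-∀ ℚ-ring

    module _ {η n} (S : Scale η n) where
      open Scale S

      centre : nat (K ℕ.* Λ ℕ.+ r) * density ≡ nat (suc n) * g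
      centre = trans (cong (λ k → nat k * density) N≡) (trans (cong (_* density) (trans (nat-* 2 (suc n)) (cong (_* nat (suc n)) nat-2))) (arith (nat (suc n)) density))
        where
        arith : ∀ n d → (1ℚ + 1ℚ) * n * d ≡ n * (d + d)
        arith = solve-∀ ℚ-ring

      -- With N twice the number of vertices, 4N contributes 8 per vertex and the leftover letters
      -- at most 1.
      tolerance-≤ : tolerance K r ≤ nat (suc n) * nat 9
      tolerance-≤ = ≤-trans (nat-mono-≤ (ℕ.≤-trans (ℕ.+-mono-≤ (ℕ.≤-reflexive (cong (4 ℕ.*_) N≡)) sr≤n) (ℕ.≤-reflexive (arith (suc n)))))
        (≤-reflexive (nat-* (suc n) 9))
        where
        arith : ∀ n → 4 ℕ.* (2 ℕ.* n) ℕ.+ n ≡ n ℕ.* 9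
        arith = ℕRing.solve-∀

      near-bounds : ∀ x → farValue K r x ≡ false →
        nat s * (nat x - nat (suc n) * g) ≤ nat (suc n) * nat 9 × nat s * (nat (suc n) * g - nat x) ≤ nat (suc n) * nat 9
      near-bounds x eq = ≤-trans (≤-reflexive (cong (λ c → nat s * (nat x - c)) (sym centre))) (≤-trans (proj₁ near) tolerance-≤)
                       , ≤-trans (≤-reflexive (cong (λ c → nat s * (c - nat x)) (sym centre))) (≤-trans (proj₂ near) tolerance-≤)
        where near = not-far⇒near K r x eq

      near-outcome : ∀ ε → nat 14 ≤ nat s * ε → ∀ o → T (not (farOutcome K r o)) → NearGamma ε (toℚ (isolated o) * inv (suc n))
      near-outcome ε large o t = subst (NearGamma ε) (cong₂ _*_ (nat≡toℚ (isolated o)) (recip≡inv (suc n)))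
        (near-γ ε (nat (isolated o) * recip (suc n)) large
          (≤-trans (scaled s (suc n) (nat (isolated o)) g (nat 9) (proj₁ near)) 9≤11)
          (≤-trans (scaled′ s (suc n) (nat (isolated o)) g (nat 9) (proj₂ near)) 9≤11))
        where
        T-not : ∀ {b} → T (not b) → b ≡ false
        T-not {false} _ = refl
        near = near-bounds (isolated o) (T-not t)
        9≤11 : nat 9 ≤ nat 11
        9≤11 = nat-mono-≤ (ℕ.m≤m+n 9 2)

      likely : 1ℚ - η < weightOf (outcomes (suc n)) (not ∘ farOutcome K r)
      likely = subst (1ℚ - η <_) (trans (cong (_- w) (trans (sym (mass-outcomes n)) (sym (weightOf-split (outcomes (suc n)) (farOutcome K r))))) (arith (weightOf (outcomes (suc n)) (not ∘ farOutcome K r)) w))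
        (+-monoʳ-< 1ℚ (neg-antimono-< rare))
        where
        w = weightOf (outcomes (suc n)) (farOutcome K r)
        arith : ∀ x w → x + w - w ≡ x
        arith = solve-∀ ℚ-ring

      module _ (sη≤1 : nat s * η ≤ 1ℚ) where

        private
          Ω = outcomes (suc n)
          X : Outcome → ℚ
          X o = toℚ (isolated o)
          m = nat (suc n)
          w = weightOf Ω (farOutcome K r)
          a = m * nat 9
          d = nat s * (m + m)

          a≥0 : 0ℚ ≤ a
          a≥0 = *-≥0 (nat-≥0 (suc n)) (nat-≥0 9)

          X-≤ : ∀ {p} → p ∈ Ω → nat (isolated (proj₂ p)) ≤ m + m
          X-≤ {p} p∈ = ≤-trans (nat-mono-≤ (ℕ.≤-trans (ℕ.≤-reflexive (outcome-isolated n p∈)) (ℕ.≤-trans (isoCount-≤ (wordOf (proj₂ p)))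
            (ℕ.≤-reflexive (trans (outcome-length n p∈) (double (suc n))))))) (≤-reflexive (nat-+ (suc n) (suc n)))

          mg-≥0 : 0ℚ ≤ m * g
          mg-≥0 = *-≥0 (nat-≥0 (suc n)) (+-≥0 density-≥0 density-≥0)

          mg-≤ : m * g ≤ m + m
          mg-≤ = ≤-trans (*-monoˡ (nat-≥0 (suc n)) (+-mono-≤ density-≤1 density-≤1)) (≤-reflexive (arith m))
            where
            arith : ∀ m → m * (1ℚ + 1ℚ) ≡ m + m
            arith = solve-∀ ℚ-ring

          far-bound : ∀ z → z ≤ m + m → nat s * z ≤ a + 1ℚ * d
          far-bound z z≤ = ≤-trans (*-monoˡ (nat-≥0 s) z≤) (≤-by a a≥0 (arith d a))
            where
            arith : ∀ d a → d + a ≡ a + 1ℚ * d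
            arith = solve-∀ ℚ-ring

          near-bound : ∀ {z} → z ≤ a → z ≤ a + 0ℚ * d
          near-bound {z} z≤ = subst (z ≤_) (arith a d) z≤
            where
            arith : ∀ a d → a ≡ a + 0ℚ * d
            arith = solve-∀ ℚ-ring

          upper-case : ∀ {p} → p ∈ Ω → ∀ b → farOutcome K r (proj₂ p) ≡ b → nat s * (nat (isolated (proj₂ p)) - m * g) ≤ a + indℚ b * d
          upper-case {p} p∈ false eq = near-bound (proj₁ (near-bounds (isolated (proj₂ p)) eq))
          upper-case {p} p∈ true  _  = far-bound _ (≤-trans (≤-by (m * g) mg-≥0 (arith (nat (isolated (proj₂ p))) (m * g))) (X-≤ p∈))
            where
            arith : ∀ x y → x - y + y ≡ x
            arith = solve-∀ ℚ-ring

          lower-case : ∀ {p} → p ∈ Ω → ∀ b → farOutcome K r (proj₂ p) ≡ b → nat s * (m * g - nat (isolated (proj₂ p))) ≤ a + indℚ b * d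
          lower-case {p} p∈ false eq = near-bound (proj₂ (near-bounds (isolated (proj₂ p)) eq))
          lower-case {p} p∈ true  _  = far-bound _ (≤-trans (≤-by (nat (isolated (proj₂ p))) (nat-≥0 (isolated (proj₂ p))) (arith (m * g) (nat (isolated (proj₂ p))))) mg-≤)
            where
            arith : ∀ x y → x - y + y ≡ x
            arith = solve-∀ ℚ-ring

          -- The 9 is the tolerance on near outcomes. A far outcome is off by at most two per vertex
          -- and the far ones weigh less than 1/s, which after scaling by `s` adds 2.
          error-≤ : a * 1ℚ + d * w ≤ m * nat 11
          error-≤ = begin
            a * 1ℚ + d * w ≡⟨ arith₁ m (nat 9) (nat s) w ⟩
            m * nat 9 + (m + m) * (nat s * w) ≤⟨ +-monoʳ-≤ (m * nat 9) (*-monoˡ (+-≥0 (nat-≥0 (suc n)) (nat-≥0 (suc n))) (≤-trans (*-monoˡ (nat-≥0 s) (<⇒≤ rare)) sη≤1)) ⟩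
            m * nat 9 + (m + m) * 1ℚ ≡⟨ arith₂ m (nat 9) ⟩
            m * (nat 9 + (1ℚ + 1ℚ)) ≡⟨ cong (m *_) (trans (cong (nat 9 +_) (sym nat-2)) (sym (nat-+ 9 2))) ⟩
            m * nat 11 ∎
            where
            open ≤-Reasoning
            arith₁ : ∀ m k s w → m * k * 1ℚ + s * (m + m) * w ≡ m * k + (m + m) * (s * w)
            arith₁ = solve-∀ ℚ-ring
            arith₂ : ∀ m k → m * k + (m + m) * 1ℚ ≡ m * (k + (1ℚ + 1ℚ))
            arith₂ = solve-∀ ℚ-ring

          error-mass : a * mass Ω + d * w ≤ m * nat 11
          error-mass = subst (λ z → a * z + d * w ≤ m * nat 11) (sym (mass-outcomes n)) error-≤

          upper-mean : nat s * (I (suc n) - m * g) ≤ m * nat 11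
          upper-mean = ≤-trans (≤-reflexive (cong (λ z → nat s * (I (suc n) - z)) (sym (trans (cong (m * g *_) (mass-outcomes n)) (*-identityʳ (m * g))))))
            (≤-trans (expectation-≤ Ω X (farOutcome K r) (nat s) (m * g) a d (outcome-weight-≥0 n)
              (λ {p} p∈ → subst (λ z → nat s * (z - m * g) ≤ a + indℚ (farOutcome K r (proj₂ p)) * d) (nat≡toℚ (isolated (proj₂ p))) (upper-case p∈ (farOutcome K r (proj₂ p)) refl))) error-mass)

          -- `expectation-≤` is one-sided, so it is applied to the negated count with the negated
          -- centre.
          lower-mean : nat s * (m * g - I (suc n)) ≤ m * nat 11
          lower-mean = ≤-trans (≤-reflexive rearrange) (≤-trans (expectation-≤ Ω (λ o → - X o) (farOutcome K r) (nat s) (- (m * g)) a d (outcome-weight-≥0 n)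
              (λ {p} p∈ → subst (_≤ a + indℚ (farOutcome K r (proj₂ p)) * d)
                (trans (cong (λ z → nat s * (m * g - z)) (nat≡toℚ (isolated (proj₂ p)))) (flip′ (nat s) (m * g) (X (proj₂ p)))) (lower-case p∈ (farOutcome K r (proj₂ p)) refl))) error-mass)
            where
            flip′ : ∀ s a x → s * (a - x) ≡ s * (- x - - a)
            flip′ = solve-∀ ℚ-ring
            expand : ∀ s a e → s * (a - e) ≡ s * (- e - - a * 1ℚ)
            expand = solve-∀ ℚ-ring
            rearrange : nat s * (m * g - I (suc n)) ≡ nat s * (expectation Ω (λ o → - X o) - - (m * g) * mass Ω)
            rearrange = trans (expand (nat s) (m * g) (I (suc n)))
              (cong₂ (λ e z → nat s * (e - - (m * g) * z)) (sym (expectation-neg Ω X)) (sym (mass-outcomes n)))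

        near-mean : ∀ ε → nat 14 ≤ nat s * ε → NearGamma ε (I (suc n) * inv (suc n))
        near-mean ε large = subst (λ z → NearGamma ε (I (suc n) * z)) (recip≡inv (suc n))
          (near-γ ε (I (suc n) * recip (suc n)) large (scaled s (suc n) (I (suc n)) g (nat 11) upper-mean) (scaled′ s (suc n) (I (suc n)) g (nat 11) lower-mean))

    shift : ∀ {P : ℕ → Set} N₀ → (∀ n → N₀ ℕ.≤ n → P (suc n)) → ∀ n → suc N₀ ℕ.≤ n → P n
    shift N₀ h (suc n) (s≤s le) = h n le

    -- For the mean, far outcomes of total weight `recip s` are rare enough, since their error is
    -- then of the same order as the tolerance; no second parameter is involved.
    mean-near-γ : ∀ ε → nat 14 ≤ nat s * ε → ∃[ N₀ ] (∀ n → N₀ ℕ.≤ n → NearGamma ε (I n * inv n))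
    mean-near-γ ε large = suc (proj₁ scales) , shift {λ n → NearGamma ε (I n * inv n)} (proj₁ scales)
      (λ n le → near-mean (proj₂ scales n le) (≤-reflexive (nat-recip s {{ℕ.>-nonZero 0<s}})) ε large)
      where
      scales : ∃[ N₀ ] (∀ n → N₀ ℕ.≤ n → Scale (recip s) n)
      scales = scale-exists recip-s>0

    probably-near-γ : ∀ ε → nat 14 ≤ nat s * ε → ∀ η → 0ℚ < η → ∃[ N₀ ] (∀ n → N₀ ℕ.≤ n →
      ProbGreater (outcomes n) (λ o → NearGamma ε (toℚ (isolated o) * inv n)) (1ℚ - η))
    probably-near-γ ε large η 0<η = suc (proj₁ scales) ,
      shift {λ n → ProbGreater (outcomes n) (λ o → NearGamma ε (toℚ (isolated o) * inv n)) (1ℚ - η)} (proj₁ scales)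
      (λ n le → likely-near n (proj₂ scales n le))
      where
      scales : ∃[ N₀ ] (∀ n → N₀ ℕ.≤ n → Scale η n)
      scales = scale-exists 0<η
      likely-near : ∀ n → Scale η n →
        ProbGreater (outcomes (suc n)) (λ o → NearGamma ε (toℚ (isolated o) * inv (suc n))) (1ℚ - η)
      likely-near n S = (λ o → not (farOutcome (Scale.K S) (Scale.r S) o)) , near-outcome S ε large , likely S

  resolution : ∀ {ε} → 0ℚ < ε → ∃[ s ] (0 ℕ.< s × nat 14 ≤ nat s * ε)
  resolution {ε} 0<ε with archimedean 0<ε
  ... | zero  , le = ⊥-elim (<-irrefl refl (<-≤-trans (positive⁻¹ 1ℚ) (≤-trans le (≤-reflexive (trans (cong (_* ε) nat-0) (*-zeroˡ ε))))))
  -- With `suc e` at least 1/ε, the multiple 14 provides the accuracy that `near-γ` needs.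
  ... | suc e , le = 14 ℕ.* suc e , s≤s z≤n , ≤-trans (≤-reflexive (sym (*-identityʳ (nat 14)))) (≤-trans (*-monoˡ (nat-≥0 14) le)
    (≤-reflexive (trans (sym (*-assoc (nat 14) (nat (suc e)) ε)) (cong (_* ε) (sym (nat-* 14 (suc e)))))))

  module At (s : ℕ) (0<s : 0 ℕ.< s) where
    private
      G H ℓ : ℕ
      G = 2 ℕ.* 4 ℕ.^ s
      H = G ℕ.* s
      ℓ = 4 ℕ.* (H ℕ.* H)
    open Concentration s G H ℓ (H ℕ.* s) (H ℕ.* s ℕ.* ℓ) 0<s refl refl refl refl refl public
      using (mean-near-γ; probably-near-γ)

open import Data.Nat using (ℕ; _≤_)
open import Data.Rational using (ℚ; 0ℚ; 1ℚ; _<_; _-_; _*_)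

open Conclusion using (resolution; module At)

theorem1p3 : ((ε : ℚ) → 0ℚ < ε → ∃[ N ] ((n : ℕ) → N ≤ n →
    NearGamma ε (I n * inv n)))
    ×
    ((ε : ℚ) → 0ℚ < ε → (η : ℚ) → 0ℚ < η → ∃[ N ] ((n : ℕ) → N ≤ n →
    ProbGreater (outcomes n) (λ o → NearGamma ε (toℚ (isolated o) * inv n)) (1ℚ - η)))
theorem1p3 = (λ ε 0<ε → let (s , 0<s , large) = resolution 0<ε in At.mean-near-γ s 0<s ε large)
           , (λ ε 0<ε η 0<η → let (s , 0<s , large) = resolution 0<ε in At.probably-near-γ s 0<s ε large η 0<η)
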